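{- Let $\mathcal{G}$ be a proper minor-closed class of graphs. Then $$\chi^f_{\Delta}(\mathcal{G}) = \chi^f_{\star}(\mathcal{G}) = \operatorname{tcn}(\mathcal{G}) - 1.$$
   Context: All graphs are finite and simple. Fractional colourings. For real $t\ge 1$, a graph $G$ is fractionally $t$-colourable with clustering $c$ if there exist $Y_1,\dots,Y_s\subseteq V(G)$ and $\alpha_1,\dots,\alpha_s\in[0,1]$ such that: - every connected component of $G[Y_i]$ has at most $c$ vertices; - $\sum_{i=1}^s \alpha_i \le t$; - $\sum_{i: v\in Y_i}\alpha_i \ge 1$ for every $v\in V(G)$. A graph $G$ is fractionally $t$-colourable with defect $d$ if the same holds with the first condition replaced by: every $G[Y_i]$ has maximum degree at most $d$. For a graph class $\mathcal{G}$: - The fractional clustered chromatic number $\chi^f_{\star}(\mathcal{G})$ is the infimum of $t>0$ such that there exists $c$ with every $G\in\mathcal{G}$ fractionally $t$-colourable with clustering $c$. - The fractional defective chromatic number $\chi^f_{\Delta}(\mathcal{G})$ is the infimum of $t>0$ such that there exists $d$ with every $G\in\mathcal{G}$ fractionally $t$-colourable with defect $d$. Trees and closures. The depth of a rooted tree is the maximum number of vertices on a root-to-leaf path. The closure of a rooted tree $T$ is obtained by adding an edge between every vertex and each of its descendants. $C\langle h,k\rangle$ is the closure of the complete $k$-ary tree of depth $h$. The tree-closure-number is $\operatorname{tcn}(\mathcal{G}) := \min\{h : \exists k\ C\langle h,k\rangle\notin\mathcal{G}\}$. A class is minor-closed if it contains every minor of each of its graphs. It is proper minor-closed if, in addition,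 some graph is not in it. -}

module Defs where

open import Level using (0ℓ)
open import Data.Nat as ℕ using (ℕ; zero; suc; _∸_; _<?_)
open import Data.Nat.Properties using (<-irrefl)
open import Data.Fin as Fin using (Fin; toℕ)
open import Data.Fin.Properties using () renaming (_≟_ to _≟F_)
open import Data.Bool using (Bool; true; false; T; if_then_else_)
open import Data.List using (List; []; _∷_; length; map; concatMap; allFin; cartesianProductWith)
open import Data.List.Membership.Propositional using (_∈_)
open import Data.List.Membership.Propositional.Properties using (∈-map⁺; ∈-concatMap⁺; ∈-allFin; ∈-cartesianProductWith⁺)
open import Data.List.Relation.Unary.Any as Any using (here)
open import Data.List.Relation.Binary.Prefix.Heterogeneous using (Prefix)
open import Data.List.Relation.Binary.Prefix.Heterogeneous.Properties using (prefix?)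
open import Data.Vec as Vec using (Vec; toList)
import Data.Vec.Properties as VecP
import Data.Product.Properties as ProdP
open import Data.Product using (Σ; ∃; ∃-syntax; _×_; _,_; proj₁; proj₂; swap)
open import Data.Sum using (_⊎_; inj₁; inj₂)
open import Data.Maybe using (Maybe; just)
import Data.Integer as ℤ
open import Data.Rational as ℚ using (ℚ; 0ℚ; 1ℚ; _+_) renaming (_≤_ to _≤ℚ_)
open import Relation.Nullary using (¬_; Dec; yes; no)
open import Relation.Nullary.Decidable using (_×-dec_; _⊎-dec_)
open import Relation.Binary.PropositionalEquality using (_≡_; refl)
open import Relation.Binary.Definitions using (DecidableEquality)
open import Relation.Unary using (Pred)

record Graph : Set₁ where
  field
    V        : Set
    _≟V_     : DecidableEquality V
    enum     : List V
    complete : ∀ v → v ∈ enum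
    E        : V → V → Set
    E?       : ∀ u v → Dec (E u v)
    E-sym    : ∀ {u v} → E u v → E v u
    E-irr    : ∀ {v} → ¬ E v v
open Graph public

AtMost : {A : Set} → ℕ → Pred A 0ℓ → Set
AtMost {A} c P = ∃[ xs ] (length xs ℕ.≤ c × (∀ a → P a → a ∈ xs))

data Reach (G : Graph) (P : Pred (V G) 0ℓ) : V G → V G → Set where
  stay : ∀ {v} → P v → Reach G P v v
  step : ∀ {u w v} → P u → E G u w → Reach G P w v → Reach G P u v

ClusteringAtMost : (G : Graph) → Pred (V G) 0ℓ → ℕ → Set
ClusteringAtMost G P c = ∀ v → P v → AtMost c (Reach G P v)

DefectAtMost : (G : Graph) → Pred (V G) 0ℓ → ℕ → Set
DefectAtMost G P d = ∀ v → P v → AtMost d (λ u → P u × E G v u)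

sumFin : (s : ℕ) → (Fin s → ℚ) → ℚ
sumFin zero    f = 0ℚ
sumFin (suc s) f = f Fin.zero + sumFin s (λ i → f (Fin.suc i))

FracColouring : (G : Graph) → (Pred (V G) 0ℓ → Set) → ℚ → Set
FracColouring G Good t =
  ∃[ s ] Σ (Fin s → V G → Bool) λ Y → Σ (Fin s → ℚ) λ α →
      (∀ i → Good (λ v → T (Y i v)))
    × (∀ i → 0ℚ ≤ℚ α i × α i ≤ℚ 1ℚ)
    × sumFin s α ≤ℚ t
    × (∀ v → 1ℚ ≤ℚ sumFin s (λ i → if Y i v then α i else 0ℚ))

FracClustered : Graph → ℚ → ℕ → Set
FracClustered G t c = FracColouring G (λ P → ClusteringAtMost G P c) t

FracDefective : Graph → ℚ → ℕ → Set
FracDefective G t d = FracColouring G (λ P → DefectAtMost G P d) t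

GraphClass : Set₁
GraphClass = Graph → Set

-- H is a minor of G: a model of H in G given by (disjoint) branch sets
-- φ⁻¹(just x), each nonempty and connected, with an edge of G between
-- the branch sets of any two adjacent vertices of H.
record _≼_ (H G : Graph) : Set where
  field
    φ         : V G → Maybe (V H)
    nonempty  : ∀ x → ∃[ g ] (φ g ≡ just x)
    connected : ∀ x g g' → φ g ≡ just x → φ g' ≡ just x →
                Reach G (λ u → φ u ≡ just x) g g'
    edges     : ∀ x y → E H x y →
                ∃[ g ] ∃[ g' ] (φ g ≡ just x × φ g' ≡ just y × E G g g')

MinorClosed : GraphClass → Set₁
MinorClosed 𝒢 = ∀ G H → 𝒢 G → H ≼ G → 𝒢 H

ProperClass : GraphClass → Set₁
ProperClass 𝒢 = ∃[ G ] (¬ 𝒢 G)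

-- Closure C⟨h,k⟩ of the complete k-ary tree of depth h.
-- Vertices: words over Fin k of length < h (the root is the empty word);
-- a vertex u is a descendant of w iff w is a proper prefix of u.

allVecs : ∀ k l → List (Vec (Fin k) l)
allVecs k zero    = Vec.[] ∷ []
allVecs k (suc l) = cartesianProductWith Vec._∷_ (allFin k) (allVecs k l)

allVecs-complete : ∀ k l (v : Vec (Fin k) l) → v ∈ allVecs k l
allVecs-complete k zero    Vec.[]       = here refl
allVecs-complete k (suc l) (x Vec.∷ xs) =
  ∈-cartesianProductWith⁺ Vec._∷_ (∈-allFin x) (allVecs-complete k l xs)

TreeV : ℕ → ℕ → Set
TreeV h k = Σ (Fin h) λ l → Vec (Fin k) (toℕ l)

treeEnum : ∀ h k → List (TreeV h k)
treeEnum h k = concatMap (λ l → map (l ,_) (allVecs k (toℕ l))) (allFin h)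

treeEnum-complete : ∀ h k (v : TreeV h k) → v ∈ treeEnum h k
treeEnum-complete h k (l , w) =
  ∈-concatMap⁺ (λ l′ → map (l′ ,_) (allVecs k (toℕ l′))) (Any.map (λ { refl → ∈-map⁺ (l ,_) (allVecs-complete k (toℕ l) w) }) (∈-allFin l))

Anc : ∀ {h k} → TreeV h k → TreeV h k → Set
Anc (l , u) (m , w) = Prefix _≡_ (toList u) (toList w) × toℕ l ℕ.< toℕ m

Anc? : ∀ {h k} (a b : TreeV h k) → Dec (Anc a b)
Anc? (l , u) (m , w) = prefix? _≟F_ (toList u) (toList w) ×-dec (toℕ l <? toℕ m)

closure : ℕ → ℕ → Graph
closure h k = record
  { V        = TreeV h k
  ; _≟V_     = ProdP.≡-dec _≟F_ (VecP.≡-dec _≟F_)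
  ; enum     = treeEnum h k
  ; complete = treeEnum-complete h k
  ; E        = λ a b → Anc a b ⊎ Anc b a
  ; E?       = λ a b → Anc? a b ⊎-dec Anc? b a
  ; E-sym    = λ { (inj₁ p) → inj₂ p ; (inj₂ p) → inj₁ p }
  ; E-irr    = λ { (inj₁ (_ , p)) → <-irrefl refl p ; (inj₂ (_ , p)) → <-irrefl refl p }
  }

C⟨_,_⟩ : ℕ → ℕ → Graph
C⟨ h , k ⟩ = closure h k

IsTcn : GraphClass → ℕ → Set
IsTcn 𝒢 h = (∃[ k ] ¬ 𝒢 C⟨ h , k ⟩) × (∀ h' → h' ℕ.< h → ∀ k → 𝒢 C⟨ h' , k ⟩)

-- "The fractional (clustered/defective) chromatic number of 𝒢 equals r",
-- i.e. inf { t > 0 : ∃ c. ∀ G ∈ 𝒢. Col G t c } = r, expressed via rational t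
-- (the set of admissible t is upward closed, so this characterises the infimum).

InfEquals : GraphClass → (Graph → ℚ → ℕ → Set) → ℕ → Set₁
InfEquals 𝒢 Col r =
    (∀ (t : ℚ) → 0ℚ ℚ.< t → (ℤ.+ r ℚ./ 1) ℚ.< t → ∃[ c ] (∀ G → 𝒢 G → Col G t c))
  × (∀ (t : ℚ) → 0ℚ ℚ.< t → t ℚ.< (ℤ.+ r ℚ./ 1) → ¬ (∃[ c ] (∀ G → 𝒢 G → Col G t c)))

FracClusteredChromaticNumber≡ : GraphClass → ℕ → Set₁
FracClusteredChromaticNumber≡ 𝒢 r = InfEquals 𝒢 FracClustered r

FracDefectiveChromaticNumber≡ : GraphClass → ℕ → Set₁
FracDefectiveChromaticNumber≡ 𝒢 r = InfEquals 𝒢 FracDefective r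

{-# OPTIONS --safe #-}
-- Lower bound: give all levels of C⟨ h - 1 , k ⟩ the same weight. Below a vertex of a set of defect d only d of the
-- k subtrees meet the set, so for large k such a set has hardly more than the weight of one level.
--
-- Upper bound: by multiplicative weights it suffices to find, for every vertex weighting of a graph without a
-- C⟨ h , k ⟩ minor, a set of bounded clustering with almost 1 / (h - 1) of the weight. Excluding a clique minor, the
-- vertices have a rank π for which few vertices are weakly reachable within distance ρ (polynomially many in ρ).
-- Deleting a small fraction of the weight, no vertex is outweighed by those weakly reaching it, and the weights fall
-- into levels separated by large factors. If much weight lies on vertices that see at least h - 1 higher levels
-- (by short paths through vertices that are no higher than themselves), then every popular chain of seen vertices
-- branches a lot at each of its levels, and a greedy choice yields a C⟨ h , k ⟩ minor. So we may assume
-- that at most h - 2 higher levels are seen. Among many scales there is one at which what a typical vertex sees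
-- does not change on passing to the next scale, so that adjacent vertices agree on what lies beyond the higher one.
-- Deleting a few levels keeps the chains of seen levels short; then colouring each vertex greedily, by the tree
-- of level sequences it sees, uses h - 1 colours and separates adjacent vertices of different levels.
-- Inside one level the weights are comparable, and region growing from vertices of least rank cuts the heaviest
-- colour class into bounded clusters.
module Submission where

open import Defs
open import Data.Nat
open import Data.Nat.Properties
open import Data.Nat.Tactic.RingSolver using (solve-∀)
open import Data.Fin as Fin using (Fin; zero; suc; toℕ; fromℕ<)
import Data.Fin.Properties as FinP
open import Data.Bool using (Bool; true; false; if_then_else_; T)
open import Data.List using (List; []; _∷_; _++_; length; map; take; cartesianProductWith; lookup; deduplicate; drop)
open import Data.Nat.ListAction using (sum)
open import Data.List.Membership.Propositional using (_∈_; lose)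
open import Data.List.Relation.Unary.Any as Any using (here; there)
open import Data.Product using (Σ; ∃; ∃-syntax; _×_; _,_; proj₁; proj₂)
open import Data.Sum using (_⊎_; inj₁; inj₂; [_,_]′)
open import Data.Empty using (⊥; ⊥-elim)
open import Function using (_∘_; id; case_of_)
open import Relation.Nullary using (¬_; Dec; yes; no; does)
open import Relation.Nullary.Decidable using (_×-dec_; _⊎-dec_; ¬?; _→-dec_; toSum)
open import Relation.Unary using (Decidable)
open import Relation.Binary.PropositionalEquality hiding ([_])
open import Data.Maybe using (Maybe; just; nothing)
open import Data.Maybe.Properties using (just-injective)
open import Data.List.Properties as ListP using (length-++; length-take; length-map; ∷-injective)
open import Data.List.Membership.Propositional.Properties using (∈-++⁺ˡ; ∈-++⁺ʳ; ∈-++⁻; ∈-map⁺; ∈-cartesianProductWith⁺; ∈-deduplicate⁺; ∈-lookup)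
open import Data.Unit using (⊤; tt)
open import Relation.Binary.Definitions using (tri<; tri≈; tri>)
import Data.List.Relation.Unary.All as All
open import Data.Bool.Properties using (¬-not) renaming (_≟_ to _≟B_)
open import Data.Nat.DivMod using (m≡m%n+[m/n]*n; m%n<n)
import Data.Integer as ℤ
import Data.Integer.Properties as ℤP
open import Data.Rational as ℚ using (ℚ; 0ℚ; 1ℚ; mkℚ)
import Data.Rational.Properties as ℚP
import Data.Rational.Unnormalised as ℚᵘ
import Data.Rational.Unnormalised.Properties as ℚᵘP
import Data.Nat.Coprimality as Coprime
open import Data.List.Relation.Unary.Unique.DecPropositional.Properties using (deduplicate-!)
open import Data.List.Relation.Unary.Unique.Propositional using (Unique)
open import Data.List.Relation.Unary.AllPairs using (_∷_)
open import Data.List.Relation.Unary.Any.Properties using (lookup-index)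
open import Data.List.Relation.Binary.Prefix.Heterogeneous using (Prefix; []; _∷_)
open import Data.Vec as Vec using (Vec; toList; fromList)
open import Data.Vec.Properties as VecP using (length-toList; toList∘fromList)

-- Finite sums and weights

-- Region growing needs a radius `ρ` with `(1 + 1 / Q) ^ ρ` above `M`, while `M` itself is `Q` times
-- the bound on the vertices weakly reachable within `ρ`. A bound polynomial in `ρ` breaks this
-- circle. Rank and weight are unrelated at the outset; the levels reconcile them. On a short walk
-- through surviving vertices the one of least rank is weakly reached from both ends, so neither end
-- outweighs it by more than a factor `M`. As `M < Γ`, an end in a level above all other vertices of
-- the walk must be that vertex. So strong reachability, which speaks of levels alone, inherits the
-- bounds on weak reachability. The colour of a vertex is read off a tree of bounded depth, so that
-- stability can be had by counting. The cut is harmless if no chain of unmarked levels runs that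
-- deep, and this is why levels are deleted: at random, with the choices then fixed by conditional
-- expectations. That good sets for all weightings yield a fractional colouring is linear
-- programming duality; multiplicative weights make it explicit, with equal rational weights.

∑ : ∀ {n} → (Fin n → ℕ) → ℕ
∑ {zero}  f = 0
∑ {suc n} f = f zero + ∑ (f ∘ suc)

∑-cong : ∀ {n} {f g : Fin n → ℕ} → (∀ i → f i ≡ g i) → ∑ f ≡ ∑ g
∑-cong {zero}  e = refl
∑-cong {suc n} e = cong₂ _+_ (e zero) (∑-cong (e ∘ suc))

∑-mono : ∀ {n} {f g : Fin n → ℕ} → (∀ i → f i ≤ g i) → ∑ f ≤ ∑ g
∑-mono {zero}  e = z≤n
∑-mono {suc n} e = +-mono-≤ (e zero) (∑-mono (e ∘ suc))

+-interchange : ∀ a b c d → (a + b) + (c + d) ≡ (a + c) + (b + d)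
+-interchange = solve-∀

*-swap : ∀ a b c → a * (b * c) ≡ b * (a * c)
*-swap = solve-∀

∑-+ : ∀ {n} (f g : Fin n → ℕ) → ∑ (λ i → f i + g i) ≡ ∑ f + ∑ g
∑-+ {zero}  f g = refl
∑-+ {suc n} f g = trans (cong (f zero + g zero +_) (∑-+ (f ∘ suc) (g ∘ suc)))
                        (+-interchange (f zero) (g zero) _ _)

∑-*ˡ : ∀ {n} c (f : Fin n → ℕ) → ∑ (λ i → c * f i) ≡ c * ∑ f
∑-*ˡ {zero}  c f = sym (*-zeroʳ c)
∑-*ˡ {suc n} c f = trans (cong (c * f zero +_) (∑-*ˡ c (f ∘ suc))) (sym (*-distribˡ-+ c (f zero) _))

∑-const : ∀ n c → ∑ {n} (λ _ → c) ≡ n * c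
∑-const zero    c = refl
∑-const (suc n) c = cong (c +_) (∑-const n c)

∑-0 : ∀ {n} {f : Fin n → ℕ} → (∀ i → f i ≡ 0) → ∑ f ≡ 0
∑-0 {n} e = trans (∑-cong e) (trans (∑-const n 0) (*-zeroʳ n))

∑-swap : ∀ {m n} (f : Fin m → Fin n → ℕ) → ∑ (λ i → ∑ (f i)) ≡ ∑ (λ j → ∑ (λ i → f i j))
∑-swap {zero}  {n} f = sym (∑-0 {n} (λ _ → refl))
∑-swap {suc m} {n} f = trans (cong (∑ (f zero) +_) (∑-swap (f ∘ suc)))
                         (sym (∑-+ (f zero) (λ j → ∑ (λ i → f (suc i) j))))

∑-≥ : ∀ {n} (f : Fin n → ℕ) i → f i ≤ ∑ f
∑-≥ f zero    = m≤m+n _ _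
∑-≥ f (suc i) = ≤-trans (∑-≥ (f ∘ suc) i) (m≤n+m _ (f zero))

∑-mono-< : ∀ {n} {f g : Fin n → ℕ} (i : Fin n) → (∀ i → f i ≤ g i) → f i < g i → ∑ f < ∑ g
∑-mono-< zero    le lt = +-mono-<-≤ lt (∑-mono (le ∘ suc))
∑-mono-< (suc i) le lt = +-mono-≤-< (le zero) (∑-mono-< i (le ∘ suc) lt)

≤⊎> : ∀ a b → (a ≤ b) ⊎ (b < a)
≤⊎> a b with a ≤? b
... | yes p = inj₁ p
... | no  p = inj₂ (≰⇒> p)

∑-min : ∀ {n} (f : Fin n → ℕ) X → 0 < n → ∑ f ≤ X → ∃[ i ] n * f i ≤ X
∑-min {n} f X n>0 le with FinP.any? (λ i → n * f i ≤? X)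
... | yes p = p
... | no ¬p = ⊥-elim (<-irrefl refl (begin-strict
    n * X               <⟨ *-monoʳ-< n {{>-nonZero n>0}} (n<1+n X) ⟩
    n * suc X           ≡⟨ sym (∑-const n (suc X)) ⟩
    ∑ {n} (λ _ → suc X) ≤⟨ ∑-mono (λ i → ≰⇒> (λ q → ¬p (i , q))) ⟩
    ∑ (λ i → n * f i)   ≡⟨ ∑-*ˡ n f ⟩
    n * ∑ f             ≤⟨ *-monoʳ-≤ n le ⟩
    n * X ∎))
  where open ≤-Reasoning

∑-max : ∀ {n} (f : Fin n → ℕ) X → 0 < n → X ≤ ∑ f → ∃[ i ] X ≤ n * f i
∑-max {n} f X n>0 le with FinP.any? (λ i → X ≤? n * f i)
... | yes p = p
... | no ¬p = ⊥-elim (<-irrefl refl (begin-strict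
    n * ∑ f                    ≡⟨ sym (∑-*ˡ n f) ⟩
    ∑ (λ i → n * f i)          <⟨ lem n n>0 (λ i → n * f i) (λ i → ≰⇒> (λ q → ¬p (i , q))) ⟩
    ∑ {n} (λ _ → X)            ≡⟨ ∑-const n X ⟩
    n * X                      ≤⟨ *-monoʳ-≤ n le ⟩
    n * ∑ f ∎))
  where
  open ≤-Reasoning
  lem : ∀ n → 0 < n → (g : Fin n → ℕ) → (∀ i → g i < X) → ∑ g < ∑ {n} (λ _ → X)
  lem (suc n) _ g h = +-mono-<-≤ (h zero) (∑-mono (<⇒≤ ∘ h ∘ suc))

ind : ∀ {A : Set} → Dec A → ℕ → ℕ
ind d x = if does d then x else 0

module _ {A : Set} where
  ind-yes : (d : Dec A) → ∀ {x} → A → ind d x ≡ x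
  ind-yes (yes _) a = refl
  ind-yes (no ¬a) a = ⊥-elim (¬a a)

  ind-no : (d : Dec A) → ∀ {x} → ¬ A → ind d x ≡ 0
  ind-no (yes a) ¬a = ⊥-elim (¬a a)
  ind-no (no _)  ¬a = refl

  ind-≤ : (d : Dec A) → ∀ {x} → ind d x ≤ x
  ind-≤ (yes _) = ≤-refl
  ind-≤ (no _)  = z≤n

  ind-≤′ : (d : Dec A) → ∀ {x y} → (A → x ≤ y) → ind d x ≤ y
  ind-≤′ (yes a) f = f a
  ind-≤′ (no _)  f = z≤n

  ind-pos : (d : Dec A) → ∀ {x} → 0 < ind d x → A × 0 < x
  ind-pos (yes a) p = a , p

  ind-* : (d : Dec A) → ∀ c x → c * ind d x ≡ ind d (c * x)
  ind-* (yes _) c x = refl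
  ind-* (no _)  c x = *-zeroʳ c

  ind-∑ : (d : Dec A) → ∀ {n} (f : Fin n → ℕ) → ind d (∑ f) ≡ ∑ (λ i → ind d (f i))
  ind-∑ (yes _) f = refl
  ind-∑ (no _) {n} f = sym (∑-0 {n} (λ _ → refl))

ind-mono : ∀ {A B : Set} (d : Dec A) (e : Dec B) → ∀ {x y} → (A → B) → (A → x ≤ y) → ind d x ≤ ind e y
ind-mono (yes a) e f g = ≤-trans (g a) (≤-reflexive (sym (ind-yes e (f a))))
ind-mono (no _)  e f g = z≤n

ind-⊎ : ∀ {A B C : Set} (d : Dec A) (e : Dec B) (h : Dec C) → ∀ {x} → (A → B ⊎ C) → ind d x ≤ ind e x + ind h x
ind-⊎ (no _)  e h f = z≤n
ind-⊎ (yes a) e h f with f a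
... | inj₁ b = ≤-trans (≤-reflexive (sym (ind-yes e b))) (m≤m+n _ _)
... | inj₂ c = ≤-trans (≤-reflexive (sym (ind-yes h c))) (m≤n+m _ _)

choose : ∀ {A : Set} → Dec A → ℕ → ℕ → ℕ
choose d a b = if does d then a else b

choose-cases : ∀ {A : Set} (d : Dec A) {a b} → (A × choose d a b ≡ a) ⊎ (¬ A × choose d a b ≡ b)
choose-cases (yes p) = inj₁ (p , refl)
choose-cases (no ¬p) = inj₂ (¬p , refl)

if-yes : ∀ {A B : Set} (d : Dec A) {x y : B} → A → (if does d then x else y) ≡ x
if-yes (yes _) a = refl
if-yes (no ¬a) a = ⊥-elim (¬a a)

if-no : ∀ {A B : Set} (d : Dec A) {x y : B} → ¬ A → (if does d then x else y) ≡ y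
if-no (yes a) ¬a = ⊥-elim (¬a a)
if-no (no _)  ¬a = refl

wt : ∀ {n} → (Fin n → ℕ) → {P : Fin n → Set} → Decidable P → ℕ
wt w P? = ∑ (λ v → ind (P? v) (w v))

wt-≤ : ∀ {n} (w : Fin n → ℕ) {P : Fin n → Set} (P? : Decidable P) → wt w P? ≤ ∑ w
wt-≤ w P? = ∑-mono (λ v → ind-≤ (P? v))

wt-mono : ∀ {n} (w : Fin n → ℕ) {P Q : Fin n → Set} (P? : Decidable P) (Q? : Decidable Q) →
          (∀ v → P v → Q v) → wt w P? ≤ wt w Q?
wt-mono w P? Q? f = ∑-mono (λ v → ind-mono (P? v) (Q? v) (f v) (λ _ → ≤-refl))

wt-⊎ : ∀ {n} (w : Fin n → ℕ) {P Q R : Fin n → Set} (P? : Decidable P) (Q? : Decidable Q) (R? : Decidable R) →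
       (∀ v → P v → Q v ⊎ R v) → wt w P? ≤ wt w Q? + wt w R?
wt-⊎ w P? Q? R? f = ≤-trans (∑-mono (λ v → ind-⊎ (P? v) (Q? v) (R? v) (f v)))
                            (≤-reflexive (∑-+ (λ v → ind (Q? v) (w v)) (λ v → ind (R? v) (w v))))

wt-all : ∀ {n} (w : Fin n → ℕ) {P Q : Fin n → Set} (P? : Decidable P) (Q? : Decidable Q) →
       (∀ v → P v ⊎ Q v) → ∑ w ≤ wt w P? + wt w Q?
wt-all w P? Q? f = ≤-trans (∑-mono (λ v → ≤-trans (≤-reflexive (sym (ind-yes {A = _} (yes (f v)) (f v))))
                                                   (ind-⊎ (yes (f v)) (P? v) (Q? v) id)))
                            (≤-reflexive (∑-+ (λ v → ind (P? v) (w v)) (λ v → ind (Q? v) (w v))))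

∑-ind-≡ : ∀ {n} (f : Fin n → ℕ) (x : Fin n) → ∑ (λ v → ind (v FinP.≟ x) (f v)) ≤ f x
∑-ind-≡ {suc n} f zero = ≤-reflexive (trans (cong (f zero +_) (∑-0 {n} (λ i → refl))) (+-identityʳ _))
∑-ind-≡ {suc n} f (suc x) = ≤-trans (∑-mono (λ v → ind-mono (suc v FinP.≟ suc x) (v FinP.≟ x) FinP.suc-injective (λ _ → ≤-refl)))
                              (∑-ind-≡ (f ∘ suc) x)

cover : ∀ {n} {P : Fin n → Set} (P? : Decidable P) (f : Fin n → ℕ) (xs : List (Fin n)) →
        (∀ v → P v → v ∈ xs) → ∑ (λ v → ind (P? v) (f v)) ≤ sum (map f xs)
cover {n} P? f [] h = ≤-reflexive (∑-0 {n} (λ v → ind-no (P? v) (λ p → case[] (h v p))))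
  where case[] : ∀ {v : Fin n} → v ∈ [] → ⊥
        case[] ()
cover {n} {P} P? f (x ∷ xs) h = begin
  ∑ (λ v → ind (P? v) (f v))
    ≤⟨ ∑-mono (λ v → ind-⊎ (P? v) (v FinP.≟ x) (P? v ×-dec ¬? (v FinP.≟ x)) (λ p → dec v p)) ⟩
  ∑ (λ v → ind (v FinP.≟ x) (f v) + ind (P? v ×-dec ¬? (v FinP.≟ x)) (f v))
    ≡⟨ ∑-+ (λ v → ind (v FinP.≟ x) (f v)) (λ v → ind (P? v ×-dec ¬? (v FinP.≟ x)) (f v)) ⟩
  ∑ (λ v → ind (v FinP.≟ x) (f v)) + ∑ (λ v → ind (P? v ×-dec ¬? (v FinP.≟ x)) (f v))
    ≤⟨ +-mono-≤ (∑-ind-≡ f x) (cover (λ v → P? v ×-dec ¬? (v FinP.≟ x)) f xs (λ v (p , q) → tail∈ v q (h v p))) ⟩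
  f x + sum (map f xs) ∎
  where
  open ≤-Reasoning
  dec : ∀ v → P v → (v ≡ x) ⊎ (P v × ¬ v ≡ x)
  dec v p with v FinP.≟ x
  ... | yes e = inj₁ e
  ... | no e  = inj₂ (p , e)
  tail∈ : ∀ v → ¬ v ≡ x → v ∈ x ∷ xs → v ∈ xs
  tail∈ v q (here e)  = ⊥-elim (q e)
  tail∈ v q (there i) = i

sum-≤ : ∀ {A : Set} (f : A → ℕ) c (xs : List A) → (∀ x → x ∈ xs → f x ≤ c) → sum (map f xs) ≤ length xs * c
sum-≤ f c []       h = z≤n
sum-≤ f c (x ∷ xs) h = +-mono-≤ (h x (here refl)) (sum-≤ f c xs (λ y i → h y (there i)))

# : (β : ℕ) → {P : ℕ → Set} → Decidable P → ℕ
# zero    P? = 0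
# (suc β) P? = ind (P? β) 1 + # β P?

#-mono : ∀ β {P Q : ℕ → Set} (P? : Decidable P) (Q? : Decidable Q) → (∀ x → x < β → P x → Q x) → # β P? ≤ # β Q?
#-mono zero    P? Q? f = z≤n
#-mono (suc β) P? Q? f = +-mono-≤ (ind-mono (P? β) (Q? β) (f β ≤-refl) (λ _ → ≤-refl))
                                  (#-mono β P? Q? (λ x l → f x (m<n⇒m<1+n l)))

#-remove : ∀ β {P Q : ℕ → Set} (P? : Decidable P) (Q? : Decidable Q) a → a < β → P a → ¬ Q a →
           (∀ x → x < β → Q x → P x) → # β Q? < # β P?
#-remove (suc β) P? Q? a a<β p ¬q f with a ≟ β
... | yes refl = ≤-trans (s≤s (+-monoˡ-≤ _ (≤-reflexive (ind-no (Q? β) ¬q))))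
                   (≤-trans (s≤s (#-mono β Q? P? (λ x l → f x (m<n⇒m<1+n l))))
                     (+-monoˡ-≤ _ (≤-reflexive (sym (ind-yes (P? β) p)))))
... | no a≢β = +-mono-≤-< (ind-mono (Q? β) (P? β) (f β ≤-refl) (λ _ → ≤-refl))
                 (#-remove β P? Q? a (≤∧≢⇒< (s≤s⁻¹ a<β) a≢β) p ¬q (λ x l → f x (m<n⇒m<1+n l)))

-- Walks

module Walks {n : ℕ} (E : Fin n → Fin n → Set) (E? : ∀ u v → Dec (E u v))
             (E-sym : ∀ {u v} → E u v → E v u) where

  -- The last vertex need not satisfy P, and ℓ is only an upper bound on the length.
  data Walk (P : Fin n → Set) : ℕ → Fin n → Fin n → Set where
    here : ∀ {ℓ v} → Walk P ℓ v v
    step : ∀ {ℓ v w u} → P v → E v w → Walk P ℓ w u → Walk P (suc ℓ) v u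

  walk? : ∀ {P} → Decidable P → ∀ ℓ v u → Dec (Walk P ℓ v u)
  walk? P? ℓ v u with v FinP.≟ u
  walk? P? ℓ v u | yes refl = yes here
  walk? P? zero v u | no ne = no (λ { here → ne refl })
  walk? P? (suc ℓ) v u | no ne with P? v ×-dec FinP.any? (λ w → E? v w ×-dec walk? P? ℓ w u)
  ... | yes (p , w , e , k) = yes (step p e k)
  ... | no q = no (λ { here → ne refl ; (step p e k) → q (p , _ , e , k) })

  walk-map : ∀ {P Q : Fin n → Set} {ℓ v u} → (∀ {x} → P x → Q x) → Walk P ℓ v u → Walk Q ℓ v u
  walk-map f here         = here
  walk-map f (step p e k) = step (f p) e (walk-map f k)

  walk-≤ : ∀ {P ℓ ℓ′ v u} → ℓ ≤ ℓ′ → Walk P ℓ v u → Walk P ℓ′ v u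
  walk-≤ l here = here
  walk-≤ (s≤s l) (step p e k) = step p e (walk-≤ l k)

  walk-++ : ∀ {P k ℓ u v w} → Walk P k u v → Walk P ℓ v w → Walk P (k + ℓ) u w
  walk-++ {k = k} here s = walk-≤ (m≤n+m _ k) s
  walk-++ (step p e r) s = step p e (walk-++ r s)

  walk-∷ʳ : ∀ {P ℓ v u w} → Walk P ℓ v u → P u → E u w → Walk P (suc ℓ) v w
  walk-∷ʳ here p e = step p e here
  walk-∷ʳ (step q f k) p e = step q f (walk-∷ʳ k p e)

  walk-head : ∀ {P ℓ v u} → Walk P ℓ v u → P u → P v
  walk-head here p = p
  walk-head (step q _ _) _ = q

  walk-rev : ∀ {P ℓ v u} → Walk P ℓ v u → P u → Walk P ℓ u v
  walk-rev here p = here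
  walk-rev (step q e k) p = walk-∷ʳ (walk-rev k p) (walk-head k p) (E-sym e)

  walk-unsnoc : ∀ {P ℓ v u} → Walk P (suc ℓ) v u → (v ≡ u) ⊎ (∃[ y ] Walk P ℓ v y × P y × E y u)
  walk-unsnoc here = inj₁ refl
  walk-unsnoc {ℓ = zero} (step p e here) = inj₂ (_ , here , p , e)
  walk-unsnoc {ℓ = suc ℓ} (step p e k) with walk-unsnoc k
  ... | inj₁ refl = inj₂ (_ , here , p , e)
  ... | inj₂ (y , r , q , f) = inj₂ (y , step p e r , q , f)

  -- Splits a walk at its vertex of least rank, which both ends weakly reach; this is how walks of
  -- any shape are fed to the bounds on weak reachability. The case `c ≡ u` is separate because the
  -- last vertex need not satisfy `P`.
  walk-min : ∀ {P ℓ v u} (π : Fin n → ℕ) → Walk P ℓ v u →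
    ∃[ c ] ((c ≡ u ⊎ P c) × π c ≤ π u × Walk (λ x → π c ≤ π x) ℓ v u
           × Walk (λ x → π c ≤ π x) ℓ v c × Walk (λ x → π c ≤ π x) ℓ u c)
  walk-min {v = v} π here = v , inj₁ refl , ≤-refl , here , here , here
  walk-min {v = v} π (step p e k) with walk-min π k
  ... | c , o , le , whole , fw , bw with ≤⊎> (π c) (π v)
  ...   | inj₁ c≤v = c , o , le , step c≤v e whole , step c≤v e fw , walk-≤ (n≤1+n _) bw
  ...   | inj₂ v<c = v , inj₂ p , ≤-trans (<⇒≤ v<c) le , all , here , walk-rev all (≤-trans (<⇒≤ v<c) le)
    where all = step ≤-refl e (walk-map (≤-trans (<⇒≤ v<c)) whole)

  module _ {P : Fin n → Set} (P? : Decidable P) (v : Fin n) where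
    private
      card : ℕ → ℕ
      card j = wt (λ _ → 1) (walk? P? j v)

      Stable : ℕ → Set
      Stable j = ∀ x → Walk P (suc j) v x → Walk P j v x

      card≤n : ∀ j → card j ≤ n
      card≤n j = ≤-trans (wt-≤ (λ _ → 1) (walk? P? j v)) (≤-reflexive (trans (∑-const n 1) (*-identityʳ n)))

      stable-or-grow : ∀ j → Stable j ⊎ card j < card (suc j)
      stable-or-grow j with FinP.any? (λ x → walk? P? (suc j) v x ×-dec ¬? (walk? P? j v x))
      ... | no q = inj₁ (λ x k → [ id , (λ m → ⊥-elim (q (x , k , m))) ]′ (dec-⊎ (walk? P? j v x)))
        where dec-⊎ : ∀ {A : Set} → Dec A → A ⊎ ¬ A
              dec-⊎ (yes a) = inj₁ a
              dec-⊎ (no a)  = inj₂ a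
      ... | yes (x , k , m) = inj₂ (∑-mono-< x
              (λ y → ind-mono (walk? P? j v y) (walk? P? (suc j) v y) (walk-≤ (n≤1+n j)) (λ _ → ≤-refl))
              (≤-trans (s≤s (≤-reflexive (ind-no (walk? P? j v x) m))) (≤-reflexive (sym (ind-yes (walk? P? (suc j) v x) k)))))

      find : ∀ k → (∃[ j ] j ≤ k × Stable j) ⊎ k < card k
      find zero with stable-or-grow zero
      ... | inj₁ s = inj₁ (0 , z≤n , s)
      ... | inj₂ g = inj₂ (≤-trans (≤-reflexive (sym (ind-yes (walk? P? 0 v v) here))) (∑-≥ _ v))
      find (suc k) with find k
      ... | inj₁ (j , l , s) = inj₁ (j , m≤n⇒m≤1+n l , s)
      ... | inj₂ g with stable-or-grow k
      ...   | inj₁ s = inj₁ (k , n≤1+n k , s)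
      ...   | inj₂ h = inj₂ (≤-trans (s≤s g) h)

      collapse : ∀ {j} → Stable j → ∀ ℓ {x} → Walk P ℓ v x → Walk P j v x
      collapse s zero here = here
      collapse s (suc ℓ) k with walk-unsnoc k
      ... | inj₁ refl = here
      ... | inj₂ (y , r , p , e) = s _ (walk-∷ʳ (collapse s ℓ r) p e)

    -- The balls around `v` grow strictly until some radius adds nothing, and `n` vertices leave no
    -- room for growth at every radius up to `n`. Hence `Walk P n` decides connection by walks of
    -- arbitrary length.
    walk-shorten : ∀ {ℓ x} → Walk P ℓ v x → Walk P n v x
    walk-shorten {ℓ} k with find n
    ... | inj₁ (j , l , s) = walk-≤ l (collapse s ℓ k)
    ... | inj₂ g = ⊥-elim (<-irrefl refl (≤-trans g (card≤n n)))

#-select : ∀ β {P : ℕ → Set} (P? : Decidable P) m → m ≤ # β P? →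
  Σ (Fin m → ℕ) λ f → ((∀ (a : Fin m) → f a < β × P (f a)) × (∀ a b → a Fin.< b → f b < f a))
#-select β P? zero le = (λ ()) , (λ ()) , (λ ())
#-select (suc β) P? (suc m) le with P? β
... | no _ with #-select β P? (suc m) le
...   | f , h , d = f , (λ a → m<n⇒m<1+n (proj₁ (h a)) , proj₂ (h a)) , d
#-select (suc β) {P} P? (suc m) le | yes p with #-select β P? m (s≤s⁻¹ le)
... | f , h , d = g , hg , dg
  where
  g : Fin (suc m) → ℕ
  g zero    = β
  g (suc a) = f a
  hg : ∀ a → g a < suc β × P (g a)
  hg zero    = ≤-refl , p
  hg (suc a) = m<n⇒m<1+n (proj₁ (h a)) , proj₂ (h a)
  dg : ∀ a b → a Fin.< b → g b < g a
  dg zero    (suc b) _ = proj₁ (h b)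
  dg (suc a) (suc b) l = d a b (s≤s⁻¹ l)

least : ∀ β {P : ℕ → Set} (P? : Decidable P) →
  (∃[ t ] t < β × P t × (∀ x → P x → t ≤ x)) ⊎ (∀ x → x < β → ¬ P x)
least zero    P? = inj₂ (λ x ())
least (suc β) {P} P? with least β P?
... | inj₁ (t , l , p , m) = inj₁ (t , m<n⇒m<1+n l , p , m)
... | inj₂ no< with P? β
...   | yes p = inj₁ (β , ≤-refl , p , λ x q → ≮⇒≥ (λ l → no< x l q))
...   | no ¬p = inj₂ (λ x l q → [ (λ l′ → no< x l′ q) , (λ { refl → ¬p q }) ]′ (m≤n⇒m<n∨m≡n (s≤s⁻¹ l)))

#-pos : ∀ β {P : ℕ → Set} (P? : Decidable P) x → x < β → P x → 0 < # β P?
#-pos (suc β) P? x l p with x ≟ β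
... | yes refl = ≤-trans (≤-reflexive (sym (ind-yes (P? β) p))) (m≤m+n _ _)
... | no ne = ≤-trans (#-pos β P? x (≤∧≢⇒< (s≤s⁻¹ l) ne) p) (m≤n+m _ _)

#-none : ∀ β {P : ℕ → Set} (P? : Decidable P) → (∀ x → x < β → ¬ P x) → # β P? ≡ 0
#-none zero    P? h = refl
#-none (suc β) P? h = cong₂ _+_ (ind-no (P? β) (h β ≤-refl)) (#-none β P? (λ x l → h x (m<n⇒m<1+n l)))

-- Adj-↓ is the chordality that makes the number of vertices reachable in m hops polynomial in m.
module Hops (Adj : ℕ → ℕ → Set) (Adj? : ∀ l i → Dec (Adj l i))
            (Adj-< : ∀ {l i} → Adj l i → l < i)
            (Adj-↓ : ∀ {l i j} → Adj l i → l < j → j ≤ i → Adj l j) where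

  data Hop : ℕ → ℕ → ℕ → Set where
    stop : ∀ {m i} → Hop m i i
    hop  : ∀ {m l i j} → Adj l i → Hop m l j → Hop (suc m) i j

  hop-≤ : ∀ {m m′ i j} → m ≤ m′ → Hop m i j → Hop m′ i j
  hop-≤ l stop = stop
  hop-≤ (s≤s l) (hop a h) = hop a (hop-≤ l h)

  hop-≥ : ∀ {m i j} → Hop m i j → j ≤ i
  hop-≥ stop = ≤-refl
  hop-≥ (hop a h) = ≤-trans (hop-≥ h) (<⇒≤ (Adj-< a))

  -- By `Adj-↓`, a hop that jumps below `t` could as well start at `t`, and an index between `t` and
  -- `i` is itself adjacent to `t`. So moving the start down to `t` costs no hop.
  hop-through : ∀ {m t i j} → Adj t i → j ≤ t → Hop m i j → Hop m t j
  hop-through a j≤t stop = ⊥-elim (<⇒≱ (Adj-< a) j≤t)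
  hop-through {t = t} a j≤t (hop {l = l} b h) with <-cmp l t
  ... | tri< l<t _ _ = hop (Adj-↓ b l<t (<⇒≤ (Adj-< a))) h
  ... | tri≈ _ refl _ = hop-≤ (n≤1+n _) h
  ... | tri> _ _ t<l = hop-≤ (n≤1+n _) (hop-through (Adj-↓ a t<l (<⇒≤ (Adj-< b))) j≤t h)

  above? : ∀ θ i → Decidable (λ l → θ ≤ l × Adj l i)
  above? θ i l = θ ≤? l ×-dec Adj? l i

  -- Let `t` be the least neighbour of `i` not below `θ`. All indices above `t` up to `i` are
  -- adjacent to `t`, so raising the threshold past `t` lowers `k`; indices up to `t` are reached
  -- from `t` with one hop fewer. This is the recursion of a binomial coefficient, bounded here by a
  -- power.
  hop-count : ∀ k m θ i → (∀ j → j ≤ i → # j (above? θ j) ≤ k) →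
    ∃[ L ] (length L ≤ suc m ^ k × (∀ j → θ ≤ j → Hop m i j → j ∈ L))
  hop-count k m θ i b with least i (above? θ i)
  hop-count k m θ i b | inj₂ none = i ∷ [] , m^n>0 (suc m) k ,
      λ { j θ≤j stop → here refl
        ; j θ≤j (hop a h) → ⊥-elim (none _ (Adj-< a) (≤-trans θ≤j (hop-≥ h) , a)) }
  hop-count zero m θ i b | inj₁ (t , t<i , pt , _) = ⊥-elim (<⇒≱ (#-pos i (above? θ i) t t<i pt) (b i ≤-refl))
  hop-count (suc k) zero θ i b | inj₁ _ = i ∷ [] , m^n>0 1 (suc k) , λ { j θ≤j stop → here refl }
  hop-count (suc k) (suc m) θ i b | inj₁ (t , t<i , (θ≤t , at) , tmin)
    with hop-count k (suc m) (suc t) i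
           lem
       | hop-count (suc k) m θ t (λ j j≤t → b j (≤-trans j≤t (<⇒≤ t<i)))
    where
    lem : ∀ j → j ≤ i → # j (above? (suc t) j) ≤ k
    lem j j≤i with t <? j
    ... | yes t<j = s≤s⁻¹ (≤-trans (#-remove j (above? θ j) (above? (suc t) j) t t<j
                       (θ≤t , Adj-↓ at t<j j≤i) (λ q → <-irrefl refl (proj₁ q)) (λ x _ (p , q) → ≤-trans (≤-trans θ≤t (n≤1+n t)) p , q))
                       (b j j≤i))
    ... | no t≮j = ≤-trans (≤-reflexive (#-none j (above? (suc t) j) (λ x x<j (p , q) → t≮j (≤-trans p (<⇒≤ x<j))))) z≤n
  ... | L , lenL , hL | L′ , lenL′ , hL′ = L ++ L′ , len , cov
    where
    len : length (L ++ L′) ≤ suc (suc m) ^ suc k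
    len = begin
      length (L ++ L′)                          ≡⟨ length-++ L ⟩
      length L + length L′                      ≤⟨ +-mono-≤ lenL (≤-trans lenL′ (*-monoʳ-≤ (suc m) (^-monoˡ-≤ k (n≤1+n (suc m))))) ⟩
      suc (suc m) ^ k + suc m * suc (suc m) ^ k ∎
      where open ≤-Reasoning
    cov : ∀ j → θ ≤ j → Hop (suc m) i j → j ∈ L ++ L′
    cov j θ≤j h with t <? j
    ... | yes t<j = ∈-++⁺ˡ (hL j t<j h)
    ... | no t≮j = ∈-++⁺ʳ L (hL′ j θ≤j (down h))
      where
      j≤t = ≮⇒≥ t≮j
      down : Hop (suc m) i j → Hop m t j
      down stop = ⊥-elim (t≮j t<i)
      down (hop {l = l} a h) with m≤n⇒m<n∨m≡n (tmin l (≤-trans θ≤j (hop-≥ h) , a))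
      ... | inj₂ refl = h
      ... | inj₁ t<l = hop-through (Adj-↓ at t<l (<⇒≤ (Adj-< a))) j≤t h

fnd : ∀ {m} {P : Fin m → Set} → Decidable P → Maybe (Fin m)
fnd {zero}  P? = nothing
fnd {suc m} P? = if does (P? zero) then just zero else Data.Maybe.map suc (fnd (P? ∘ suc))

fnd-sound : ∀ {m} {P : Fin m → Set} (P? : Decidable P) {c} → fnd P? ≡ just c → P c
fnd-sound {suc m} P? e with P? zero
fnd-sound {suc m} P? refl | yes p = p
... | no _ with fnd (P? ∘ suc) in e′
fnd-sound {suc m} P? refl | no _ | just c = fnd-sound (P? ∘ suc) e′

fnd-complete : ∀ {m} {P : Fin m → Set} (P? : Decidable P) {x} → P x → ∃[ c ] fnd P? ≡ just c
fnd-complete {suc m} P? {x} p with P? zero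
... | yes _ = zero , refl
fnd-complete {suc m} P? {zero}  p | no ¬p = ⊥-elim (¬p p)
fnd-complete {suc m} P? {suc x} p | no ¬p with fnd (P? ∘ suc) | fnd-complete (P? ∘ suc) {x} p
... | _ | c , refl = suc c , refl

-- The index found depends only on the set. Applied to components, it gives all vertices of a
-- component the same root.
fnd-ext : ∀ {m} {P Q : Fin m → Set} (P? : Decidable P) (Q? : Decidable Q) →
          (∀ x → P x → Q x) → (∀ x → Q x → P x) → fnd P? ≡ fnd Q?
fnd-ext {zero}  P? Q? f g = refl
fnd-ext {suc m} P? Q? f g with P? zero | Q? zero
... | yes _ | yes _ = refl
... | yes p | no ¬q = ⊥-elim (¬q (f zero p))
... | no ¬p | yes q = ⊥-elim (¬p (g zero q))
... | no _  | no _  = cong (Data.Maybe.map suc) (fnd-ext (P? ∘ suc) (Q? ∘ suc) (f ∘ suc) (g ∘ suc))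

∈-take-≤ : ∀ {A : Set} {a b} {y : A} (L : List A) → a ≤ b → y ∈ take a L → y ∈ take b L
∈-take-≤ [] (s≤s l) i = i
∈-take-≤ (x ∷ L) (s≤s l) (here e) = here e
∈-take-≤ (x ∷ L) (s≤s l) (there i) = there (∈-take-≤ L l i)

-- Ranks with small weak reachability sets

module Ranking {n : ℕ} (E : Fin n → Fin n → Set) (E? : ∀ u v → Dec (E u v))
               (E-sym : ∀ {u v} → E u v → E v u) where
  open Walks E E? E-sym

  record Clique (r : ℕ) : Set₁ where
    field
      B         : Fin r → Fin n → Set
      B?        : ∀ a → Decidable (B a)
      nonempty  : ∀ a → ∃ (B a)
      connected : ∀ a x y → B a x → B a y → ∃[ ℓ ] Walk (B a) ℓ x y
      disjoint  : ∀ a b x → B a x → B b x → a ≡ b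
      adjacent  : ∀ a b → a Fin.< b → ∃[ x ] ∃[ y ] (B a x × B b y × E x y)

  verts : ∀ {P ℓ v u} → Walk P ℓ v u → List (Fin n)
  verts {v = v} here = v ∷ []
  verts {v = v} (step _ _ k) = v ∷ verts k

  end∈verts : ∀ {P ℓ v u} (k : Walk P ℓ v u) → u ∈ verts k
  end∈verts here = here refl
  end∈verts (step _ _ k) = there (end∈verts k)

  prefix : ∀ {P ℓ v u} (k : Walk P ℓ v u) {y} → y ∈ verts k → Walk (λ z → P z × z ∈ verts k) ℓ v y
  prefix here (here refl) = here
  prefix (step p e k) (here refl) = here
  prefix (step p e k) (there i) = step (p , here refl) e (walk-map (λ (q , j) → q , there j) (prefix k i))

  Shortest : ∀ P → ℕ → Fin n → Fin n → Set
  Shortest P ℓ v u = ∀ m → m < ℓ → ¬ Walk P m v u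

  geodesic : ∀ {P} → Decidable P → ∀ {ℓ v u} → Walk P ℓ v u → ∃[ ℓ₀ ] (Walk P ℓ₀ v u × Shortest P ℓ₀ v u)
  geodesic P? {ℓ} {v} {u} k with least (suc ℓ) (λ m → walk? P? m v u)
  ... | inj₁ (t , _ , k′ , tmin) = t , k′ , λ m m<t k″ → <⇒≱ m<t (tmin m k″)
  ... | inj₂ none = ⊥-elim (none ℓ ≤-refl k)

  position : ∀ {P ℓ v u} (k : Walk P ℓ v u) {y} → y ∈ verts k →
             ∃[ q ] (q ≤ ℓ × Walk P (ℓ ∸ q) y u × y ∈ take (suc q) (verts k))
  position here (here refl) = 0 , z≤n , here , here refl
  position k@(step _ _ _) (here refl) = 0 , z≤n , k , here refl
  position (step p e k) (there i) with position k i
  ... | q , q≤ℓ , k′ , j = suc q , s≤s q≤ℓ , k′ , there j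

  -- If `y` came later on the geodesic, the short walk to `y` followed by the remaining piece would
  -- be a shortcut.
  near : ∀ {P ℓ v u} (k : Walk P ℓ v u) → Shortest P ℓ v u → ∀ {m y} → y ∈ verts k → Walk P m v y → y ∈ take (suc m) (verts k)
  near {ℓ = ℓ} k sh {m} i c with position k i
  ... | q , q≤ℓ , k′ , j with q ≤? m
  ...   | yes q≤m = ∈-take-≤ (verts k) (s≤s q≤m) j
  ...   | no q≰m = ⊥-elim (sh (m + (ℓ ∸ q)) (≤-trans (+-monoˡ-< (ℓ ∸ q) (≰⇒> q≰m)) (≤-reflexive (m+[n∸m]≡n q≤ℓ))) (walk-++ c k′))

  -- Two vertices of a geodesic lying in a ball of radius ρ are at most 2ρ apart along the geodesic.
  window : ∀ {P} (P? : Decidable P) {ℓ v u} (k : Walk P ℓ v u) → Shortest P ℓ v u → ∀ ρ x →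
           ∃[ L ] (length L ≤ suc (ρ + ρ) × (∀ y → y ∈ verts k → Walk P ρ x y → y ∈ L))
  window P? {v = v} here sh ρ x = v ∷ [] , s≤s z≤n , λ { y i _ → i }
  window P? {v = v} (step p e k) sh ρ x with walk? P? ρ x v
  ... | yes r = take (suc (ρ + ρ)) (v ∷ verts k)
              , ≤-trans (≤-reflexive (length-take (suc (ρ + ρ)) (v ∷ verts k))) (m⊓n≤m _ _)
              , λ y i s → near (step p e k) sh i (walk-++ (walk-rev r p) s)
  ... | no ¬r with window P? k (λ m m<ℓ k′ → sh (suc m) (s≤s m<ℓ) (step p e k′)) ρ x
  ...   | L , len , h = L , len , λ { y (here refl) s → ⊥-elim (¬r s) ; y (there i) s → h y i s }

  -- The vertices of rank i: in every component of what is left, a union of geodesics from a root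
  -- to one neighbour of each adjacent earlier part.
  module Stage (i : ℕ) (r : Fin n → ℕ) where
    U : Fin n → Set
    U x = r x ≡ i
    U? : Decidable U
    U? x = r x ≟ i
    Conn : Fin n → Fin n → Set
    Conn x y = U y × Walk U n x y
    Conn? : ∀ x → Decidable (Conn x)
    Conn? x y = U? y ×-dec walk? U? n x y
    Adj : ℕ → Fin n → Set
    Adj l x = ∃[ y ] ∃[ z ] (r y ≡ l × E y z × Conn x z)
    Adj? : ∀ l x → Dec (Adj l x)
    Adj? l x = FinP.any? (λ y → FinP.any? (λ z → r y ≟ l ×-dec (E? y z ×-dec Conn? x z)))

    conn-refl : ∀ {x} → U x → Conn x x
    conn-refl u = u , here
    conn-sym : ∀ {x y} → U x → Conn x y → Conn y x
    conn-sym ux (uy , k) = ux , walk-rev k uy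
    conn-trans : ∀ {x y z} → Conn x y → Conn y z → Conn x z
    conn-trans (_ , k) (uz , l) = uz , walk-shorten U? _ (walk-++ k l)

    data Path (l : ℕ) (c : Fin n) : List (Fin n) → Set where
      none : ¬ Adj l c → Path l c []
      some : ∀ {y z ℓ} → r y ≡ l → E y z → U z → (k : Walk U ℓ c z) → Shortest U ℓ c z → Path l c (verts k)

    abstract
      pathΣ : ∀ l c → ∃ (Path l c)
      pathΣ l c with Adj? l c
      ... | no ¬a = [] , none ¬a
      ... | yes (y , z , ry , e , uz , k) with geodesic U? k
      ...   | ℓ , k′ , sh = verts k′ , some ry e uz k′ sh

    path : ℕ → Fin n → List (Fin n)
    path l c = proj₁ (pathΣ l c)

    paths : ℕ → Fin n → List (Fin n)
    paths zero    c = []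
    paths (suc l) c = path l c ++ paths l c

    H : Fin n → List (Fin n)
    H c = c ∷ paths i c

    Proc : Fin n → Set
    Proc x = ∃[ c ] (fnd (Conn? x) ≡ just c × x ∈ H c)
    Proc? : Decidable Proc
    Proc? x with fnd (Conn? x)
    ... | nothing = no (λ ())
    ... | just c with Any.any? (x FinP.≟_) (H c)
    ...   | yes m = yes (c , refl , m)
    ...   | no ¬m = no (λ { (_ , refl , m) → ¬m m })

    Late : Fin n → Set
    Late x = U x × ¬ Proc x

    abstract
      next : Fin n → ℕ
      next x = choose (U? x ×-dec ¬? (Proc? x)) (suc i) (r x)

      next-cases : ∀ x → (Late x × next x ≡ suc i) ⊎ (¬ Late x × next x ≡ r x)
      next-cases x = choose-cases (U? x ×-dec ¬? (Proc? x))

    ∈-paths : ∀ {l c y} β → l < β → y ∈ path l c → y ∈ paths β c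
    ∈-paths {l} {c} (suc β) l<β m with l ≟ β
    ... | yes refl = ∈-++⁺ˡ m
    ... | no ne = ∈-++⁺ʳ (path β c) (∈-paths β (≤∧≢⇒< (s≤s⁻¹ l<β) ne) m)

    ∈-paths⁻ : ∀ {c y} β → y ∈ paths β c → ∃[ l ] (l < β × y ∈ path l c)
    ∈-paths⁻ {c} (suc β) m with ∈-++⁻ (path β c) m
    ... | inj₁ m′ = β , ≤-refl , m′
    ... | inj₂ m′ with ∈-paths⁻ β m′
    ...   | l , l<β , m″ = l , m<n⇒m<1+n l<β , m″

    fnd-conn : ∀ {x y} → U x → Conn x y → fnd (Conn? x) ≡ fnd (Conn? y)
    fnd-conn ux k = fnd-ext _ _ (λ z m → conn-trans (conn-sym ux k) m) (λ z m → conn-trans k m)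

    root : ∀ {x} → U x → ∃[ c ] (fnd (Conn? x) ≡ just c × Conn x c)
    root {x} ux with fnd-complete (Conn? x) (conn-refl ux)
    ... | c , e = c , e , fnd-sound (Conn? x) e

    proc : ∀ {x c y} → U x → fnd (Conn? x) ≡ just c → Conn x y → y ∈ H c → Proc y
    proc ux e k m = _ , trans (sym (fnd-conn ux k)) e , m

    proc⁻ : ∀ {x c y} → U x → fnd (Conn? x) ≡ just c → Conn x y → Proc y → y ∈ H c
    proc⁻ ux e k (c′ , e′ , m) with just-injective (trans (sym e) (trans (fnd-conn ux k) e′))
    ... | refl = m

    path-prefix : ∀ {l c L} → Path l c L → ∀ {y} → y ∈ L → Walk (λ z → U z × z ∈ L) n c y
    path-prefix (some ry e uz k sh) m = walk-shorten (λ z → U? z ×-dec Any.any? (z FinP.≟_) (verts k)) _ (prefix k m)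

    proc-connected : ∀ {x c} → U x → fnd (Conn? x) ≡ just c → Conn x c → ∀ {y} → Conn x y → Proc y →
                     Walk (λ z → U z × Proc z × Conn x z) n y c
    proc-connected {x} {c} ux e xc {y} xy py with proc⁻ ux e xy py
    ... | here refl = here
    ... | there m with ∈-paths⁻ i m
    ...   | l , l<i , m′ = walk-rev (walk-map good k) (proj₁ xy , py , xy)
      where
      k = path-prefix (proj₂ (pathΣ l c)) m′
      good : ∀ {w} → U w × w ∈ path l c → U w × Proc w × Conn x w
      good {w} (uw , j) = uw , proc ux e cw (there (∈-paths i l<i j)) , cw
        where cw = conn-trans xc (uw , walk-map proj₁ (path-prefix (proj₂ (pathΣ l c)) j))

    -- The geodesic kept for `l` ends next to part `l`. So the processed vertices alone touch every
    -- earlier part that their component touches, which makes the parts pairwise adjacent in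
    -- `adj-clique`.
    touch : ∀ {l x} → l < i → U x → Adj l x → ∃[ y ] ∃[ z ] (r y ≡ l × E y z × Conn x z × Proc z)
    touch {l} {x} l<i ux (y , z , ry , ez , xz) with root ux
    ... | c , e , xc = go (proj₂ (pathΣ l c)) (λ z m → ∈-paths i l<i m)
      where
      go : ∀ {L} → Path l c L → (∀ z → z ∈ L → z ∈ paths i c) → ∃[ y ] ∃[ z ] (r y ≡ l × E y z × Conn x z × Proc z)
      go (none ¬a) _ = ⊥-elim (¬a (y , z , ry , ez , conn-trans (conn-sym ux xc) xz))
      go (some {y′} {z′} ry′ ez′ uz′ k sh) f = y′ , z′ , ry′ , ez′ , xz′ , proc ux e xz′ (there (f z′ (end∈verts k)))
        where xz′ = conn-trans xc (uz′ , walk-shorten U? _ k)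

    -- Besides the root, the processed vertices lie on one geodesic for each adjacent earlier part,
    -- and `window` limits how much of a geodesic a ball can contain.
    ball : ∀ {x} → U x → ∀ ρ →
      ∃[ L ] (length L ≤ suc (# i (λ l → Adj? l x) * suc (ρ + ρ)) × (∀ y → Proc y → U y → Walk U ρ x y → y ∈ L))
    ball {x} ux ρ with root ux
    ... | c , e , xc = c ∷ proj₁ (all i) , s≤s (proj₁ (proj₂ (all i))) , cov
      where
      one : ∀ {β L₀} → Path β c L₀ → ∃[ L ] (length L ≤ ind (Adj? β x) 1 * suc (ρ + ρ) × (∀ y → y ∈ L₀ → Walk U ρ x y → y ∈ L))
      one (none ¬a) = [] , z≤n , λ y ()
      one {β} (some {y} {z} ry ez uz k sh) with window U? k sh ρ x
      ... | L′ , len′ , h′ = L′ , ≤-trans len′ (≤-reflexive (sym (trans (cong (_* suc (ρ + ρ)) (ind-yes (Adj? β x) {1} adj)) (+-identityʳ _)))) , h′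
        where
        adj : Adj β x
        adj = y , z , ry , ez , conn-trans xc (uz , walk-shorten U? _ k)
      all : ∀ β → ∃[ L ] (length L ≤ # β (λ l → Adj? l x) * suc (ρ + ρ) × (∀ y → y ∈ paths β c → Walk U ρ x y → y ∈ L))
      all zero = [] , z≤n , λ y ()
      all (suc β) with all β | one (proj₂ (pathΣ β c))
      ... | L , len , h | L′ , len′ , h′ = L′ ++ L
          , ≤-trans (≤-reflexive (length-++ L′)) (≤-trans (+-mono-≤ len′ len)
              (≤-reflexive (sym (*-distribʳ-+ (suc (ρ + ρ)) (ind (Adj? β x) 1) _))))
          , λ y m s → [ (λ m′ → ∈-++⁺ˡ (h′ y m′ s)) , (λ m′ → ∈-++⁺ʳ L′ (h y m′ s)) ]′ (∈-++⁻ (path β c) m)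
      cov : ∀ y → Proc y → U y → Walk U ρ x y → y ∈ c ∷ proj₁ (all i)
      cov y py uy s with proc⁻ ux e (uy , walk-shorten U? _ s) py
      ... | here refl = here refl
      ... | there m = there (proj₂ (proj₂ (all i)) y m s)

-- The ranking and its weak reachability bound

module Rank {n : ℕ} (E : Fin n → Fin n → Set) (E? : ∀ u v → Dec (E u v))
            (E-sym : ∀ {u v} → E u v → E v u) where
  open Walks E E? E-sym
  open Ranking E E? E-sym

  -- A value below the stage number is final, while the value `i` at stage `i` marks a vertex not
  -- yet placed. All components are treated in the same stage, so one rank may comprise several
  -- pieces.
  rank : ℕ → Fin n → ℕ
  rank zero    x = 0
  rank (suc i) x = Stage.next i (rank i) x

  module At (i : ℕ) = Stage i (rank i)

  rank-≤ : ∀ i x → rank i x ≤ i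
  rank-≤ zero x = z≤n
  rank-≤ (suc i) x with At.next-cases i x
  ... | inj₁ (_ , e) = ≤-reflexive e
  ... | inj₂ (_ , e) = ≤-trans (≤-reflexive e) (m≤n⇒m≤1+n (rank-≤ i x))

  rank-frozen : ∀ d i x → rank i x < i → rank (d + i) x ≡ rank i x
  rank-frozen zero i x l = refl
  rank-frozen (suc d) i x l with At.next-cases (d + i) x
  ... | inj₂ (_ , e) = trans e (rank-frozen d i x l)
  ... | inj₁ ((u , _) , e) = ⊥-elim (<⇒≱ l (≤-trans (m≤n+m i d) (≤-reflexive (trans (sym u) (rank-frozen d i x l)))))

  rank-live : ∀ d i x → rank i x ≡ i → i ≤ rank (d + i) x
  rank-live zero i x e = ≤-reflexive (sym e)
  rank-live (suc d) i x e with At.next-cases (d + i) x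
  ... | inj₁ (_ , e′) = ≤-trans (m≤n⇒m≤1+n (m≤n+m i d)) (≤-reflexive (sym e′))
  ... | inj₂ (_ , e′) = ≤-trans (rank-live d i x e) (≤-reflexive (sym e′))

  abstract
    π : Fin n → ℕ
    π = rank n

    π-frozen : ∀ {i x} → i ≤ n → rank i x < i → π x ≡ rank i x
    π-frozen {i} {x} i≤n l = subst (λ m → rank m x ≡ rank i x) (m∸n+n≡m i≤n) (rank-frozen (n ∸ i) i x l)

    U⇒ : ∀ {i x} → i ≤ n → rank i x ≡ i → i ≤ π x
    U⇒ {i} {x} i≤n e = subst (λ m → i ≤ rank m x) (m∸n+n≡m i≤n) (rank-live (n ∸ i) i x e)

    private
      card : ℕ → ℕ
      card i = wt (λ _ → 1) (At.U? i)

      late : ∀ i x → rank (suc i) x ≡ suc i → At.Late i x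
      late i x e with At.next-cases i x
      ... | inj₁ (l , _) = l
      ... | inj₂ (_ , e′) = ⊥-elim (<-irrefl refl (≤-trans (≤-reflexive (trans (sym e) e′)) (rank-≤ i x)))

      card-drop : ∀ i x → At.U i x → card (suc i) < card i
      card-drop i x ux with At.root i ux
      ... | c , e , xc = ∑-mono-< c (λ y → ind-mono (At.U? (suc i) y) (At.U? i y) (λ q → proj₁ (late i y q)) (λ _ → ≤-refl))
                (≤-trans (s≤s (≤-reflexive (ind-no (At.U? (suc i) c) (λ q → proj₂ (late i c q) (At.proc i ux e xc (here refl))))))
                         (≤-reflexive (sym (ind-yes (At.U? i c) (proj₁ xc)))))

      -- A stage that still has vertices places at least the root of a component, so all vertices
      -- are placed within `n` stages.
      card-≤ : ∀ i → (card i + i ≤ n) ⊎ (∀ x → ¬ At.U i x)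
      card-≤ zero = inj₁ (≤-trans (≤-reflexive (+-identityʳ _)) (≤-trans (wt-≤ (λ _ → 1) (At.U? 0)) (≤-reflexive (trans (∑-const n 1) (*-identityʳ n)))))
      card-≤ (suc i) with FinP.any? (At.U? (suc i))
      ... | no ¬p = inj₂ (λ x u → ¬p (x , u))
      ... | yes (x , u) with card-≤ i
      ...   | inj₂ e = ⊥-elim (e x (proj₁ (late i x u)))
      ...   | inj₁ l = inj₁ (≤-trans (≤-reflexive (+-suc _ i)) (≤-trans (+-monoˡ-≤ i (card-drop i x (proj₁ (late i x u)))) l))

    π<n : ∀ x → π x < n
    π<n x with m≤n⇒m<n∨m≡n (rank-≤ n x)
    ... | inj₁ l = l
    ... | inj₂ e with card-≤ n
    ...   | inj₂ f = ⊥-elim (f x e)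
    ...   | inj₁ l = ⊥-elim (<-irrefl refl (≤-trans (+-monoˡ-≤ n (≤-trans (≤-reflexive (sym (ind-yes (At.U? n x) e))) (∑-≥ (λ v → ind (At.U? n v) 1) x))) l))

  U⇐ : ∀ {i x} → i ≤ n → i ≤ π x → rank i x ≡ i
  U⇐ {i} {x} i≤n l with m≤n⇒m<n∨m≡n (rank-≤ i x)
  ... | inj₂ e = e
  ... | inj₁ q = ⊥-elim (<⇒≱ q (≤-trans l (≤-reflexive (π-frozen i≤n q))))

  level⇒ : ∀ {i x} → i < n → rank i x ≡ i → At.Proc i x → π x ≡ i
  level⇒ {i} {x} i<n u p with At.next-cases i x
  ... | inj₁ ((_ , ¬p) , _) = ⊥-elim (¬p p)
  ... | inj₂ (_ , e) = trans (π-frozen i<n (s≤s (≤-reflexive (trans e u)))) (trans e u)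

  level⇐ : ∀ {i x} → π x ≡ i → rank i x ≡ i × At.Proc i x
  level⇐ {i} {x} refl = u , p
    where
    u = U⇐ (<⇒≤ (π<n x)) ≤-refl
    p : At.Proc (π x) x
    p with At.Proc? (π x) x
    ... | yes q = q
    ... | no ¬q with At.next-cases (π x) x
    ...   | inj₁ (_ , e) = ⊥-elim (<-irrefl refl (U⇒ (π<n x) e))
    ...   | inj₂ (¬l , _) = ⊥-elim (¬l (u , ¬q))

  low⇒ : ∀ {i l x} → i ≤ n → l < i → rank i x ≡ l → π x ≡ l
  low⇒ i≤n l<i refl = π-frozen i≤n l<i

  low⇐ : ∀ {i l x} → i ≤ n → l < i → π x ≡ l → rank i x ≡ l
  low⇐ {i} {l} {x} i≤n l<i refl with m≤n⇒m<n∨m≡n (rank-≤ i x)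
  ... | inj₁ q = sym (π-frozen i≤n q)
  ... | inj₂ e = ⊥-elim (<⇒≱ l<i (U⇒ i≤n e))

  reachable : ∀ {P : Fin n → Set} → Decidable P → ∀ {ℓ v x} → Walk P ℓ v x → Walk (λ z → P z × Walk P n v z) ℓ v x
  reachable P? k = walk-map (λ (p , m) → p , walk-shorten P? _ (walk-map proj₁ (prefix k m))) (prefix k (end∈verts k))

  module _ (v : Fin n) where
    -- This component singles out the one piece of each rank that matters for `v`, so that `Adj` can
    -- relate ranks instead of pieces. The components are nested as `i` varies, which is the
    -- chordality that `Hops` asks for.
    C : ℕ → Fin n → Set
    C i x = i ≤ π x × Walk (λ z → i ≤ π z) n v x

    C? : ∀ i → Decidable (C i)
    C? i x = i ≤? π x ×-dec walk? (λ z → i ≤? π z) n v x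

    Adj : ℕ → ℕ → Set
    Adj l i = l < i × i ≤ π v × ∃[ y ] ∃[ z ] (π y ≡ l × E y z × C i z)

    Adj? : ∀ l i → Dec (Adj l i)
    Adj? l i = (l <? i) ×-dec ((i ≤? π v) ×-dec FinP.any? (λ y → FinP.any? (λ z → (π y ≟ l) ×-dec (E? y z ×-dec C? i z))))

    C-↓ : ∀ {i j x} → j ≤ i → C i x → C j x
    C-↓ j≤i (l , k) = ≤-trans j≤i l , walk-map (≤-trans j≤i) k

    open Hops Adj Adj? proj₁ (λ (l<i , i≤ , y , z , py , e , cz) l<j j≤i → l<j , ≤-trans j≤i i≤ , y , z , py , e , C-↓ j≤i cz)

    module _ {i : ℕ} (i≤v : i ≤ π v) where
      private
        i<n : i < n
        i<n = ≤-<-trans i≤v (π<n v)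
        uv : At.U i v
        uv = U⇐ (<⇒≤ i<n) i≤v

      conn⇒ : ∀ {x} → At.Conn i v x → C i x
      conn⇒ (u , k) = U⇒ (<⇒≤ i<n) u , walk-map (U⇒ (<⇒≤ i<n)) k

      conn⇐ : ∀ {x} → C i x → At.Conn i v x
      conn⇐ (u , k) = U⇐ (<⇒≤ i<n) u , walk-map (U⇐ (<⇒≤ i<n)) k

      adj⇒ : ∀ {l} → l < i → At.Adj i l v → Adj l i
      adj⇒ l<i (y , z , ry , e , c) = l<i , i≤v , y , z , low⇒ (<⇒≤ i<n) l<i ry , e , conn⇒ c

      adj⇐ : ∀ {l} → Adj l i → At.Adj i l v
      adj⇐ (l<i , _ , y , z , py , e , c) = y , z , low⇐ (<⇒≤ i<n) l<i py , e , conn⇐ c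

      touch : ∀ {l} → Adj l i → ∃[ y ] ∃[ z ] (π y ≡ l × E y z × C i z × π z ≡ i)
      touch a@(l<i , _) with At.touch i l<i uv (adj⇐ a)
      ... | y , z , ry , e , c , p = y , z , low⇒ (<⇒≤ i<n) l<i ry , e , conn⇒ c , level⇒ i<n (proj₁ c) p

      part-connected : ∀ x y → π x ≡ i × C i x → π y ≡ i × C i y → ∃[ ℓ ] Walk (λ z → π z ≡ i × C i z) ℓ x y
      part-connected x y (px , cx) (py , cy) with At.root i uv
      ... | c , e , vc = n + n , walk-++ (to x px cx) (walk-rev (to y py cy) pc)
        where
        mem : ∀ {z} → At.U i z × At.Proc i z × At.Conn i v z → π z ≡ i × C i z
        mem (u , p , k) = level⇒ i<n u p , conn⇒ k
        to : ∀ x → π x ≡ i → C i x → Walk (λ z → π z ≡ i × C i z) n x c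
        to x px cx = walk-map mem (At.proc-connected i uv e vc (conn⇐ cx) (proj₂ (level⇐ px)))
        pc : π c ≡ i × C i c
        pc = mem (proj₁ vc , At.proc i uv e vc (here refl) , vc)

      part-ball : ∀ ρ → ∃[ L ] (length L ≤ suc (# i (λ l → Adj? l i) * suc (ρ + ρ))
                    × (∀ y → π y ≡ i → Walk (λ z → i ≤ π z) ρ v y → y ∈ L))
      part-ball ρ with At.ball i uv ρ
      ... | L , len , h = L , ≤-trans len (s≤s (*-monoˡ-≤ (suc (ρ + ρ)) (#-mono i (λ l → At.Adj? i l v) (λ l → Adj? l i) (λ l l<i → adj⇒ l<i))))
                        , λ y py k → h y (proj₂ (level⇐ py)) (proj₁ (level⇐ py)) (walk-map (U⇐ (<⇒≤ i<n)) k)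

    -- The branch sets are the component `C i` and the pieces adjacent to it. For `f b < f a`, the
    -- larger component `C (f a)` is adjacent to rank `f b` because `C i` is, and by `touch` so is
    -- the piece `f a` itself.
    adj-clique : ∀ {i} → i ≤ π v → ∀ {k} → k ≤ # i (λ l → Adj? l i) → Clique (suc k)
    adj-clique {i} i≤v {k} le with #-select i (λ l → Adj? l i) k le
    ... | f , good , desc = record
      { B = B ; B? = B? ; nonempty = nonempty ; connected = connected ; disjoint = disjoint ; adjacent = adjacent }
      where
      B : Fin (suc k) → Fin n → Set
      B zero    x = C i x
      B (suc a) x = π x ≡ f a × C (f a) x
      B? : ∀ a → Decidable (B a)
      B? zero    = C? i
      B? (suc a) x = (π x ≟ f a) ×-dec C? (f a) x
      f≤ : ∀ a → f a ≤ i
      f≤ a = <⇒≤ (proj₁ (good a))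
      ext : ∀ {l y z} → π y ≡ l → E y z → C l z → π y ≡ l × C l y
      ext {l} {y} {z} py e (l≤z , k) = py , ≤-reflexive (sym py) , walk-shorten (λ x → l ≤? π x) _ (walk-∷ʳ k l≤z (E-sym e))
      adjacent : ∀ a b → a Fin.< b → ∃[ x ] ∃[ y ] (B a x × B b y × E x y)
      adjacent zero (suc b) _ with proj₂ (good b)
      ... | l<i , _ , y , z , py , e , cz = z , y , cz , ext py e (C-↓ (f≤ b) cz) , E-sym e
      adjacent (suc a) (suc b) a<b with proj₂ (good b)
      ... | l<i , _ , y , z , py , e , cz with touch (≤-trans (f≤ a) i≤v) {f b} (desc a b (s≤s⁻¹ a<b) , ≤-trans (f≤ a) i≤v , y , z , py , e , C-↓ (f≤ a) cz)
      ...   | y′ , z′ , py′ , e′ , cz′ , pz′ = z′ , y′ , (pz′ , cz′) , ext py′ e′ (C-↓ (<⇒≤ (desc a b (s≤s⁻¹ a<b))) cz′) , E-sym e′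
      nonempty : ∀ a → ∃ (B a)
      nonempty zero = v , i≤v , here
      nonempty (suc a) with proj₂ (good a)
      ... | l<i , _ , y , z , py , e , cz = y , ext py e (C-↓ (f≤ a) cz)
      connected : ∀ a x y → B a x → B a y → ∃[ ℓ ] Walk (B a) ℓ x y
      connected zero x y (ix , kx) (iy , ky) =
        n + n , walk-++ (walk-rev (reachable (λ z → i ≤? π z) kx) (ix , kx)) (reachable (λ z → i ≤? π z) ky)
      connected (suc a) = part-connected (≤-trans (f≤ a) i≤v)
      disjoint : ∀ a b x → B a x → B b x → a ≡ b
      disjoint zero zero x _ _ = refl
      disjoint zero (suc b) x (l , _) (e , _) = ⊥-elim (<⇒≱ (proj₁ (good b)) (≤-trans l (≤-reflexive e)))
      disjoint (suc a) zero x (e , _) (l , _) = ⊥-elim (<⇒≱ (proj₁ (good a)) (≤-trans l (≤-reflexive e)))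
      disjoint (suc a) (suc b) x (e , _) (e′ , _) with FinP.<-cmp a b
      ... | tri< a<b _ _ = ⊥-elim (<-irrefl (trans (sym e′) e) (desc a b a<b))
      ... | tri≈ _ refl _ = refl
      ... | tri> _ _ b<a = ⊥-elim (<-irrefl (trans (sym e) e′) (desc b a b<a))

    -- Steps within the current component `C i` are free. A step onto a vertex of rank below `i` is
    -- a hop to that rank, as the vertex is adjacent to the component; the walk then continues from
    -- the component of that rank.
    walk⇒hop : ∀ {j m} {u} → j ≤ π v → π u ≡ j → ∀ {i y} → i ≤ π v → j ≤ i → C i y → Walk (λ z → j ≤ π z) m y u → Hop m i j
    walk⇒hop {j} j≤v pu {i} i≤v j≤i (i≤y , k) here with ≤-antisym j≤i (≤-trans i≤y (≤-reflexive pu))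
    ... | refl = stop
    walk⇒hop {j} {u = u} j≤v pu {i} {y} i≤v j≤i (i≤y , k) (step {w = y′} q e s) with i ≤? π y′
    ... | yes i≤y′ = hop-≤ (n≤1+n _) (walk⇒hop j≤v pu i≤v j≤i (i≤y′ , walk-shorten (λ x → i ≤? π x) _ (walk-∷ʳ k i≤y e)) s)
    ... | no i≰y′ = hop (l<i , i≤v , y′ , y , refl , E-sym e , i≤y , k)
                        (walk⇒hop j≤v pu (≤-trans (<⇒≤ l<i) i≤v) (walk-head s (≤-reflexive (sym pu)))
                          (≤-refl , walk-shorten (λ x → π y′ ≤? π x) _ (walk-∷ʳ (walk-map (≤-trans (<⇒≤ l<i)) k) (≤-trans (<⇒≤ l<i) i≤y) e)) s)
      where l<i = ≰⇒> i≰y′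

    adj-bound : ∀ k → ¬ Clique (suc (suc k)) → ∀ {i} → i ≤ π v → # i (λ l → Adj? l i) ≤ k
    adj-bound k ¬cl i≤v = ≮⇒≥ (λ l → ¬cl (adj-clique i≤v l))

    -- One factor counts the ranks reachable by `ρ` hops, the other the vertices of one such rank
    -- within the ball. For fixed `k` the product is polynomial in `ρ`, as `long-radius` requires.
    weak-reach-bound : ∀ k → ¬ Clique (suc (suc k)) → ∀ ρ →
      ∃[ L ] (length L ≤ suc ρ ^ k * suc (k * suc (ρ + ρ)) × (∀ u → Walk (λ z → π u ≤ π z) ρ v u → u ∈ L))
    weak-reach-bound k ¬cl ρ with hop-count k ρ 0 (π v) (λ j j≤ → ≤-trans (#-mono j (above? 0 j) (λ l → Adj? l j) (λ l _ → proj₂)) (adj-bound k ¬cl j≤))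
    ... | js , len , hj = proj₁ (balls js) , ≤-trans (proj₁ (proj₂ (balls js))) (*-monoˡ-≤ _ len) , cov
      where
      InBall : ℕ → Fin n → Set
      InBall i y = π y ≡ i × i ≤ π v × Walk (λ z → i ≤ π z) ρ v y
      balls : ∀ js → ∃[ L ] (length L ≤ length js * suc (k * suc (ρ + ρ)) × (∀ i y → i ∈ js → InBall i y → y ∈ L))
      balls [] = [] , z≤n , λ i y ()
      balls (j ∷ js) with balls js | j ≤? π v
      ... | L , len , h | no j≰ = L , ≤-trans len (m≤n+m _ _) , λ { i y (here refl) (_ , l , _) → ⊥-elim (j≰ l) ; i y (there m) b → h i y m b }
      ... | L , len , h | yes j≤ with part-ball j≤ ρ
      ...   | L′ , len′ , h′ = L′ ++ L , ≤-trans (≤-reflexive (length-++ L′)) (+-mono-≤ (≤-trans len′ (s≤s (*-monoˡ-≤ (suc (ρ + ρ)) (adj-bound k ¬cl j≤)))) len)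
              , λ { i y (here refl) (p , _ , w) → ∈-++⁺ˡ (h′ y p w) ; i y (there m) b → ∈-++⁺ʳ L′ (h i y m b) }
      cov : ∀ u → Walk (λ z → π u ≤ π z) ρ v u → u ∈ proj₁ (balls js)
      cov u w = proj₂ (proj₂ (balls js)) (π u) u (hj (π u) z≤n (walk⇒hop u≤v refl ≤-refl u≤v (≤-refl , here) w)) (refl , u≤v , w)
        where u≤v = walk-head w ≤-refl

-- The weighted graph after cleaning: a surviving vertex is not outweighed by the vertices weakly reaching it,
-- and the weights of surviving vertices at different levels b differ by a factor of at least Γ.
record Setting {n : ℕ} (E : Fin n → Fin n → Set) (E? : ∀ u v → Dec (E u v))
               (E-sym : ∀ {u v} → E u v → E v u) : Set₁ where
  open Walks E E? E-sym
  field
    w         : Fin n → ℕ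
    π         : Fin n → ℕ
    ρ W M Γ β : ℕ
    reach     : ∀ v → ∃[ L ] (length L ≤ W × (∀ u → Walk (λ z → π u ≤ π z) ρ v u → u ∈ L))
    alive     : Fin n → Set
    alive?    : Decidable alive
    pos       : ∀ {u} → alive u → 0 < w u
    heavy     : ∀ {u} → alive u → ∑ (λ v → ind (walk? (λ z → π u ≤? π z) ρ v u) (w v)) ≤ M * w u
    b         : Fin n → ℕ
    b<β       : ∀ v → b v < β
    gap       : ∀ {u v} → alive u → alive v → b v < b u → Γ * w v ≤ w u
    M<Γ       : M < Γ

-- Reachability between levels

module Structure {n : ℕ} {E : Fin n → Fin n → Set} {E? : ∀ u v → Dec (E u v)}
                 {E-sym : ∀ {u v} → E u v → E v u} (S : Setting E E? E-sym) where
  open Walks E E? E-sym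
  open Setting S

  Wk : Fin n → Fin n → Set
  Wk v u = Walk (λ z → π u ≤ π z) ρ v u
  Wk? : ∀ v u → Dec (Wk v u)
  Wk? v u = walk? (λ z → π u ≤? π z) ρ v u

  w⁻ : Fin n → ℕ
  w⁻ u = ∑ (λ v → ind (Wk? v u) (w v))

  w≤w⁻ : ∀ {v u} → Wk v u → w v ≤ w⁻ u
  w≤w⁻ {v} {u} k = ≤-trans (≤-reflexive (sym (ind-yes (Wk? v u) k))) (∑-≥ (λ v → ind (Wk? v u) (w v)) v)

  Lower : ℕ → Fin n → Set
  Lower a x = alive x × b x < a
  Below : ℕ → Fin n → Set
  Below a x = alive x × b x ≤ a
  Below? : ∀ a → Decidable (Below a)
  Below? a x = alive? x ×-dec (b x ≤? a)

  -- A vertex above all others of a short walk is its vertex of least rank, since the latter is almost as heavy.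
  top⇒Wk : ∀ {ℓ v u} → ℓ ≤ ρ → alive u → Walk (Lower (b u)) ℓ v u → Wk v u
  top⇒Wk {ℓ} {v} {u} ℓ≤ρ au k with walk-min π k
  ... | c , inj₁ refl , le , whole , fw , bw = walk-≤ ℓ≤ρ fw
  ... | c , inj₂ (ac , bc<bu) , le , whole , fw , bw = ⊥-elim (<-irrefl refl (begin-strict
      Γ * w c ≤⟨ gap au ac bc<bu ⟩
      w u     ≤⟨ w≤w⁻ (walk-≤ ℓ≤ρ bw) ⟩
      w⁻ c    ≤⟨ heavy ac ⟩
      M * w c <⟨ *-monoˡ-< (w c) {{>-nonZero (pos ac)}} M<Γ ⟩
      Γ * w c ∎))
    where open ≤-Reasoning

  -- Strong reachability of a vertex of a higher level.
  SR : ℕ → Fin n → Fin n → Set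
  SR ℓ v u = alive u × b v < b u × Walk (Below (b v)) ℓ v u
  SR? : ∀ ℓ v u → Dec (SR ℓ v u)
  SR? ℓ v u = alive? u ×-dec ((b v <? b u) ×-dec walk? (Below? (b v)) ℓ v u)

  SR-≤ : ∀ {ℓ ℓ′ v u} → ℓ ≤ ℓ′ → SR ℓ v u → SR ℓ′ v u
  SR-≤ l (a , lt , k) = a , lt , walk-≤ l k

  SR⇒Wk : ∀ {ℓ v u} → ℓ ≤ ρ → SR ℓ v u → Wk v u
  SR⇒Wk ℓ≤ρ (au , lt , k) = top⇒Wk ℓ≤ρ au (walk-map (λ (a , le) → a , ≤-<-trans le lt) k)

  Seen : ℕ → Fin n → ℕ → Set
  Seen ℓ v x = ∃[ u ] (SR ℓ v u × b u ≡ x)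
  Seen? : ∀ ℓ v → Decidable (Seen ℓ v)
  Seen? ℓ v x = FinP.any? (λ u → SR? ℓ v u ×-dec (b u ≟ x))

tab : {A : Set} → ℕ → (ℕ → A) → List A
tab zero    f = []
tab (suc m) f = f m ∷ tab m f

module _ {A : Set} where
  tab-injective : ∀ m {f g : ℕ → A} → tab m f ≡ tab m g → ∀ i → i < m → f i ≡ g i
  tab-injective (suc m) e i l with i ≟ m
  ... | yes refl = proj₁ (∷-injective e)
  ... | no ne = tab-injective m (proj₂ (∷-injective e)) i (≤∧≢⇒< (s≤s⁻¹ l) ne)

  tuples : ℕ → List A → List (List A)
  tuples zero    L = [] ∷ []
  tuples (suc m) L = cartesianProductWith _∷_ L (tuples m L)

  length-product : {B C : Set} (f : A → B → C) (xs : List A) (ys : List B) →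
                   length (cartesianProductWith f xs ys) ≡ length xs * length ys
  length-product f []       ys = refl
  length-product f (x ∷ xs) ys = trans (length-++ (map (f x) ys)) (cong₂ _+_ (length-map (f x) ys) (length-product f xs ys))

  length-tuples : ∀ m (L : List A) → length (tuples m L) ≡ length L ^ m
  length-tuples zero    L = refl
  length-tuples (suc m) L = trans (length-product _∷_ L (tuples m L)) (cong (length L *_) (length-tuples m L))

  tab∈tuples : ∀ m {L : List A} {f : ℕ → A} → (∀ i → i < m → f i ∈ L) → tab m f ∈ tuples m L
  tab∈tuples zero    h = here refl
  tab∈tuples (suc m) h = ∈-cartesianProductWith⁺ _∷_ (h m ≤-refl) (tab∈tuples m (λ i l → h i (m<n⇒m<1+n l)))

#-ascending : ∀ β {P : ℕ → Set} (P? : Decidable P) m → m ≤ # β P? →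
  Σ (ℕ → ℕ) λ f → (∀ i → i < m → f i < β × P (f i)) × (∀ i j → i < j → j < m → f i < f j)
#-ascending β P? zero le = (λ i → i) , (λ i ()) , (λ i j _ ())
#-ascending (suc β) P? (suc m) le with P? β
... | no _ with #-ascending β P? (suc m) le
...   | f , h , d = f , (λ i l → m<n⇒m<1+n (proj₁ (h i l)) , proj₂ (h i l)) , d
#-ascending (suc β) {P} P? (suc m) le | yes p with #-ascending β P? m (s≤s⁻¹ le)
... | f , h , d = g , hg , dg
  where
  g : ℕ → ℕ
  g i = choose (i ≟ m) β (f i)
  g-top : ∀ {i} → i ≡ m → g i ≡ β
  g-top {i} e with choose-cases (i ≟ m) {β} {f i}
  ... | inj₁ (_ , q) = q
  ... | inj₂ (ne , _) = ⊥-elim (ne e)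
  g-low : ∀ {i} → i < m → g i ≡ f i
  g-low {i} l with choose-cases (i ≟ m) {β} {f i}
  ... | inj₁ (refl , _) = ⊥-elim (<-irrefl refl l)
  ... | inj₂ (_ , q) = q
  hg : ∀ i → i < suc m → g i < suc β × P (g i)
  hg i l with m≤n⇒m<n∨m≡n (s≤s⁻¹ l)
  ... | inj₁ l′ rewrite g-low l′ = m<n⇒m<1+n (proj₁ (h i l′)) , proj₂ (h i l′)
  ... | inj₂ e rewrite g-top e = ≤-refl , p
  dg : ∀ i j → i < j → j < suc m → g i < g j
  dg i j i<j l with m≤n⇒m<n∨m≡n (s≤s⁻¹ l)
  ... | inj₁ l′ rewrite g-low l′ | g-low (<-trans i<j l′) = d i j i<j l′
  ... | inj₂ refl rewrite g-top {j} refl | g-low i<j = proj₁ (h i i<j)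

-- Closures of trees from vertices strongly reaching many levels

module Tree {n : ℕ} {E : Fin n → Fin n → Set} {E? : ∀ u v → Dec (E u v)}
            {E-sym : ∀ {u v} → E u v → E v u} (S : Setting E E? E-sym)
            (s ρZ k Q : ℕ) (2ρZ≤ρ : ρZ + ρZ ≤ Setting.ρ S) where
  open Walks E E? E-sym
  open Setting S
  open Structure S

  ρZ≤ρ : ρZ ≤ ρ
  ρZ≤ρ = ≤-trans (m≤m+n ρZ ρZ) 2ρZ≤ρ

  Z : Fin n → Set
  Z v = alive v × suc s ≤ # β (Seen? ρZ v)
  Z? : Decidable Z
  Z? v = alive? v ×-dec (suc s ≤? # β (Seen? ρZ v))

  IsChain : Fin n → (ℕ → Fin n) → Set
  IsChain z c = (∀ i → i < suc s → SR ρZ z (c i)) × (∀ i j → i < j → j < suc s → b (c i) < b (c j))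

  abstract
    chains : ∀ z → Σ (ℕ → Fin n) λ c → Z z → IsChain z c
    chains z with Z? z
    ... | no ¬p = (λ _ → z) , λ p → ⊥-elim (¬p p)
    ... | yes (az , le) with #-ascending β (Seen? ρZ z) (suc s) le
    ...   | f , h , d = (λ i → proj₁ (pick i))
              , λ _ → (λ i l → proj₁ (proj₂ (pick i) l))
                    , (λ i j i<j l → subst₂ _<_ (sym (proj₂ (proj₂ (pick i) (<-trans i<j l)))) (sym (proj₂ (proj₂ (pick j) l))) (d i j i<j l))
      where
      pick : ∀ i → ∃[ u ] (i < suc s → SR ρZ z u × b u ≡ f i)
      pick i with i <? suc s
      ... | no ¬l = z , λ l → ⊥-elim (¬l l)
      ... | yes l with proj₂ (h i l)
      ...   | u , r , e = u , λ _ → r , e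

  ch : Fin n → ℕ → Fin n
  ch z = proj₁ (chains z)
  ch-SR : ∀ {z} → Z z → ∀ i → i < suc s → SR ρZ z (ch z i)
  ch-SR {z} p = proj₁ (proj₂ (chains z) p)
  ch-mono : ∀ {z} → Z z → ∀ i j → i < j → j < suc s → b (ch z i) < b (ch z j)
  ch-mono {z} p = proj₂ (proj₂ (chains z) p)

  -- The two entries are joined through `z` by a walk of length `ρZ + ρZ` that stays below the level
  -- of the later one, so `top⇒Wk` applies.
  ch-Wk : ∀ {z} → Z z → ∀ i j → i ≤ j → j < suc s → Wk (ch z i) (ch z j)
  ch-Wk {z} p i j i≤j l with m≤n⇒m<n∨m≡n i≤j
  ... | inj₂ refl = here
  ... | inj₁ i<j with ch-SR p i (≤-<-trans i≤j l) | ch-SR p j l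
  ...   | ai , lti , ki | aj , ltj , kj =
    top⇒Wk 2ρZ≤ρ aj (walk-++ (walk-rev (walk-map (λ (a , le) → a , ≤-<-trans le ltj) ki) (ai , ch-mono p i j i<j l))
                             (walk-map (λ (a , le) → a , ≤-<-trans le ltj) kj))

  Same : ℕ → Fin n → Fin n → Set
  Same t z z′ = ∀ {i} → i < suc s → t ≤ i → ch z i ≡ ch z′ i
  Same? : ∀ t z z′ → Dec (Same t z z′)
  Same? t z z′ = allUpTo? (λ i → (t ≤? i) →-dec (ch z i FinP.≟ ch z′ i)) (suc s)

  -- Predicate and decision procedure arise in one recursion, because the weight in the next
  -- predicate is computed with the previous decision procedure.
  levels : ℕ → Σ (Fin n → Set) Decidable
  levels zero = Z , Z?
  levels (suc t) = let (R , R?) = levels t in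
    (λ z → R z × w (ch z t) ≤ Q * wt w (λ z′ → R? z′ ×-dec Same? t z z′)) ,
    (λ z → R? z ×-dec (w (ch z t) ≤? Q * wt w (λ z′ → R? z′ ×-dec Same? t z z′)))

  -- R t consists of the vertices whose chain entries of index below t are, one after the other,
  -- entries of a non-negligible weight of vertices with the same higher entries.
  R : ℕ → Fin n → Set
  R t = proj₁ (levels t)
  R? : ∀ t → Decidable (R t)
  R? t = proj₂ (levels t)

  R⇒Z : ∀ t {z} → R t z → Z z
  R⇒Z zero p = p
  R⇒Z (suc t) (p , _) = R⇒Z t p

  K : ℕ
  K = W ^ suc s

  module Loss (t : ℕ) (t≤s : t < suc s) where
    Bad : Fin n → Set
    Bad z = R t z × ¬ R (suc t) z
    Bad? : Decidable Bad
    Bad? z = R? t z ×-dec ¬? (R? (suc t) z)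

    -- Indices below `t` repeat entry `t`, so every entry of the key is weakly reached from
    -- `ch z t`. This leaves at most `W ^ suc s` keys for each value of that entry.
    key : Fin n → List (Fin n)
    key z = tab (suc s) (λ i → ch z (i ⊔ t))

    key-same : ∀ {z z′} → key z ≡ key z′ → Same t z z′
    key-same {z} {z′} e {i} l t≤i = subst (λ j → ch z j ≡ ch z′ j) (m≥n⇒m⊔n≡m t≤i) (tab-injective (suc s) e i l)

    key∈ : ∀ {z} → Z z → key z ∈ tuples (suc s) (proj₁ (reach (ch z t)))
    key∈ {z} p = tab∈tuples (suc s) (λ i l → proj₂ (proj₂ (reach (ch z t))) _ (ch-Wk p t (i ⊔ t) (m≤n⊔m i t) (⊔-lub l t≤s)))

    Cell? : ∀ u p → Decidable (λ z → Bad z × ch z t ≡ u × key z ≡ p)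
    Cell? u p z = Bad? z ×-dec ((ch z t FinP.≟ u) ×-dec ListP.≡-dec FinP._≟_ (key z) p)

    -- The members of a cell agree on all entries from `t` on. Were the cell heavier, it would by
    -- itself make them satisfy the condition of `R (suc t)`, and they would not be bad.
    cell : ∀ u p → Q * wt w (Cell? u p) ≤ w u
    cell u p with FinP.any? (Cell? u p)
    ... | no none = ≤-trans (≤-reflexive (trans (cong (Q *_) (∑-0 (λ z → ind-no (Cell? u p z) (λ q → none (z , q))))) (*-zeroʳ Q))) z≤n
    ... | yes (z₀ , (r₀ , ¬r₀) , refl , refl) =
      ≤-trans (*-monoʳ-≤ Q (wt-mono w (Cell? (ch z₀ t) (key z₀)) (λ z′ → R? t z′ ×-dec Same? t z₀ z′)
                (λ z ((r , _) , _ , e) → r , key-same (sym e))))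
              (<⇒≤ (≰⇒> (λ q → ¬r₀ (r₀ , q))))

    Col? : ∀ u → Decidable (λ z → Bad z × ch z t ≡ u)
    Col? u z = Bad? z ×-dec (ch z t FinP.≟ u)

    Keyed? : ∀ u ps → Decidable (λ z → (Bad z × ch z t ≡ u) × key z ∈ ps)
    Keyed? u ps z = Col? u z ×-dec Any.any? (ListP.≡-dec FinP._≟_ (key z)) ps

    cells : ∀ u ps →
            Q * wt w (Keyed? u ps) ≤ length ps * w u
    cells u [] = ≤-trans (≤-reflexive (trans (cong (Q *_) (∑-0 (λ z → ind-no (Keyed? u [] z) (λ { (_ , ()) })))) (*-zeroʳ Q))) z≤n
    cells u (p ∷ ps) = begin
      Q * wt w (Keyed? u (p ∷ ps))
        ≤⟨ *-monoʳ-≤ Q (wt-⊎ w (Keyed? u (p ∷ ps)) (Cell? u p) (Keyed? u ps)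
             (λ { z ((bd , c) , here e) → inj₁ (bd , c , e) ; z (q , there m) → inj₂ (q , m) })) ⟩
      Q * (wt w (Cell? u p) + wt w (Keyed? u ps))
        ≡⟨ *-distribˡ-+ Q _ _ ⟩
      Q * wt w (Cell? u p) + Q * wt w (Keyed? u ps)
        ≤⟨ +-mono-≤ (cell u p) (cells u ps) ⟩
      w u + length ps * w u ∎
      where open ≤-Reasoning

    column : ∀ u → Q * wt w (Col? u) ≤ K * w u
    column u = begin
      Q * wt w (Col? u) ≤⟨ *-monoʳ-≤ Q (wt-mono w (Col? u) (Keyed? u ps) (λ { z (bd , refl) → (bd , refl) , key∈ (R⇒Z t (proj₁ bd)) })) ⟩
      Q * wt w (Keyed? u ps) ≤⟨ cells u ps ⟩
      length ps * w u ≤⟨ *-monoˡ-≤ (w u) (≤-trans (≤-reflexive (length-tuples (suc s) (proj₁ (reach u)))) (^-monoˡ-≤ (suc s) (proj₁ (proj₂ (reach u))))) ⟩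
      K * w u ∎
      where
      open ≤-Reasoning
      ps = tuples (suc s) (proj₁ (reach u))

    loss : Q * wt w Bad? ≤ K * ∑ w
    loss = begin
      Q * wt w Bad? ≤⟨ *-monoʳ-≤ Q (∑-mono (λ z → ≤-trans (ind-mono (Bad? z) (Col? (ch z t) z) (λ q → q , refl) (λ _ → ≤-refl)) (∑-≥ (λ u → ind (Col? u z) (w z)) (ch z t)))) ⟩
      Q * ∑ (λ z → ∑ (λ u → ind (Col? u z) (w z))) ≡⟨ cong (Q *_) (∑-swap (λ z u → ind (Col? u z) (w z))) ⟩
      Q * ∑ (λ u → wt w (Col? u)) ≡⟨ sym (∑-*ˡ Q (λ u → wt w (Col? u))) ⟩
      ∑ (λ u → Q * wt w (Col? u)) ≤⟨ ∑-mono column ⟩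
      ∑ (λ u → K * w u) ≡⟨ ∑-*ˡ K w ⟩
      K * ∑ w ∎
      where open ≤-Reasoning

  total-loss : ∀ t → t ≤ suc s → Q * wt w Z? ≤ Q * wt w (R? t) + t * (K * ∑ w)
  total-loss zero le = m≤m+n _ _
  total-loss (suc t) le = begin
    Q * wt w Z? ≤⟨ total-loss t (<⇒≤ le) ⟩
    Q * wt w (R? t) + t * (K * ∑ w) ≤⟨ +-monoˡ-≤ _ (*-monoʳ-≤ Q (wt-⊎ w (R? t) (R? (suc t)) (Loss.Bad? t le) split)) ⟩
    Q * (wt w (R? (suc t)) + wt w (Loss.Bad? t le)) + t * (K * ∑ w) ≡⟨ cong (_+ t * (K * ∑ w)) (*-distribˡ-+ Q _ _) ⟩
    Q * wt w (R? (suc t)) + Q * wt w (Loss.Bad? t le) + t * (K * ∑ w) ≤⟨ +-monoˡ-≤ _ (+-monoʳ-≤ (Q * wt w (R? (suc t))) (Loss.loss t le)) ⟩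
    Q * wt w (R? (suc t)) + K * ∑ w + t * (K * ∑ w) ≡⟨ +-assoc (Q * wt w (R? (suc t))) _ _ ⟩
    Q * wt w (R? (suc t)) + (K * ∑ w + t * (K * ∑ w)) ∎
    where
    open ≤-Reasoning
    split : ∀ z → R t z → R (suc t) z ⊎ (R t z × ¬ R (suc t) z)
    split z r with R? (suc t) z
    ... | yes p = inj₁ p
    ... | no ¬p = inj₂ (r , ¬p)

  Hit : Fin n → Fin n → Fin n → Set
  Hit x u z = ∃[ c ] (Wk x c × alive c × b c < b u × Wk z c)
  Hit? : ∀ x u → Decidable (Hit x u)
  Hit? x u z = FinP.any? (λ c → Wk? x c ×-dec (alive? c ×-dec ((b c <? b u) ×-dec Wk? z c)))

  -- There are at most `W` vertices `c` weakly reached from `x`. What weakly reaches one of them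
  -- weighs at most `M * w c`, and `gap` turns this into a share `M / Γ` of `w u`.
  hit-weight : ∀ x {u} → alive u → Γ * wt w (Hit? x u) ≤ W * M * w u
  hit-weight x {u} au = begin
    Γ * wt w (Hit? x u)
      ≤⟨ *-monoʳ-≤ Γ (∑-mono (λ z → ind-≤′ (Hit? x u z) (λ { (c , xc , ac , lt , zc) →
           ≤-trans (≤-reflexive (sym (trans (ind-yes (Q? c) (xc , ac , lt)) (ind-yes (Wk? z c) zc)))) (∑-≥ (λ c → ind (Q? c) (ind (Wk? z c) (w z))) c) }))) ⟩
    Γ * ∑ (λ z → ∑ (λ c → ind (Q? c) (ind (Wk? z c) (w z))))
      ≡⟨ cong (Γ *_) (∑-swap (λ z c → ind (Q? c) (ind (Wk? z c) (w z)))) ⟩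
    Γ * ∑ (λ c → ∑ (λ z → ind (Q? c) (ind (Wk? z c) (w z))))
      ≡⟨ cong (Γ *_) (∑-cong (λ c → sym (ind-∑ (Q? c) (λ z → ind (Wk? z c) (w z))))) ⟩
    Γ * ∑ (λ c → ind (Q? c) (w⁻ c)) ≡⟨ sym (∑-*ˡ Γ (λ c → ind (Q? c) (w⁻ c))) ⟩
    ∑ (λ c → Γ * ind (Q? c) (w⁻ c)) ≡⟨ ∑-cong (λ c → ind-* (Q? c) Γ (w⁻ c)) ⟩
    ∑ (λ c → ind (Q? c) (Γ * w⁻ c)) ≤⟨ ∑-mono (λ c → ind-mono (Q? c) (Q? c) id (λ (_ , ac , lt) → light ac lt)) ⟩
    ∑ (λ c → ind (Q? c) (M * w u)) ≤⟨ cover Q? (λ _ → M * w u) (proj₁ (reach x)) (λ c (xc , _) → proj₂ (proj₂ (reach x)) c xc) ⟩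
    sum (map (λ _ → M * w u) (proj₁ (reach x))) ≤⟨ sum-≤ (λ _ → M * w u) (M * w u) (proj₁ (reach x)) (λ _ _ → ≤-refl) ⟩
    length (proj₁ (reach x)) * (M * w u) ≤⟨ *-monoˡ-≤ (M * w u) (proj₁ (proj₂ (reach x))) ⟩
    W * (M * w u) ≡⟨ sym (*-assoc W M (w u)) ⟩
    W * M * w u ∎
    where
    open ≤-Reasoning
    Q? : Decidable (λ c → Wk x c × alive c × b c < b u)
    Q? c = Wk? x c ×-dec (alive? c ×-dec (b c <? b u))
    light : ∀ {c} → alive c → b c < b u → Γ * w⁻ c ≤ M * w u
    light {c} ac lt = begin
      Γ * w⁻ c      ≤⟨ *-monoʳ-≤ Γ (heavy ac) ⟩
      Γ * (M * w c) ≡⟨ trans (sym (*-assoc Γ M (w c))) (trans (cong (_* w c) (*-comm Γ M)) (*-assoc M Γ (w c))) ⟩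
      M * (Γ * w c) ≤⟨ *-monoʳ-≤ M (gap au ac lt) ⟩
      M * w u       ∎

-- Greedy construction of the closure of a tree

module Inner {n : ℕ} (E : Fin n → Fin n → Set) (E? : ∀ u v → Dec (E u v))
             (E-sym : ∀ {u v} → E u v → E v u) where
  open Walks E E? E-sym

  inner : ∀ {P ℓ v u} → Walk P ℓ v u → List (Fin n)
  inner here = []
  inner (step {v = v} _ _ k) = v ∷ inner k

  length-inner : ∀ {P ℓ v u} (k : Walk P ℓ v u) → length (inner k) ≤ ℓ
  length-inner here = z≤n
  length-inner (step _ _ k) = s≤s (length-inner k)

  inner-walk : ∀ {P ℓ v u} (k : Walk P ℓ v u) {x} → x ∈ inner k → P x × Walk (λ y → P y × y ∈ inner k) ℓ v x
  inner-walk (step p e k) (here refl) = p , here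
  inner-walk (step p e k) (there i) with inner-walk k i
  ... | px , k′ = px , step (p , here refl) e (walk-map (λ (q , j) → q , there j) k′)

  inner-last : ∀ {P ℓ v u} (k : Walk P ℓ v u) → ¬ v ≡ u → ∃[ x ] (x ∈ inner k × E x u)
  inner-last here ne = ⊥-elim (ne refl)
  inner-last {u = u} (step {v = v} {w = w} p e k) ne with w FinP.≟ u
  ... | yes refl = v , here refl , e
  ... | no ne′ with inner-last k ne′
  ...   | x , i , e′ = x , there i , e′

-- A family of branch sets, indexed by the words over Fin k of length at most t, modelling
-- the closure of the complete k-ary tree of depth suc t.
record TreeModel {n : ℕ} (E : Fin n → Fin n → Set) (E? : ∀ u v → Dec (E u v))
                 (E-sym : ∀ {u v} → E u v → E v u) (k t : ℕ) : Set where
  open Walks E E? E-sym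
  field
    f         : List (Fin k) → List (Fin n)
    connected : ∀ q → length q ≤ t → ∃[ x ] (x ∈ f q × (∀ y → y ∈ f q → ∃[ ℓ ] Walk (_∈ f q) ℓ x y))
    disjoint  : ∀ q q′ x → length q ≤ t → length q′ ≤ t → x ∈ f q → x ∈ f q′ → q ≡ q′
    edges     : ∀ q a q′ → length (q ++ a ∷ q′) ≤ t → ∃[ x ] ∃[ y ] (x ∈ f q × y ∈ f (q ++ a ∷ q′) × E x y)

module Size (λ₀ k : ℕ) where
  size : ℕ → ℕ
  size zero    = λ₀
  size (suc t) = suc λ₀ + k * size t

module TreeBuild {n : ℕ} {E : Fin n → Fin n → Set} {E? : ∀ u v → Dec (E u v)}
            {E-sym : ∀ {u v} → E u v → E v u} (S : Setting E E? E-sym)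
            (s ρZ k Q : ℕ) (2ρZ≤ρ : ρZ + ρZ ≤ Setting.ρ S) (1≤W : 1 ≤ Setting.W S) where
  open Walks E E? E-sym
  open Inner E E? E-sym
  open Setting S
  open Structure S
  open Tree S s ρZ k Q 2ρZ≤ρ

  λ₀ : ℕ
  λ₀ = suc (suc s * ρZ)
  open Size λ₀ k

  -- Realised by `z` together with its walks to the first `m` chain entries, the entries themselves
  -- left out: those belong to the ancestors.
  IsLeaf : Fin n → ℕ → List (Fin n) → Set
  IsLeaf z m L = length L ≤ suc (m * ρZ) × z ∈ L
    × (∀ x → x ∈ L → Walk (λ y → Below (b z) y × y ∈ L) ρZ z x × Below (b z) x)
    × (∀ i → i < m → ∃[ x ] (x ∈ L × E x (ch z i)))

  leaf-upto : ∀ z → Z z → ∀ m → m ≤ suc s → ∃ (IsLeaf z m)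
  leaf-upto z p zero le = z ∷ [] , s≤s z≤n , here refl , (λ { x (here refl) → here , proj₁ p , ≤-refl }) , λ i ()
  leaf-upto z p (suc m) le with leaf-upto z p m (<⇒≤ le) | ch-SR p m le
  ... | L , len , z∈ , cn , up | _ , lt , k =
      inner k ++ L
    , ≤-trans (≤-reflexive (length-++ (inner k))) (≤-trans (+-mono-≤ (length-inner k) len) (≤-reflexive (+-suc ρZ (m * ρZ))))
    , ∈-++⁺ʳ (inner k) z∈
    , cn′
    , up′
    where
    cn′ : ∀ x → x ∈ inner k ++ L → Walk (λ y → Below (b z) y × y ∈ inner k ++ L) ρZ z x × Below (b z) x
    cn′ x i with ∈-++⁻ (inner k) i
    ... | inj₁ j = walk-map (λ (q , h) → q , ∈-++⁺ˡ h) (proj₂ (inner-walk k j)) , proj₁ (inner-walk k j)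
    ... | inj₂ j = walk-map (λ (q , h) → q , ∈-++⁺ʳ (inner k) h) (proj₁ (cn x j)) , proj₂ (cn x j)
    up′ : ∀ i → i < suc m → ∃[ x ] (x ∈ inner k ++ L × E x (ch z i))
    up′ i l with m≤n⇒m<n∨m≡n (s≤s⁻¹ l)
    ... | inj₁ l′ = let (x , j , e) = up i l′ in x , ∈-++⁺ʳ (inner k) j , e
    ... | inj₂ refl = let (x , j , e) = inner-last k (λ q → <-irrefl (cong b q) lt) in x , ∈-++⁺ˡ j , e

  abstract
    leaves : ∀ z → Σ (List (Fin n)) λ L → Z z → IsLeaf z (suc s) L
    leaves z with Z? z
    ... | yes p = proj₁ (leaf-upto z p (suc s) ≤-refl) , λ _ → proj₂ (leaf-upto z p (suc s) ≤-refl)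
    ... | no ¬p = [] , λ p → ⊥-elim (¬p p)

  Lf : Fin n → List (Fin n)
  Lf z = proj₁ (leaves z)

  leaf : ∀ {z} → Z z → IsLeaf z (suc s) (Lf z)
  leaf {z} = proj₂ (leaves z)

  -- What a newly selected `z` contributes when the entries from `t` on are already fixed: the entry
  -- just before `t`, or the leaf if there is none.
  Obj : ℕ → Fin n → List (Fin n)
  Obj zero    z = Lf z
  Obj (suc t) z = ch z t ∷ []

  ch-alive : ∀ {z} → Z z → ∀ t → t < suc s → alive (ch z t)
  ch-alive p t l = proj₁ (ch-SR p t l)

  obj-hit : ∀ t z x → t < suc s → Z z → x ∈ Obj t z → Hit x (ch z t) z
  obj-hit zero z x l p i with proj₁ (proj₂ (proj₂ (leaf p))) x i
  ... | k , bx with walk-min π k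
  ...   | c , o , _ , _ , fw , bw = c , walk-≤ ρZ≤ρ bw , proj₁ bc , ≤-<-trans (proj₂ bc) (proj₁ (proj₂ (ch-SR p 0 l))) , walk-≤ ρZ≤ρ fw
    where
    bc : Below (b z) c
    bc = [ (λ { refl → bx }) , proj₁ ]′ o
  obj-hit (suc t) z x l p (here refl) =
    x , here , ch-alive p t (<⇒≤ l) , ch-mono p t (suc t) ≤-refl l , SR⇒Wk ρZ≤ρ (ch-SR p t (<⇒≤ l))

  Fit : ℕ → Set
  Fit x = Q * (x * (W * M)) < Γ

  Fit-≤ : ∀ {x y} → x ≤ y → Fit y → Fit x
  Fit-≤ l h = ≤-<-trans (*-monoʳ-≤ Q (*-monoˡ-≤ (W * M) l)) h

  Avoids : List (Fin n) → List (Fin n) → Set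
  Avoids L U = ∀ x → x ∈ L → x ∈ U → ⊥

  avoids⊎meets : ∀ L U → Avoids L U ⊎ (∃[ x ] (x ∈ L × x ∈ U))
  avoids⊎meets [] U = inj₁ (λ x ())
  avoids⊎meets (x ∷ L) U with Any.any? (x FinP.≟_) U | avoids⊎meets L U
  ... | yes m | _ = inj₂ (x , here refl , m)
  ... | no ¬m | inj₂ (y , i , j) = inj₂ (y , there i , j)
  ... | no ¬m | inj₁ a = inj₁ λ { y (here refl) j → ¬m j ; y (there i) j → a y i j }

  avoids? : ∀ L U → Dec (Avoids L U)
  avoids? L U with avoids⊎meets L U
  ... | inj₁ a           = yes a
  ... | inj₂ (x , i , j) = no (λ a → a x i j)

  hits : ∀ U {u} → alive u → Γ * wt w (λ z → Any.any? (λ x → Hit? x u z) U) ≤ length U * (W * M * w u)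
  hits [] {u} au = ≤-trans (≤-reflexive (trans (cong (Γ *_) (∑-0 {n} (λ z → refl))) (*-zeroʳ Γ))) z≤n
  hits (x ∷ U) {u} au = begin
    Γ * wt w (λ z → Any.any? (λ x → Hit? x u z) (x ∷ U))
      ≤⟨ *-monoʳ-≤ Γ (wt-⊎ w (λ z → Any.any? (λ x → Hit? x u z) (x ∷ U)) (Hit? x u) (λ z → Any.any? (λ x → Hit? x u z) U)
           (λ { z (here h) → inj₁ h ; z (there h) → inj₂ h })) ⟩
    Γ * (wt w (Hit? x u) + wt w (λ z → Any.any? (λ x → Hit? x u z) U)) ≡⟨ *-distribˡ-+ Γ _ _ ⟩
    Γ * wt w (Hit? x u) + Γ * wt w (λ z → Any.any? (λ x → Hit? x u z) U) ≤⟨ +-mono-≤ (hit-weight x au) (hits U au) ⟩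
    W * M * w u + length U * (W * M * w u) ∎
    where open ≤-Reasoning

  -- The vertices extending the chain of z₀ downwards are too heavy to be all blocked by few used vertices.
  select : ∀ t z₀ U → t < suc s → R (suc t) z₀ → Fit (length U) → ∃[ z ] (R t z × Same t z₀ z × Avoids (Obj t z) U)
  select t z₀ U l (r₀ , rich) fit with FinP.any? (λ z → R? t z ×-dec (Same? t z₀ z ×-dec avoids? (Obj t z) U))
  ... | yes p = p
  ... | no none = ⊥-elim (<-irrefl refl (begin-strict
      Γ * w u ≤⟨ *-monoʳ-≤ Γ rich ⟩
      Γ * (Q * wt w (λ z → R? t z ×-dec Same? t z₀ z)) ≡⟨ *-swap Γ Q _ ⟩
      Q * (Γ * wt w (λ z → R? t z ×-dec Same? t z₀ z)) ≤⟨ *-monoʳ-≤ Q (*-monoʳ-≤ Γ (wt-mono w (λ z → R? t z ×-dec Same? t z₀ z) (λ z → Any.any? (λ x → Hit? x u z) U) blocked)) ⟩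
      Q * (Γ * wt w (λ z → Any.any? (λ x → Hit? x u z) U)) ≤⟨ *-monoʳ-≤ Q (hits U au) ⟩
      Q * (length U * (W * M * w u)) ≡⟨ trans (cong (Q *_) (sym (*-assoc (length U) (W * M) (w u)))) (sym (*-assoc Q _ (w u))) ⟩
      Q * (length U * (W * M)) * w u <⟨ *-monoˡ-< (w u) {{>-nonZero (pos au)}} fit ⟩
      Γ * w u ∎))
    where
    open ≤-Reasoning
    u = ch z₀ t
    au = ch-alive (R⇒Z t r₀) t l
    blocked : ∀ z → R t z × Same t z₀ z → Any.Any (λ x → Hit x u z) U
    blocked z (r , same) with avoids⊎meets (Obj t z) U
    ... | inj₁ a = ⊥-elim (none (z , r , same , a))
    ... | inj₂ (x , i , j) = lose j (subst (λ u → Hit x u z) (sym (same l ≤-refl)) (obj-hit t z x l (R⇒Z t r) i))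

  -- Repeated selection fixes the chain downwards entry by entry; of the objects met on the way only
  -- the final leaf is kept.
  find-leaf : ∀ t z₀ U → t < suc s → R (suc t) z₀ → Fit (length U) → ∃[ z ] (Z z × Same t z₀ z × Avoids (Lf z) U)
  find-leaf zero z₀ U l r fit = select zero z₀ U l r fit
  find-leaf (suc t) z₀ U l r fit with select (suc t) z₀ U l r fit
  ... | z₁ , r₁ , same , _ with find-leaf t z₁ U (<⇒≤ l) r₁ fit
  ...   | z , p , same′ , a = z , p , (λ il le → trans (same il le) (same′ il (<⇒≤ le))) , a

  -- The field `up` provides the edges to the ancestors, since their branch sets contain the chain
  -- entries of `z₀` from `t` on. The list `all` is what later siblings must avoid.
  record Sub (t : ℕ) (z₀ : Fin n) (U : List (Fin n)) : Set where
    field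
      model  : TreeModel E E? E-sym k t
    open TreeModel model public
    field
      all    : List (Fin n)
      length-all : length all ≤ size t
      ⊆all   : ∀ q → length q ≤ t → ∀ x → x ∈ f q → x ∈ all
      avoids : ∀ q → length q ≤ t → Avoids (f q) U
      up     : ∀ q → length q ≤ t → ∀ i → t ≤ i → i < suc s → ∃[ x ] (x ∈ f q × E x (ch z₀ i))

  weaken : ∀ {t z U U′} → (∀ x → x ∈ U → x ∈ U′) → Sub t z U′ → Sub t z U
  weaken h sub = record { model = Sub.model sub ; all = Sub.all sub ; length-all = Sub.length-all sub ; ⊆all = Sub.⊆all sub
                        ; avoids = λ q l x i j → Sub.avoids sub q l x i (h x j) ; up = Sub.up sub }

  record Kids (t : ℕ) (z₀ : Fin n) (U : List (Fin n)) (m : ℕ) : Set where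
    field
      kid        : ∀ a → a < m → ∃[ z ] (Same t z₀ z × Sub t z U)
    kf : ∀ {a} → a < m → List (Fin k) → List (Fin n)
    kf {a} l = Sub.f (proj₂ (proj₂ (kid a l)))
    field
      all        : List (Fin n)
      length-all : length all ≤ m * size t
      ⊆all       : ∀ {a} (l : a < m) q → length q ≤ t → ∀ x → x ∈ kf l q → x ∈ all
      apart      : ∀ {a a′} (l : a < m) (l′ : a′ < m) q q′ x → length q ≤ t → length q′ ≤ t →
                   x ∈ kf l q → x ∈ kf l′ q′ → a ≡ a′

  mutual
    build : ∀ t z₀ U → t ≤ suc s → R t z₀ → Avoids (Obj t z₀) U → Fit (length U + size t) → Sub t z₀ U
    build zero z₀ U l p av fit = record
      { model = record
        { f = λ _ → Lf z₀
        ; connected = λ _ _ → z₀ , proj₁ (proj₂ (leaf p)) , λ y i → ρZ , walk-map proj₂ (proj₁ (proj₁ (proj₂ (proj₂ (leaf p))) y i))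
        ; disjoint = λ { [] [] x _ _ _ _ → refl }
        ; edges = λ { [] a q′ () ; (_ ∷ _) a q′ () } }
      ; all = Lf z₀ ; length-all = proj₁ (leaf p) ; ⊆all = λ _ _ x i → i
      ; avoids = λ _ _ → av
      ; up = λ _ _ i _ l′ → proj₂ (proj₂ (proj₂ (leaf p))) i l′ }
    build (suc t) z₀ U l r av fit = record
      { model = record { f = f ; connected = connected ; disjoint = disjoint ; edges = edges }
      ; all = root ++ K.all
      ; length-all = ≤-trans (≤-reflexive (length-++ root)) (+-mono-≤ root-len K.length-all)
      ; ⊆all = λ { [] _ x i → ∈-++⁺ˡ i ; (a ∷ q) (s≤s lq) x i → ∈-++⁺ʳ root (K.⊆all (FinP.toℕ<n a) q lq x i) }
      ; avoids = avoids′
      ; up = up′ }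
      where
      u = ch z₀ t
      found = find-leaf t z₀ U l r (Fit-≤ (m≤m+n (length U) (size (suc t))) fit)
      z = proj₁ found
      pz = proj₁ (proj₂ found)
      same = proj₁ (proj₂ (proj₂ found))
      -- The vertex `u` alone need not be adjacent to the chain entries above it. The attached leaf
      -- is adjacent to `u` and to all those entries, as its chain agrees with that of `z₀` from `t`
      -- on.
      root = u ∷ Lf z
      root-len : length root ≤ suc λ₀
      root-len = s≤s (proj₁ (leaf pz))
      kids : Kids t z₀ (root ++ U) k
      kids = build-kids t z₀ (root ++ U) l r k (Fit-≤ (begin
          length (root ++ U) + k * size t     ≡⟨ cong (_+ k * size t) (length-++ root) ⟩
          length root + length U + k * size t ≤⟨ +-monoˡ-≤ (k * size t) (+-monoˡ-≤ (length U) root-len) ⟩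
          suc λ₀ + length U + k * size t      ≡⟨ cong (_+ k * size t) (+-comm (suc λ₀) (length U)) ⟩
          length U + suc λ₀ + k * size t      ≡⟨ +-assoc (length U) (suc λ₀) _ ⟩
          length U + size (suc t)             ∎) fit)
        where open ≤-Reasoning
      module K = Kids kids
      module Kid (a : Fin k) = Sub (proj₂ (proj₂ (K.kid (toℕ a) (FinP.toℕ<n a))))
      kid-same : ∀ a → Same t z₀ (proj₁ (K.kid (toℕ a) (FinP.toℕ<n a)))
      kid-same a = proj₁ (proj₂ (K.kid (toℕ a) (FinP.toℕ<n a)))
      f : List (Fin k) → List (Fin n)
      f []      = root
      f (a ∷ q) = Kid.f a q
      to-u : ∃[ x ] (x ∈ Lf z × E x u)
      to-u = let (x , i , e) = proj₂ (proj₂ (proj₂ (leaf pz))) t l in x , i , subst (E x) (sym (same l ≤-refl)) e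
      connected : ∀ q → length q ≤ suc t → ∃[ x ] (x ∈ f q × (∀ y → y ∈ f q → ∃[ ℓ ] Walk (_∈ f q) ℓ x y))
      connected (a ∷ q) (s≤s lq) = Kid.connected a q lq
      connected [] _ = z , there (proj₁ (proj₂ (leaf pz))) , λ
        { y (here refl) → let (x , i , e) = to-u in
            suc ρZ , walk-∷ʳ (walk-map (there ∘ proj₂) (proj₁ (proj₁ (proj₂ (proj₂ (leaf pz))) x i))) (there i) e
        ; y (there i) → ρZ , walk-map (there ∘ proj₂) (proj₁ (proj₁ (proj₂ (proj₂ (leaf pz))) y i)) }
      disjoint : ∀ q q′ x → length q ≤ suc t → length q′ ≤ suc t → x ∈ f q → x ∈ f q′ → q ≡ q′
      disjoint [] [] x _ _ _ _ = refl
      disjoint [] (a ∷ q) x _ (s≤s l′) i j = ⊥-elim (Kid.avoids a q l′ x j (∈-++⁺ˡ i))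
      disjoint (a ∷ q) [] x (s≤s l′) _ i j = ⊥-elim (Kid.avoids a q l′ x i (∈-++⁺ˡ j))
      disjoint (a ∷ q) (a′ ∷ q′) x (s≤s l₁) (s≤s l₂) i j
        with FinP.toℕ-injective (K.apart (FinP.toℕ<n a) (FinP.toℕ<n a′) q q′ x l₁ l₂ i j)
      ... | refl = cong (a ∷_) (Kid.disjoint a q q′ x l₁ l₂ i j)
      edges : ∀ q a q′ → length (q ++ a ∷ q′) ≤ suc t → ∃[ x ] ∃[ y ] (x ∈ f q × y ∈ f (q ++ a ∷ q′) × E x y)
      edges (c ∷ q) a q′ (s≤s l′) = Kid.edges c q a q′ l′
      edges [] a q′ (s≤s l′) with Kid.up a q′ l′ t ≤-refl l
      ... | y , i , e = u , y , here refl , i , E-sym (subst (E y) (sym (kid-same a l ≤-refl)) e)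
      avoids′ : ∀ q → length q ≤ suc t → Avoids (f q) U
      avoids′ [] _ x (here refl) j = av x (here refl) j
      avoids′ [] _ x (there i) j = proj₂ (proj₂ (proj₂ found)) x i j
      avoids′ (a ∷ q) (s≤s l′) x i j = Kid.avoids a q l′ x i (∈-++⁺ʳ root j)
      up′ : ∀ q → length q ≤ suc t → ∀ i → suc t ≤ i → i < suc s → ∃[ x ] (x ∈ f q × E x (ch z₀ i))
      up′ [] _ i le l′ = let (x , j , e) = proj₂ (proj₂ (proj₂ (leaf pz))) i l′ in x , there j , subst (E x) (sym (same l′ (<⇒≤ le))) e
      up′ (a ∷ q) (s≤s lq) i le l′ = let (x , j , e) = Kid.up a q lq i (<⇒≤ le) l′ in x , j , subst (E x) (sym (kid-same a l′ (<⇒≤ le))) e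

    build-kids : ∀ t z₀ U → t < suc s → R (suc t) z₀ → ∀ m → Fit (length U + m * size t) → Kids t z₀ U m
    build-kids t z₀ U l r zero fit = record { kid = λ a () ; all = [] ; length-all = z≤n ; ⊆all = λ () ; apart = λ () }
    build-kids t z₀ U l r (suc m) fit = record
      { kid = kid ; all = Sub.all new ++ O.all
      ; length-all = ≤-trans (≤-reflexive (length-++ (Sub.all new))) (+-mono-≤ (Sub.length-all new) O.length-all)
      ; ⊆all = ⊆all′ ; apart = apart′ }
      where
      open ≤-Reasoning
      old : Kids t z₀ U m
      old = build-kids t z₀ U l r m (Fit-≤ (+-monoʳ-≤ (length U) (m≤n+m _ (size t))) fit)
      module O = Kids old
      U′ = O.all ++ U
      fit′ : Fit (length U′ + size t)
      fit′ = Fit-≤ (begin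
          length U′ + size t                ≡⟨ cong (_+ size t) (trans (length-++ O.all) (+-comm _ (length U))) ⟩
          length U + length O.all + size t  ≤⟨ +-monoˡ-≤ (size t) (+-monoʳ-≤ (length U) O.length-all) ⟩
          length U + m * size t + size t    ≡⟨ trans (+-assoc (length U) _ _) (cong (length U +_) (+-comm (m * size t) (size t))) ⟩
          length U + suc m * size t         ∎) fit
      sel = select t z₀ U′ l r (Fit-≤ (m≤m+n (length U′) (size t)) fit′)
      z = proj₁ sel
      new : Sub t z U′
      new = build t z U′ (<⇒≤ l) (proj₁ (proj₂ sel)) (proj₂ (proj₂ (proj₂ sel))) fit′
      kid′ : ∀ a → (a < m) ⊎ (a ≡ m) → ∃[ z ] (Same t z₀ z × Sub t z U)
      kid′ a (inj₁ l′) = O.kid a l′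
      kid′ a (inj₂ _) = z , proj₁ (proj₂ (proj₂ sel)) , weaken (λ x i → ∈-++⁺ʳ O.all i) new
      split : ∀ {a} → a < suc m → (a < m) ⊎ (a ≡ m)
      split l′ = m≤n⇒m<n∨m≡n (s≤s⁻¹ l′)
      kid : ∀ a → a < suc m → ∃[ z ] (Same t z₀ z × Sub t z U)
      kid a l′ = kid′ a (split l′)
      g : ∀ {a} → (a < m) ⊎ (a ≡ m) → List (Fin k) → List (Fin n)
      g {a} c = Sub.f (proj₂ (proj₂ (kid′ a c)))
      ⊆all′ : ∀ {a} (l′ : a < suc m) q → length q ≤ t → ∀ x → x ∈ g (split l′) q → x ∈ Sub.all new ++ O.all
      ⊆all′ l′ q lq x i with split l′
      ... | inj₁ l″ = ∈-++⁺ʳ (Sub.all new) (O.⊆all l″ q lq x i)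
      ... | inj₂ _  = ∈-++⁺ˡ (Sub.⊆all new q lq x i)
      apart′ : ∀ {a a′} (l₁ : a < suc m) (l₂ : a′ < suc m) q q′ x → length q ≤ t → length q′ ≤ t →
               x ∈ g (split l₁) q → x ∈ g (split l₂) q′ → a ≡ a′
      apart′ l₁ l₂ q q′ x lq lq′ i j with split l₁ | split l₂
      ... | inj₁ m₁ | inj₁ m₂ = O.apart m₁ m₂ q q′ x lq lq′ i j
      ... | inj₂ e₁ | inj₂ e₂ = trans e₁ (sym e₂)
      ... | inj₁ m₁ | inj₂ _ = ⊥-elim (Sub.avoids new q′ lq′ x j (∈-++⁺ˡ (O.⊆all m₁ q lq x i)))
      ... | inj₂ _ | inj₁ m₂ = ⊥-elim (Sub.avoids new q lq x i (∈-++⁺ˡ (O.⊆all m₂ q′ lq′ x j)))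

  Z-small : Fit (size (suc s)) → ¬ TreeModel E E? E-sym k (suc s) → Q * wt w Z? ≤ suc s * (K * ∑ w)
  Z-small fit ¬model with FinP.any? (R? (suc s))
  ... | yes (z , r) = ⊥-elim (¬model (Sub.model (build (suc s) z [] ≤-refl r (λ _ _ ()) fit)))
  ... | no none = ≤-trans (total-loss (suc s) ≤-refl) (+-monoˡ-≤ _ (≤-trans (*-monoʳ-≤ Q (≤-reflexive (∑-0 (λ z → ind-no (R? (suc s) z) (λ r → none (z , r)))))) (≤-reflexive (*-zeroʳ Q))))

S< : ℕ → (ℕ → ℕ) → ℕ
S< zero    f = 0
S< (suc β) f = f β + S< β f

S<-mono : ∀ β {f g : ℕ → ℕ} → (∀ x → x < β → f x ≤ g x) → S< β f ≤ S< β g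
S<-mono zero    h = z≤n
S<-mono (suc β) h = +-mono-≤ (h β ≤-refl) (S<-mono β (λ x l → h x (m<n⇒m<1+n l)))

S<-tight : ∀ β {f g : ℕ → ℕ} → (∀ x → x < β → f x ≤ g x) → S< β g ≤ S< β f → ∀ x → x < β → g x ≤ f x
S<-tight (suc β) {f} {g} h le x l with m≤n⇒m<n∨m≡n (s≤s⁻¹ l)
... | inj₂ refl = +-cancelʳ-≤ (S< β f) (g β) (f β) (≤-trans (+-monoʳ-≤ (g β) (S<-mono β (λ x l → h x (m<n⇒m<1+n l)))) le)
... | inj₁ l′ = S<-tight β (λ x l → h x (m<n⇒m<1+n l)) (+-cancelˡ-≤ (f β) _ _ (≤-trans (+-monoˡ-≤ _ (h β ≤-refl)) le)) x l′

S<-ind : ∀ β {P : ℕ → Set} (P? : Decidable P) (f : ℕ → ℕ) c → (∀ x → x < β → P x → f x ≤ c) → S< β (λ x → ind (P? x) (f x)) ≤ # β P? * c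
S<-ind zero    P? f c h = z≤n
S<-ind (suc β) P? f c h = ≤-trans (+-mono-≤ (head (P? β) (h β ≤-refl)) (S<-ind β P? f c (λ x l → h x (m<n⇒m<1+n l))))
                                   (≤-reflexive (sym (*-distribʳ-+ c (ind (P? β) 1) (# β P?))))
  where
  head : ∀ {A : Set} {y} (d : Dec A) → (A → y ≤ c) → ind d y ≤ ind d 1 * c
  head (yes a) h = ≤-trans (h a) (≤-reflexive (sym (+-identityʳ c)))
  head (no _)  h = z≤n

-- The number of nonempty words of length at most `n` over `s` letters.
trie-size : ℕ → ℕ → ℕ
trie-size s zero    = 0
trie-size s (suc n) = s * suc (trie-size s n)

-- Level sequences at a stable scale

module Trie (β : ℕ) where
  cnt : ℕ → {P : List ℕ → Set} → Decidable P → ℕ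
  cnt zero    P? = 0
  cnt (suc n) P? = S< β (λ x → ind (P? (x ∷ [])) (suc (cnt n (λ q → P? (x ∷ q)))))

  cnt-mono : ∀ n {P Q : List ℕ → Set} (P? : Decidable P) (Q? : Decidable Q) → (∀ q → P q → Q q) → cnt n P? ≤ cnt n Q?
  cnt-mono zero    P? Q? f = z≤n
  cnt-mono (suc n) P? Q? f = S<-mono β (λ x _ → ind-mono (P? (x ∷ [])) (Q? (x ∷ [])) (f (x ∷ []))
                               (λ _ → s≤s (cnt-mono n (λ q → P? (x ∷ q)) (λ q → Q? (x ∷ q)) (λ q → f (x ∷ q)))))

  -- Nested finite sets of equal size coincide. This reduces stability of the tree of level
  -- sequences to comparing two numbers.
  cnt-tight : ∀ n {P Q : List ℕ → Set} (P? : Decidable P) (Q? : Decidable Q) → (∀ q → P q → Q q) →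
              (∀ q q′ → Q (q ++ q′) → Q q) → (∀ q x q′ → Q (q ++ x ∷ q′) → x < β) →
              cnt n Q? ≤ cnt n P? → ∀ x q → length (x ∷ q) ≤ n → Q (x ∷ q) → P (x ∷ q)
  cnt-tight (suc n) {P} {Q} P? Q? f cl bd le x q (s≤s l) p = go q l p (ind-pos (P? (x ∷ [])) pos)
    where
    x<β = bd [] x q p
    q₀ : Q (x ∷ [])
    q₀ = cl (x ∷ []) q p
    le′ = S<-tight β (λ x _ → ind-mono (P? (x ∷ [])) (Q? (x ∷ [])) (f (x ∷ []))
                               (λ _ → s≤s (cnt-mono n (λ q → P? (x ∷ q)) (λ q → Q? (x ∷ q)) (λ q → f (x ∷ q))))) le x x<β
    pos : 0 < ind (P? (x ∷ [])) (suc (cnt n (λ q → P? (x ∷ q))))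
    pos = ≤-trans (≤-trans (s≤s z≤n) (≤-reflexive (sym (ind-yes (Q? (x ∷ [])) q₀)))) le′
    go : ∀ q → length q ≤ n → Q (x ∷ q) → P (x ∷ []) × _ → P (x ∷ q)
    go [] _ _ (p , _) = p
    go (y ∷ q) l p (p₀ , _) = cnt-tight n (λ q → P? (x ∷ q)) (λ q → Q? (x ∷ q)) (λ q → f (x ∷ q))
        (λ q q′ → cl (x ∷ q) q′) (λ q → bd (x ∷ q))
        (s≤s⁻¹ (subst₂ _≤_ (ind-yes (Q? (x ∷ [])) q₀) (ind-yes (P? (x ∷ [])) p₀) le′)) y q l p

  cnt-bound : ∀ s n {P : List ℕ → Set} (P? : Decidable P) → P [] →
              (∀ q → length q < n → P q → # β (λ x → P? (q ++ x ∷ [])) ≤ s) → cnt n P? ≤ trie-size s n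
  cnt-bound s zero    P? p₀ h = z≤n
  cnt-bound s (suc n) P? p₀ h = ≤-trans
    (S<-ind β (λ x → P? (x ∷ [])) _ (suc (trie-size s n))
      (λ x _ p → s≤s (cnt-bound s n (λ q → P? (x ∷ q)) p (λ q l → h (x ∷ q) (s≤s l)))))
    (*-monoˡ-≤ (suc (trie-size s n)) (h [] (s≤s z≤n) p₀))

-- One edge and two walks of the previous scale: the length of the detour in `seq-down`.
radius : ℕ → ℕ
radius zero    = 1
radius (suc i) = suc (radius i + radius i)

radius-mono : ∀ {i j} → i ≤ j → radius i ≤ radius j
radius-mono {zero} {zero} z≤n = ≤-refl
radius-mono {zero} {suc j} z≤n = s≤s z≤n
radius-mono (s≤s l) = s≤s (+-mono-≤ (radius-mono l) (radius-mono l))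

module Tame {n : ℕ} {E : Fin n → Fin n → Set} {E? : ∀ u v → Dec (E u v)}
            {E-sym : ∀ {u v} → E u v → E v u} (S : Setting E E? E-sym) (s ρZ : ℕ) where
  open Walks E E? E-sym
  open Setting S
  open Structure S

  -- The bound is asked of everything weakly reached from `v`, because `few-children` and `queue-≤`
  -- apply it at the far end of a chain rather than at `v`.
  Tame : Fin n → Set
  Tame v = alive v × (∀ y → alive y × Wk v y → # β (Seen? ρZ y) ≤ s)

  Tame? : Decidable Tame
  Tame? v = alive? v ×-dec FinP.all? (λ y → (alive? y ×-dec Wk? v y) →-dec (# β (Seen? ρZ y) ≤? s))

  Wild : Fin n → Set
  Wild y = alive y × suc s ≤ # β (Seen? ρZ y)
  Wild? : Decidable Wild
  Wild? y = alive? y ×-dec (suc s ≤? # β (Seen? ρZ y))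

  -- Each untame vertex weakly reaches a wild one, and `heavy` limits the weight that can weakly
  -- reach a given vertex.
  untame : wt w (λ v → alive? v ×-dec ¬? (Tame? v)) ≤ M * wt w Wild?
  untame = begin
    wt w (λ v → alive? v ×-dec ¬? (Tame? v))
      ≤⟨ ∑-mono (λ v → ind-≤′ (alive? v ×-dec ¬? (Tame? v)) (λ (a , nt) → near v a nt)) ⟩
    ∑ (λ v → ∑ (λ y → ind (Wild? y) (ind (Wk? v y) (w v)))) ≡⟨ ∑-swap (λ v y → ind (Wild? y) (ind (Wk? v y) (w v))) ⟩
    ∑ (λ y → ∑ (λ v → ind (Wild? y) (ind (Wk? v y) (w v)))) ≡⟨ ∑-cong (λ y → sym (ind-∑ (Wild? y) (λ v → ind (Wk? v y) (w v)))) ⟩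
    ∑ (λ y → ind (Wild? y) (w⁻ y)) ≤⟨ ∑-mono (λ y → ind-mono (Wild? y) (Wild? y) id (λ (a , _) → heavy a)) ⟩
    ∑ (λ y → ind (Wild? y) (M * w y)) ≡⟨ ∑-cong (λ y → sym (ind-* (Wild? y) M (w y))) ⟩
    ∑ (λ y → M * ind (Wild? y) (w y)) ≡⟨ ∑-*ˡ M (λ y → ind (Wild? y) (w y)) ⟩
    M * wt w Wild? ∎
    where
    open ≤-Reasoning
    near : ∀ v → alive v → ¬ Tame v → w v ≤ ∑ (λ y → ind (Wild? y) (ind (Wk? v y) (w v)))
    near v a nt with FinP.any? (λ y → Wild? y ×-dec Wk? v y)
    ... | yes (y , wy , k) = ≤-trans (≤-reflexive (sym (trans (ind-yes (Wild? y) wy) (ind-yes (Wk? v y) k)))) (∑-≥ (λ y → ind (Wild? y) (ind (Wk? v y) (w v))) y)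
    ... | no none = ⊥-elim (nt (a , λ y (ay , k) → ≮⇒≥ (λ l → none (y , (ay , l) , k))))

module Tries {n : ℕ} {E : Fin n → Fin n → Set} {E? : ∀ u v → Dec (E u v)}
             {E-sym : ∀ {u v} → E u v → E v u} (S : Setting E E? E-sym) (s ρZ N I : ℕ)
             (2ρZ≤ρ : ρZ + ρZ ≤ Setting.ρ S) (fits : suc (N + N) * radius I ≤ ρZ) where
  open Walks E E? E-sym
  open Setting S
  open Structure S
  open Tame S s ρZ public
  open Trie β public

  Seq : ℕ → Fin n → List ℕ → Set
  Seq ℓ v []      = ⊤
  Seq ℓ v (x ∷ q) = ∃[ y ] (SR ℓ v y × b y ≡ x × Seq ℓ y q)

  Seq? : ∀ ℓ v → Decidable (Seq ℓ v)
  Seq? ℓ v []      = yes tt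
  Seq? ℓ v (x ∷ q) = FinP.any? (λ y → SR? ℓ v y ×-dec ((b y ≟ x) ×-dec Seq? ℓ y q))

  Seq-≤ : ∀ {ℓ ℓ′} → ℓ ≤ ℓ′ → ∀ v q → Seq ℓ v q → Seq ℓ′ v q
  Seq-≤ l v []      _ = tt
  Seq-≤ l v (x ∷ q) (y , r , e , m) = y , SR-≤ l r , e , Seq-≤ l y q m

  Seq-prefix : ∀ {ℓ} v q q′ → Seq ℓ v (q ++ q′) → Seq ℓ v q
  Seq-prefix v []      q′ _ = tt
  Seq-prefix v (x ∷ q) q′ (y , r , e , m) = y , r , e , Seq-prefix y q q′ m

  Seq-< : ∀ {ℓ} v q x q′ → Seq ℓ v (q ++ x ∷ q′) → x < β
  Seq-< v []      x q′ (y , r , refl , m) = b<β y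
  Seq-< v (x′ ∷ q) x q′ (y , r , e , m) = Seq-< y q x q′ m

  End : ℕ → Fin n → List ℕ → Fin n → Set
  End ℓ v []      y = v ≡ y
  End ℓ v (x ∷ q) y = ∃[ y₁ ] (SR ℓ v y₁ × b y₁ ≡ x × End ℓ y₁ q y)

  Seq-end : ∀ {ℓ} v q → Seq ℓ v q → ∃ (End ℓ v q)
  Seq-end v [] _ = v , refl
  Seq-end v (x ∷ q) (y , r , e , m) = let (z , h) = Seq-end y q m in z , y , r , e , h

  Seq-snoc : ∀ {ℓ} v q x → Seq ℓ v (q ++ x ∷ []) → ∃[ y ] ∃[ z ] (End ℓ v q y × SR ℓ y z × b z ≡ x)
  Seq-snoc v [] x (z , r , e , _) = v , z , refl , r , e
  Seq-snoc v (x′ ∷ q) x (y₁ , r , e , m) = let (y , z , h , r′ , e′) = Seq-snoc y₁ q x m in y , z , (y₁ , r , e , h) , r′ , e′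

  End-b : ∀ {ℓ v v′} q {y y′} → b v ≡ b v′ → End ℓ v q y → End ℓ v′ q y′ → b y ≡ b y′
  End-b [] e refl refl = e
  End-b (x ∷ q) _ (_ , _ , e , h) (_ , _ , e′ , h′) = End-b q (trans e (sym e′)) h h′

  End-walk : ∀ {ℓ v} q {y} → alive v → End ℓ v q y → alive y × b v ≤ b y × Walk (Lower (b y)) (length q * ℓ) v y
  End-walk [] a refl = a , ≤-refl , here
  End-walk (x ∷ q) a (y₁ , (a₁ , lt , k) , _ , h) with End-walk q a₁ h
  ... | ay , le , k′ = ay , ≤-trans (<⇒≤ lt) le , walk-++ (walk-map (λ (ax , bx) → ax , ≤-trans (≤-<-trans bx lt) le) k) k′

  -- All ends of `q` have the same level, so every next level is seen from one fixed end `y`: back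
  -- to `v`, along `q` to another end, and one walk further. Within `ρZ` this is possible by `fits`,
  -- and `y` sees at most `s` levels as `v` is tame.
  few-children : ∀ {ℓ v} → ℓ ≤ radius I → Tame v → ∀ q → length q ≤ N → Seq ℓ v q → # β (λ x → Seq? ℓ v (q ++ x ∷ [])) ≤ s
  few-children {ℓ} {v} ℓ≤ (av , tame) q lq m with Seq-end v q m
  ... | y , h with End-walk q av h
  ...   | ay , _ , k = ≤-trans (#-mono β (λ x → Seq? ℓ v (q ++ x ∷ [])) (Seen? ρZ y) seen)
                               (tame y (ay , top⇒Wk (≤-trans (≤-trans short (m≤m+n ρZ ρZ)) 2ρZ≤ρ) ay k))
    where
    lqℓ : length q * ℓ ≤ N * radius I
    lqℓ = *-mono-≤ lq ℓ≤
    long : length q * ℓ + (length q * ℓ + ℓ) ≤ ρZ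
    long = begin
      length q * ℓ + (length q * ℓ + ℓ) ≤⟨ +-mono-≤ lqℓ (+-mono-≤ lqℓ ℓ≤) ⟩
      N * radius I + (N * radius I + radius I) ≡⟨ trans (sym (+-assoc (N * radius I) _ _)) (trans (+-comm _ (radius I)) (cong (radius I +_) (sym (*-distribʳ-+ (radius I) N N)))) ⟩
      suc (N + N) * radius I ≤⟨ fits ⟩
      ρZ ∎
      where open ≤-Reasoning
    short : length q * ℓ ≤ ρZ
    short = ≤-trans (m≤m+n _ _) long
    seen : ∀ x → x < β → Seq ℓ v (q ++ x ∷ []) → Seen ρZ y x
    seen x _ m′ with Seq-snoc v q x m′
    ... | y′ , z , h′ , (az , lt , k″) , e with End-walk q av h′ | End-b q refl h′ h
    ...   | _ , _ , k′ | same = z , (az , ≤-<-trans (≤-reflexive (sym same)) lt , walk-≤ long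
              (walk-++ (walk-rev (walk-map (λ (a , l) → a , <⇒≤ l) k) (ay , ≤-refl))
                (walk-++ (walk-map (λ (a , l) → a , ≤-trans (<⇒≤ l) (≤-reflexive same)) k′)
                         (walk-map (λ (a , l) → a , ≤-trans l (≤-reflexive same)) k″)))) , e

  count : ℕ → Fin n → ℕ
  count i v = cnt (suc N) (Seq? (radius i) v)

  count-mono : ∀ i v → count i v ≤ count (suc i) v
  count-mono i v = cnt-mono (suc N) (Seq? (radius i) v) (Seq? (radius (suc i)) v) (Seq-≤ (radius-mono (n≤1+n i)) v)

  count-bound : ∀ i {v} → i ≤ I → Tame v → count i v ≤ trie-size s (suc N)
  count-bound i {v} i≤I t = cnt-bound s (suc N) (Seq? (radius i) v) tt
    (λ q l m → few-children (radius-mono i≤I) t q (s≤s⁻¹ l) m)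

  Unstable : ℕ → Fin n → Set
  Unstable i v = Tame v × count i v < count (suc i) v
  Unstable? : ∀ i → Decidable (Unstable i)
  Unstable? i v = Tame? v ×-dec (count i v <? count (suc i) v)

  changes : ∀ j v → ∑ {j} (λ i → ind (count (toℕ i) v <? count (suc (toℕ i)) v) 1) + count 0 v ≤ count j v
  changes j v = go j 0
    where
    go : ∀ j a → ∑ {j} (λ i → ind (count (a + toℕ i) v <? count (suc (a + toℕ i)) v) 1) + count a v ≤ count (a + j) v
    go zero a = ≤-reflexive (cong (λ x → count x v) (sym (+-identityʳ a)))
    go (suc j) a = begin
      ind (count (a + 0) v <? count (suc (a + 0)) v) 1 + rest + count a v
        ≡⟨ cong₂ (λ x y → ind (count x v <? count (suc x) v) 1 + y + count a v) (+-identityʳ a) (∑-cong {j} (λ i → cong (λ x → ind (count x v <? count (suc x) v) 1) (+-suc a (toℕ i)))) ⟩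
      ind (count a v <? count (suc a) v) 1 + rest′ + count a v ≡⟨ trans (cong (_+ count a v) (+-comm _ rest′)) (+-assoc rest′ _ _) ⟩
      rest′ + (ind (count a v <? count (suc a) v) 1 + count a v) ≤⟨ +-monoʳ-≤ rest′ (one (count a v <? count (suc a) v) (count-mono a v)) ⟩
      rest′ + count (suc a) v ≤⟨ go j (suc a) ⟩
      count (suc a + j) v ≡⟨ cong (λ x → count x v) (sym (+-suc a j)) ⟩
      count (a + suc j) v ∎
      where
      open ≤-Reasoning
      rest = ∑ {j} (λ i → ind (count (a + suc (toℕ i)) v <? count (suc (a + suc (toℕ i))) v) 1)
      rest′ = ∑ {j} (λ i → ind (count (suc a + toℕ i) v <? count (suc (suc a + toℕ i)) v) 1)
      one : ∀ {x y} (d : Dec (x < y)) → x ≤ y → ind d 1 + x ≤ y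
      one (yes l) _ = l
      one (no _) le = le

  -- For a tame vertex the count never decreases and is at most `trie-size s (suc N)`, so it changes
  -- at no more than that many of the `I` scales. Averaging over the scales finds a good one.
  stable-scale : 0 < I → ∃[ i ] (i < I × I * wt w (Unstable? i) ≤ trie-size s (suc N) * ∑ w)
  stable-scale I>0 with ∑-min {I} (λ i → wt w (Unstable? (toℕ i))) (trie-size s (suc N) * ∑ w) I>0 total
    where
    open ≤-Reasoning
    C = trie-size s (suc N)
    each : ∀ v → ∑ {I} (λ i → ind (Unstable? (toℕ i) v) (w v)) ≤ C * w v
    each v = [ yes-case , (λ ¬t → ≤-trans (≤-reflexive (∑-0 {I} (λ i → ind-no (Unstable? (toℕ i) v) (λ p → ¬t (proj₁ p))))) z≤n) ]′ (toSum (Tame? v))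
      where
      yes-case : Tame v → ∑ {I} (λ i → ind (Unstable? (toℕ i) v) (w v)) ≤ C * w v
      yes-case t = begin
        ∑ {I} (λ i → ind (Unstable? (toℕ i) v) (w v))
          ≤⟨ ∑-mono {I} (λ i → ind-mono (Unstable? (toℕ i) v) (count (toℕ i) v <? count (suc (toℕ i)) v) proj₂ (λ _ → ≤-refl)) ⟩
        ∑ {I} (λ i → ind (count (toℕ i) v <? count (suc (toℕ i)) v) (w v))
          ≡⟨ ∑-cong {I} (λ i → trans (cong (ind (count (toℕ i) v <? count (suc (toℕ i)) v)) (sym (*-identityʳ (w v)))) (sym (ind-* (count (toℕ i) v <? count (suc (toℕ i)) v) (w v) 1))) ⟩
        ∑ {I} (λ i → w v * ind (count (toℕ i) v <? count (suc (toℕ i)) v) 1) ≡⟨ ∑-*ˡ {I} (w v) (λ i → ind (count (toℕ i) v <? count (suc (toℕ i)) v) 1) ⟩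
        w v * ∑ {I} (λ i → ind (count (toℕ i) v <? count (suc (toℕ i)) v) 1) ≤⟨ *-monoʳ-≤ (w v) (≤-trans (≤-trans (m≤m+n _ (count 0 v)) (changes I v)) (count-bound I ≤-refl t)) ⟩
        w v * C ≡⟨ *-comm (w v) C ⟩
        C * w v ∎
    total : ∑ {I} (λ i → wt w (Unstable? (toℕ i))) ≤ C * ∑ w
    total = begin
      ∑ {I} (λ i → ∑ (λ v → ind (Unstable? (toℕ i) v) (w v))) ≡⟨ ∑-swap {I} (λ i v → ind (Unstable? (toℕ i) v) (w v)) ⟩
      ∑ (λ v → ∑ {I} (λ i → ind (Unstable? (toℕ i) v) (w v))) ≤⟨ ∑-mono each ⟩
      ∑ (λ v → C * w v) ≡⟨ ∑-*ˡ C w ⟩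
      C * ∑ w ∎
  ... | i , le = toℕ i , FinP.toℕ<n i , le

  module Scale (i : ℕ) where
    ℓ : ℕ
    ℓ = radius i

    stable-seq : ∀ {v} → ¬ (count i v < count (suc i) v) → ∀ q → length q ≤ suc N → Seq (radius (suc i)) v q → Seq ℓ v q
    stable-seq {v} st [] _ _ = tt
    stable-seq {v} st (x ∷ q) l m = cnt-tight (suc N) (Seq? ℓ v) (Seq? (radius (suc i)) v)
      (Seq-≤ (radius-mono (n≤1+n i)) v) (Seq-prefix v) (Seq-< v) (≮⇒≥ st) x q l m

    seq-up : ∀ {v u} → alive v → alive u → E v u → b v < b u → ∀ q → Seq ℓ u q → Seq ℓ v (b u ∷ q)
    seq-up av au e lt q m = _ , (au , lt , walk-≤ (radius-mono {0} {i} z≤n) (step (av , ≤-refl) e (here {ℓ = 0}))) , refl , m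

    -- The level of u determines what is reached beyond it: another vertex of that level seen from v is close to u.
    seq-down : ∀ {v u} → alive v → alive u → E v u → b v < b u → ¬ (count i u < count (suc i) u) →
               ∀ q → length q ≤ suc N → Seq ℓ v (b u ∷ q) → Seq ℓ u q
    seq-down {v} {u} av au e lt st q lq (y , (ay , lt′ , k) , e′ , m) = stable-seq st q lq (move q m)
      where
      move : ∀ q → Seq ℓ y q → Seq (radius (suc i)) u q
      move [] _ = tt
      move (x ∷ q) (z , (az , lt″ , k″) , ez , m) =
        z , (az , ≤-<-trans (≤-reflexive (sym e′)) lt″
            , step (au , ≤-refl) (E-sym e) (walk-++ (walk-map (λ (a , l) → a , ≤-trans l (<⇒≤ lt)) k)
                                                     (walk-map (λ (a , l) → a , ≤-trans l (≤-reflexive e′)) k″)))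
          , ez , Seq-≤ (radius-mono (n≤1+n i)) z q m

argmax : ∀ {n} {P : Fin n → Set} (P? : Decidable P) (f : Fin n → ℕ) → ∃ P → ∃[ y ] (P y × (∀ y′ → P y′ → f y′ ≤ f y))
argmax {P = P} P? f (x , px) = climb (∑ f) x px (m≤m+n (∑ f) (f x))
  where
  climb : ∀ d x → P x → ∑ f ≤ d + f x → ∃[ y ] (P y × (∀ y′ → P y′ → f y′ ≤ f y))
  climb zero x p le = x , p , λ y′ _ → ≤-trans (∑-≥ f y′) le
  climb (suc d) x p le with FinP.any? (λ y → P? y ×-dec (f x <? f y))
  ... | no none = x , p , λ y′ p′ → ≮⇒≥ (λ l → none (y′ , p′ , l))
  ... | yes (y , p′ , l) = climb d y p′ (≤-trans le (≤-trans (≤-reflexive (sym (+-suc d (f x)))) (+-monoʳ-≤ d l)))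

-- Marking levels to bound the depth of unmarked chains

module Queue (s m₁ : ℕ) where
  m : ℕ
  m = suc m₁

  -- X k f / m ^ k bounds the probability that, each queued level being marked with probability 1 / m,
  -- k levels are processed before a queue of length f ≤ s runs empty,
  -- where an unmarked level may refill the queue up to length s.
  X : ℕ → ℕ → ℕ
  X zero    f       = 1
  X (suc k) zero    = 0
  X (suc k) (suc f) = X k f + m₁ * X k s

  X-mono : ∀ k {f f′} → f ≤ f′ → X k f ≤ X k f′
  X-mono zero    l       = ≤-refl
  X-mono (suc k) z≤n     = z≤n
  X-mono (suc k) (s≤s l) = +-monoˡ-≤ _ (X-mono k l)

module Potential (s m₁ L : ℕ) where
  open Queue s m₁ public

  -- The first exponent is the minimum of `R` and `L`. With `R` levels revealed and `f` queued,
  -- `P R f` is `m ^ L` times the probability bound of `X` for reaching `L` revealed levels, and it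
  -- stays at `m ^ L` once they are reached.
  P : ℕ → ℕ → ℕ
  P R f = m ^ (L ∸ (L ∸ R)) * X (L ∸ R) f

  P-mono : ∀ R {f f′} → f ≤ f′ → P R f ≤ P R f′
  P-mono R l = *-monoʳ-≤ (m ^ (L ∸ (L ∸ R))) (X-mono (L ∸ R) l)

  P-full : ∀ {R} f → L ≤ R → P R f ≡ m ^ L
  P-full {R} f l rewrite m≤n⇒m∸n≡0 l = *-identityʳ (m ^ L)

  -- Supermartingale inequality for revealing one level: with probability `1 / m` it is marked and
  -- the queue shrinks, otherwise the queue may refill to `s`.
  P-step : ∀ R {f f⁺ f⁻} → f⁺ < f → f⁻ ≤ s → P (suc R) f⁺ + m₁ * P (suc R) f⁻ ≤ m * P R f
  P-step R {suc f} {f⁺} {f⁻} (s≤s l⁺) l⁻ with L ≤? R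
  ... | yes L≤R = ≤-reflexive (trans (cong₂ (λ x y → x + m₁ * y) (P-full f⁺ (m≤n⇒m≤1+n L≤R)) (P-full f⁻ (m≤n⇒m≤1+n L≤R)))
                                     (cong (m *_) (sym (P-full (suc f) L≤R))))
  ... | no L≰R = begin
      c * X k f⁺ + m₁ * (c * X k f⁻) ≤⟨ +-mono-≤ (*-monoʳ-≤ c (X-mono k l⁺)) (*-monoʳ-≤ m₁ (*-monoʳ-≤ c (X-mono k l⁻))) ⟩
      c * X k f + m₁ * (c * X k s)   ≡⟨ trans (cong (c * X k f +_) (*-swap m₁ c (X k s))) (sym (*-distribˡ-+ c (X k f) (m₁ * X k s))) ⟩
      c * X (suc k) (suc f)          ≡⟨ cong (λ x → m ^ x * X (suc k) (suc f)) (+-∸-assoc 1 k<L) ⟩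
      m * m ^ (L ∸ suc k) * X (suc k) (suc f)   ≡⟨ *-assoc m (m ^ (L ∸ suc k)) (X (suc k) (suc f)) ⟩
      m * (m ^ (L ∸ suc k) * X (suc k) (suc f)) ≡⟨ cong (λ x → m * (m ^ (L ∸ x) * X x (suc f))) (sym k+1) ⟩
      m * P R (suc f) ∎
    where
    open ≤-Reasoning
    k = L ∸ suc R
    c = m ^ (L ∸ k)
    k+1 : L ∸ R ≡ suc k
    k+1 = +-∸-assoc 1 (≰⇒> L≰R)
    k<L : suc k ≤ L
    k<L = ≤-trans (≤-reflexive (sym k+1)) (m∸n≤m L R)

module Marks {n : ℕ} {E : Fin n → Fin n → Set} {E? : ∀ u v → Dec (E u v)}
             {E-sym : ∀ {u v} → E u v → E v u} (S : Setting E E? E-sym) (s ρZ m₁ L ℓ : ℕ)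
             (2ρZ≤ρ : ρZ + ρZ ≤ Setting.ρ S) (fits : suc (L + L) * ℓ ≤ ρZ) where
  open Walks E E? E-sym
  open Setting S
  open Structure S
  open Tame S s ρZ
  open Potential s m₁ L public

  -- The exploration from `v` by which levels enter its queue. Levels are decided in ascending
  -- order, and only those below `a`, decided and unmarked, may be passed through.
  Expo : (ℕ → Bool) → ℕ → ℕ → Fin n → ℕ → Set
  Expo μ a zero    v x = ⊥
  Expo μ a (suc k) v x = ∃[ y ] (SR ℓ v y × (b y ≡ x ⊎ (b y < a × μ (b y) ≡ false × Expo μ a k y x)))

  Expo? : ∀ μ a k v x → Dec (Expo μ a k v x)
  Expo? μ a zero    v x = no (λ ())
  Expo? μ a (suc k) v x = FinP.any? (λ y → SR? ℓ v y ×-dec ((b y ≟ x) ⊎-dec ((b y <? a) ×-dec ((μ (b y) ≟B false) ×-dec Expo? μ a k y x))))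

  Expo-≤ : ∀ {μ a k k′ v x} → k ≤ k′ → Expo μ a k v x → Expo μ a k′ v x
  Expo-≤ (s≤s l) (y , r , inj₁ e) = y , r , inj₁ e
  Expo-≤ (s≤s l) (y , r , inj₂ (lt , u , h)) = y , r , inj₂ (lt , u , Expo-≤ l h)

  Expo-agree : ∀ {μ μ′ a} → (∀ x → x < a → μ x ≡ μ′ x) → ∀ k {v x} → Expo μ a k v x → Expo μ′ a k v x
  Expo-agree h (suc k) (y , r , inj₁ e) = y , r , inj₁ e
  Expo-agree h (suc k) (y , r , inj₂ (lt , u , g)) = y , r , inj₂ (lt , trans (sym (h _ lt)) u , Expo-agree h k g)

  Expo-pred : ∀ {μ a} k {v x} → Expo μ (suc a) k v x → Expo μ a k v x ⊎ (Expo μ a k v a × μ a ≡ false)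
  Expo-pred (suc k) (y , r , inj₁ e) = inj₁ (y , r , inj₁ e)
  Expo-pred (suc k) (y , r , inj₂ (lt , u , g)) with m≤n⇒m<n∨m≡n (s≤s⁻¹ lt)
  ... | inj₂ refl = inj₂ ((y , r , inj₁ refl) , u)
  ... | inj₁ lt′ with Expo-pred k g
  ...   | inj₁ h = inj₁ (y , r , inj₂ (lt′ , u , h))
  ...   | inj₂ (h , ma) = inj₂ ((y , r , inj₂ (lt′ , u , h)) , ma)

  Act : (ℕ → Bool) → ℕ → Fin n → ℕ → Set
  Act μ a v x = a ≤ x × Expo μ a L v x
  Act? : ∀ μ a v → Decidable (Act μ a v)
  Act? μ a v x = (a ≤? x) ×-dec Expo? μ a L v x

  Inter : ℕ → ℕ → Fin n → Fin n → Set
  Inter a zero    v y = v ≡ y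
  Inter a (suc k) v y = v ≡ y ⊎ (∃[ y₁ ] (SR ℓ v y₁ × b y₁ < a × Inter a k y₁ y))
  Inter? : ∀ a k v y → Dec (Inter a k v y)
  Inter? a zero    v y = v FinP.≟ y
  Inter? a (suc k) v y = (v FinP.≟ y) ⊎-dec FinP.any? (λ y₁ → SR? ℓ v y₁ ×-dec ((b y₁ <? a) ×-dec Inter? a k y₁ y))

  Inter-refl : ∀ {a} k {v} → Inter a k v v
  Inter-refl zero    = refl
  Inter-refl (suc k) = inj₁ refl

  Inter-walk : ∀ {a} k {v y} → alive v → Inter a k v y →
               alive y × b v ≤ b y × (v ≡ y ⊎ b y < a) × Walk (Lower (b y)) (k * ℓ) v y
  Inter-walk zero av refl = av , ≤-refl , inj₁ refl , here
  Inter-walk (suc k) av (inj₁ refl) = av , ≤-refl , inj₁ refl , here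
  Inter-walk (suc k) av (inj₂ (y₁ , (a₁ , lt , w₁) , lt′ , h)) with Inter-walk k a₁ h
  ... | ay , le , o , w₂ = ay , ≤-trans (<⇒≤ lt) le , inj₂ ([ (λ { refl → lt′ }) , id ]′ o)
                         , walk-++ (walk-map (λ (ax , bx) → ax , ≤-trans (≤-<-trans bx lt) le) w₁) w₂

  Expo-inter : ∀ {μ a} k {v x} → Expo μ a (suc k) v x → ∃[ y ] ∃[ z ] (Inter a k v y × SR ℓ y z × b z ≡ x)
  Expo-inter zero (y , r , inj₁ e) = _ , y , refl , r , e
  Expo-inter (suc k) (y , r , inj₁ e) = _ , y , inj₁ refl , r , e
  Expo-inter (suc k) (y , r , inj₂ (lt , _ , g)) with Expo-inter k g
  ... | y′ , z , i , r′ , e = y′ , z , inj₂ (y , r , lt , i) , r′ , e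

  -- All queued levels are strongly reached from a single vertex, the highest one processed so far.
  queue-≤ : ∀ μ a {v} → Tame v → # β (Act? μ a v) ≤ s
  queue-≤ μ a {v} (av , tame) = by-fuel L refl
    where
    by-fuel : ∀ j → j ≡ L → # β (Act? μ a v) ≤ s
    by-fuel zero refl = ≤-trans (≤-reflexive (#-none β (Act? μ a v) (λ { x _ (_ , ()) }))) z≤n
    by-fuel (suc k) refl with argmax (Inter? a k v) b (v , Inter-refl k)
    ... | y , iy , ymax with Inter-walk k av iy
    ...   | ay , le , o , w₁ = ≤-trans (#-mono β (Act? μ a v) (Seen? ρZ y) seen)
                                       (tame y (ay , top⇒Wk (≤-trans short (≤-trans (m≤m+n ρZ ρZ) 2ρZ≤ρ)) ay w₁))
      where
      long : k * ℓ + (k * ℓ + ℓ) ≤ ρZ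
      long = begin
        k * ℓ + (k * ℓ + ℓ)     ≡⟨ cong (k * ℓ +_) (+-comm (k * ℓ) ℓ) ⟩
        k * ℓ + suc k * ℓ       ≡⟨ sym (*-distribʳ-+ ℓ k (suc k)) ⟩
        (k + suc k) * ℓ         ≤⟨ *-monoˡ-≤ ℓ (m≤n⇒m≤1+n (+-monoˡ-≤ (suc k) (n≤1+n k))) ⟩
        suc (suc k + suc k) * ℓ ≤⟨ fits ⟩
        ρZ ∎
        where open ≤-Reasoning
      short : k * ℓ ≤ ρZ
      short = ≤-trans (m≤m+n _ _) long
      seen : ∀ x → x < β → Act μ a v x → Seen ρZ y x
      seen x _ (a≤x , h) with Expo-inter k h
      ... | y′ , z , iy′ , (az , lt , w₃) , refl with Inter-walk k av iy′
      ...   | _ , le′ , _ , w₂ = z , (az , top< o , walk-≤ long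
                (walk-++ (walk-rev (walk-map (λ (p , l) → p , <⇒≤ l) w₁) (ay , ≤-refl))
                  (walk-++ (walk-map (λ (p , l) → p , ≤-trans (<⇒≤ l) (ymax y′ iy′)) w₂)
                           (walk-map (λ (p , l) → p , ≤-trans l (ymax y′ iy′)) w₃)))) , refl
        where
        top< : v ≡ y ⊎ b y < a → b y < b z
        top< (inj₁ refl) = ≤-<-trans le′ lt
        top< (inj₂ l) = ≤-trans l a≤x

  -- Each level `x` is judged by the marks below `x`, so the verdict does not change when higher
  -- levels are decided.
  Rev : (ℕ → Bool) → ℕ → Fin n → ℕ
  Rev μ a v = # a (λ x → Expo? μ x L v x)

  pot : (ℕ → Bool) → ℕ → Fin n → ℕ
  pot μ a v = P (Rev μ a v) (# β (Act? μ a v))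

  set : (ℕ → Bool) → ℕ → Bool → ℕ → Bool
  set μ a c x = if does (x ≟ a) then c else μ x

  set-at : ∀ μ a c → set μ a c a ≡ c
  set-at μ a c = if-yes (a ≟ a) refl

  set-below : ∀ μ a c x → x < a → set μ a c x ≡ μ x
  set-below μ a c x l = if-no (x ≟ a) (<⇒≢ l)

  Rev-agree : ∀ {μ μ′ a} → (∀ x → x < a → μ x ≡ μ′ x) → ∀ v → Rev μ a v ≡ Rev μ′ a v
  Rev-agree {μ} {μ′} {a} h v = ≤-antisym (half h) (half (λ x l → sym (h x l)))
    where
    half : ∀ {μ μ′} → (∀ x → x < a → μ x ≡ μ′ x) → Rev μ a v ≤ Rev μ′ a v
    half {μ} {μ′} h = #-mono a (λ x → Expo? μ x L v x) (λ x → Expo? μ′ x L v x) (λ x l → Expo-agree (λ y l′ → h y (<-trans l′ l)) L)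

  -- Deciding a level that is not exposed adds nothing to the queue of `v`. An exposed level is
  -- revealed; it leaves the queue without successors if marked, and otherwise the new queue is
  -- still bounded by `queue-≤`.
  transition : ∀ μ {a v} → a < β → Tame v → pot (set μ a true) (suc a) v + m₁ * pot (set μ a false) (suc a) v ≤ m * pot μ a v
  transition μ {a} {v} a<β t = [ exposed , hidden ]′ (toSum (Expo? μ a L v a))
    where
    μ⁺ = set μ a true
    μ⁻ = set μ a false
    back : ∀ c {x} → Expo (set μ a c) a L v x → Expo μ a L v x
    back c = Expo-agree (set-below μ a c) L
    exposed : Expo μ a L v a → _
    exposed e = subst₂ (λ x y → P x (# β (Act? μ⁺ (suc a) v)) + m₁ * P y (# β (Act? μ⁻ (suc a) v)) ≤ m * pot μ a v)
                  (sym (rev true)) (sym (rev false))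
                  (P-step (Rev μ a v) (#-remove β (Act? μ a v) (Act? μ⁺ (suc a) v) a a<β (≤-refl , e) (λ (l , _) → <-irrefl refl l) sub) (queue-≤ μ⁻ (suc a) t))
      where
      rev : ∀ c → Rev (set μ a c) (suc a) v ≡ suc (Rev μ a v)
      rev c = cong₂ _+_ (ind-yes (Expo? (set μ a c) a L v a) (Expo-agree (λ x l → sym (set-below μ a c x l)) L e)) (Rev-agree (set-below μ a c) v)
      sub : ∀ x → x < β → Act μ⁺ (suc a) v x → Act μ a v x
      sub x _ (l , h) with Expo-pred L h
      ... | inj₁ h′ = <⇒≤ l , back true h′
      ... | inj₂ (_ , e′) with trans (sym (set-at μ a true)) e′
      ...   | ()
    hidden : ¬ Expo μ a L v a → _
    hidden ne = subst₂ (λ x y → P x (# β (Act? μ⁺ (suc a) v)) + m₁ * P y (# β (Act? μ⁻ (suc a) v)) ≤ m * pot μ a v)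
                  (sym (rev true)) (sym (rev false))
                  (+-mono-≤ (P-mono (Rev μ a v) (#-mono β (Act? μ⁺ (suc a) v) (Act? μ a v) (sub true)))
                            (*-monoʳ-≤ m₁ (P-mono (Rev μ a v) (#-mono β (Act? μ⁻ (suc a) v) (Act? μ a v) (sub false)))))
      where
      rev : ∀ c → Rev (set μ a c) (suc a) v ≡ Rev μ a v
      rev c = cong₂ _+_ (ind-no (Expo? (set μ a c) a L v a) (λ h → ne (back c h))) (Rev-agree (set-below μ a c) v)
      sub : ∀ c x → x < β → Act (set μ a c) (suc a) v x → Act μ a v x
      sub c x _ (l , h) with Expo-pred L h
      ... | inj₁ h′ = <⇒≤ l , back c h′
      ... | inj₂ (h′ , _) = ⊥-elim (ne (back c h′))

  Marked : (ℕ → Bool) → ℕ → Fin n → Set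
  Marked μ a v = b v < a × μ (b v) ≡ true
  Marked? : ∀ μ a → Decidable (Marked μ a)
  Marked? μ a v = (b v <? a) ×-dec (μ (b v) ≟B true)

  -- Conditional expectations scaled by `m * m ^ L`: `t₁` bounds the expected weight of deep
  -- vertices, `t₂` is that of marked ones, an undecided level being marked with probability
  -- `1 / m`.
  t₁ t₂ : (ℕ → Bool) → ℕ → Fin n → ℕ
  t₁ μ a v = m * ind (Tame? v) (w v * pot μ a v)
  t₂ μ a v = m * m ^ L * ind (Marked? μ a v) (w v) + m ^ L * ind (a ≤? b v) (w v)

  t₁-step : ∀ μ {a} v → a < β → t₁ (set μ a true) (suc a) v + m₁ * t₁ (set μ a false) (suc a) v ≤ m * t₁ μ a v
  t₁-step μ {a} v a<β = [ yes-case , no-case ]′ (toSum (Tame? v))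
    where
    open ≤-Reasoning
    μ⁺ = set μ a true
    μ⁻ = set μ a false
    zero-term : ∀ μ a → ¬ Tame v → t₁ μ a v ≡ 0
    zero-term μ a nt = trans (cong (m *_) (ind-no (Tame? v) nt)) (*-zeroʳ m)
    no-case : ¬ Tame v → t₁ μ⁺ (suc a) v + m₁ * t₁ μ⁻ (suc a) v ≤ m * t₁ μ a v
    no-case nt = ≤-trans (≤-reflexive (trans (cong₂ (λ x y → x + m₁ * y) (zero-term μ⁺ (suc a) nt) (zero-term μ⁻ (suc a) nt)) (*-zeroʳ m₁))) z≤n
    yes-case : Tame v → t₁ μ⁺ (suc a) v + m₁ * t₁ μ⁻ (suc a) v ≤ m * t₁ μ a v
    yes-case t = begin
      m * ind (Tame? v) (w v * pot μ⁺ (suc a) v) + m₁ * (m * ind (Tame? v) (w v * pot μ⁻ (suc a) v))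
        ≡⟨ cong₂ (λ x y → m * x + m₁ * (m * y)) (ind-yes (Tame? v) t) (ind-yes (Tame? v) t) ⟩
      m * (w v * p⁺) + m₁ * (m * (w v * p⁻)) ≡⟨ cong (m * (w v * p⁺) +_) (trans (*-swap m₁ m (w v * p⁻)) (cong (m *_) (*-swap m₁ (w v) p⁻))) ⟩
      m * (w v * p⁺) + m * (w v * (m₁ * p⁻)) ≡⟨ trans (sym (*-distribˡ-+ m (w v * p⁺) (w v * (m₁ * p⁻)))) (cong (m *_) (sym (*-distribˡ-+ (w v) p⁺ (m₁ * p⁻)))) ⟩
      m * (w v * (p⁺ + m₁ * p⁻)) ≤⟨ *-monoʳ-≤ m (*-monoʳ-≤ (w v) (transition μ a<β t)) ⟩
      m * (w v * (m * pot μ a v)) ≡⟨ cong (m *_) (*-swap (w v) m (pot μ a v)) ⟩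
      m * (m * (w v * pot μ a v)) ≡⟨ cong (λ x → m * (m * x)) (sym (ind-yes (Tame? v) t)) ⟩
      m * t₁ μ a v ∎
      where
      p⁺ = pot μ⁺ (suc a) v
      p⁻ = pot μ⁻ (suc a) v

  t₂-step : ∀ μ a v → t₂ (set μ a true) (suc a) v + m₁ * t₂ (set μ a false) (suc a) v ≤ m * t₂ μ a v
  t₂-step μ a v with <-cmp (b v) a
  ... | tri< l _ _ = ≤-reflexive (cong₂ (λ x y → x + m₁ * y) (same true) (same false))
    where
    same : ∀ c → t₂ (set μ a c) (suc a) v ≡ t₂ μ a v
    same c = cong₂ (λ x y → m * m ^ L * x + m ^ L * y)
      (≤-antisym (ind-mono (Marked? (set μ a c) (suc a) v) (Marked? μ a v) (λ (_ , e) → l , trans (sym (set-below μ a c _ l)) e) (λ _ → ≤-refl))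
                 (ind-mono (Marked? μ a v) (Marked? (set μ a c) (suc a) v) (λ (_ , e) → m<n⇒m<1+n l , trans (set-below μ a c _ l) e) (λ _ → ≤-refl)))
      (trans (ind-no (suc a ≤? b v) (λ l′ → <-asym l l′)) (sym (ind-no (a ≤? b v) (<⇒≱ l))))
  ... | tri≈ _ refl _ = ≤-reflexive (begin
      t₂ (set μ (b v) true) (suc (b v)) v + m₁ * t₂ (set μ (b v) false) (suc (b v)) v
        ≡⟨ cong₂ (λ x y → x + m₁ * y)
             (cong₂ (λ x y → m * m ^ L * x + m ^ L * y) (ind-yes (Marked? (set μ (b v) true) (suc (b v)) v) (≤-refl , set-at μ (b v) true)) (ind-no (suc (b v) ≤? b v) (<-irrefl refl)))
             (cong₂ (λ x y → m * m ^ L * x + m ^ L * y) (ind-no (Marked? (set μ (b v) false) (suc (b v)) v) (λ (_ , e) → case trans (sym (set-at μ (b v) false)) e of λ ())) (ind-no (suc (b v) ≤? b v) (<-irrefl refl))) ⟩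
      m * m ^ L * w v + m ^ L * 0 + m₁ * (m * m ^ L * 0 + m ^ L * 0) ≡⟨ arith m₁ (m * m ^ L) (m ^ L) (w v) ⟩
      m * m ^ L * w v ≡⟨ *-assoc m (m ^ L) (w v) ⟩
      m * (m ^ L * w v) ≡⟨ cong (m *_) (cong (_+ m ^ L * w v) (sym (*-zeroʳ (m * m ^ L)))) ⟩
      m * (m * m ^ L * 0 + m ^ L * w v) ≡⟨ cong (m *_) (cong₂ (λ x y → m * m ^ L * x + m ^ L * y) (sym (ind-no (Marked? μ (b v) v) (λ (l , _) → <-irrefl refl l))) (sym (ind-yes (b v ≤? b v) ≤-refl))) ⟩
      m * t₂ μ (b v) v ∎)
    where
    open ≡-Reasoning
    arith : ∀ p q r x → q * x + r * 0 + p * (q * 0 + r * 0) ≡ q * x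
    arith = solve-∀
  ... | tri> _ _ l = ≤-reflexive (cong₂ (λ x y → x + m₁ * y) (same true) (same false))
    where
    same : ∀ c → t₂ (set μ a c) (suc a) v ≡ t₂ μ a v
    same c = cong₂ (λ x y → m * m ^ L * x + m ^ L * y)
      (trans (ind-no (Marked? (set μ a c) (suc a) v) (λ (l′ , _) → <⇒≱ l (s≤s⁻¹ l′))) (sym (ind-no (Marked? μ a v) (λ (l′ , _) → <-asym l l′))))
      (trans (ind-yes (suc a ≤? b v) l) (sym (ind-yes (a ≤? b v) (<⇒≤ l))))

  total : (ℕ → Bool) → ℕ → ℕ
  total μ a = ∑ (λ v → t₁ μ a v + t₂ μ a v)

  total-step : ∀ μ {a} → a < β → total (set μ a true) (suc a) + m₁ * total (set μ a false) (suc a) ≤ m * total μ a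
  total-step μ {a} a<β = begin
    ∑ f⁺ + m₁ * ∑ f⁻ ≡⟨ cong (∑ f⁺ +_) (sym (∑-*ˡ m₁ f⁻)) ⟩
    ∑ f⁺ + ∑ (λ v → m₁ * f⁻ v) ≡⟨ sym (∑-+ f⁺ (λ v → m₁ * f⁻ v)) ⟩
    ∑ (λ v → f⁺ v + m₁ * f⁻ v) ≤⟨ ∑-mono (λ v → ≤-trans (≤-reflexive (arith (t₁ (set μ a true) (suc a) v) (t₂ (set μ a true) (suc a) v) m₁ (t₁ (set μ a false) (suc a) v) (t₂ (set μ a false) (suc a) v)))
                                     (≤-trans (+-mono-≤ (t₁-step μ v a<β) (t₂-step μ a v)) (≤-reflexive (sym (*-distribˡ-+ m (t₁ μ a v) (t₂ μ a v)))))) ⟩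
    ∑ (λ v → m * (t₁ μ a v + t₂ μ a v)) ≡⟨ ∑-*ˡ m (λ v → t₁ μ a v + t₂ μ a v) ⟩
    m * total μ a ∎
    where
    open ≤-Reasoning
    f⁺ f⁻ : Fin n → ℕ
    f⁺ v = t₁ (set μ a true) (suc a) v + t₂ (set μ a true) (suc a) v
    f⁻ v = t₁ (set μ a false) (suc a) v + t₂ (set μ a false) (suc a) v
    arith : ∀ p q k r t → (p + q) + k * (r + t) ≡ (p + k * r) + (q + k * t)
    arith = solve-∀

  -- Method of conditional expectations: if both decisions on a level increased the total, so would
  -- their weighted average, against `total-step`.
  choose-marks : ∀ a → a ≤ β → ∃[ μ ] total μ a ≤ total (λ _ → false) 0
  choose-marks zero _ = (λ _ → false) , ≤-refl
  choose-marks (suc a) l with choose-marks a (<⇒≤ l)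
  ... | μ , le with ≤⊎> (total (set μ a true) (suc a)) (total μ a)
  ...   | inj₁ good = set μ a true , ≤-trans good le
  ...   | inj₂ bad with ≤⊎> (total (set μ a false) (suc a)) (total μ a)
  ...     | inj₁ good = set μ a false , ≤-trans good le
  ...     | inj₂ bad′ = ⊥-elim (<-irrefl refl (≤-trans (+-mono-<-≤ bad (*-monoʳ-≤ m₁ (<⇒≤ bad′))) (total-step μ l)))

  Deep : (ℕ → Bool) → Fin n → Set
  Deep μ v = Tame v × L ≤ Rev μ β v
  Deep? : ∀ μ → Decidable (Deep μ)
  Deep? μ v = Tame? v ×-dec (L ≤? Rev μ β v)

  marks : ∃[ μ ] m * m ^ L * (wt w (Deep? μ) + wt w (λ v → μ (b v) ≟B true)) ≤ (m * X L s + m ^ L) * ∑ w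
  marks with choose-marks β ≤-refl
  ... | μ , le = μ , (begin
      m * m ^ L * (wt w (Deep? μ) + wt w (λ v → μ (b v) ≟B true))
        ≡⟨ trans (cong (m * m ^ L *_) (sym (∑-+ (λ v → ind (Deep? μ v) (w v)) (λ v → ind (μ (b v) ≟B true) (w v))))) (sym (∑-*ˡ (m * m ^ L) (λ v → ind (Deep? μ v) (w v) + ind (μ (b v) ≟B true) (w v)))) ⟩
      ∑ (λ v → m * m ^ L * (ind (Deep? μ v) (w v) + ind (μ (b v) ≟B true) (w v))) ≤⟨ ∑-mono final ⟩
      total μ β ≤⟨ le ⟩
      total (λ _ → false) 0 ≤⟨ ∑-mono initial ⟩
      ∑ (λ v → (m * X L s + m ^ L) * w v) ≡⟨ ∑-*ˡ (m * X L s + m ^ L) w ⟩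
      (m * X L s + m ^ L) * ∑ w ∎)
    where
    open ≤-Reasoning
    final : ∀ v → m * m ^ L * (ind (Deep? μ v) (w v) + ind (μ (b v) ≟B true) (w v)) ≤ t₁ μ β v + t₂ μ β v
    final v = ≤-trans (≤-reflexive (*-distribˡ-+ (m * m ^ L) (ind (Deep? μ v) (w v)) (ind (μ (b v) ≟B true) (w v)))) (+-mono-≤ one
                (≤-trans (*-monoʳ-≤ (m * m ^ L) (ind-mono (μ (b v) ≟B true) (Marked? μ β v) (λ e → b<β v , e) (λ _ → ≤-refl))) (m≤m+n _ _)))
      where
      one : m * m ^ L * ind (Deep? μ v) (w v) ≤ m * ind (Tame? v) (w v * pot μ β v)
      one = ≤-trans (≤-reflexive (trans (*-assoc m (m ^ L) (ind (Deep? μ v) (w v))) (cong (m *_) (ind-* (Deep? μ v) (m ^ L) (w v)))))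
              (*-monoʳ-≤ m (ind-mono (Deep? μ v) (Tame? v) proj₁
                (λ (_ , l) → ≤-reflexive (trans (*-comm (m ^ L) (w v)) (cong (w v *_) (sym (P-full (# β (Act? μ β v)) l)))))))
    initial : ∀ v → t₁ (λ _ → false) 0 v + t₂ (λ _ → false) 0 v ≤ (m * X L s + m ^ L) * w v
    initial v = ≤-trans (+-mono-≤ first second) (≤-reflexive (sym (*-distribʳ-+ (w v) (m * X L s) (m ^ L))))
      where
      first : m * ind (Tame? v) (w v * pot (λ _ → false) 0 v) ≤ m * X L s * w v
      first = ≤-trans (*-monoʳ-≤ m (ind-≤′ (Tame? v) (λ t → *-monoʳ-≤ (w v) (≤-trans (P-mono 0 (queue-≤ (λ _ → false) 0 t)) (≤-reflexive (P0 s))))))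
                (≤-reflexive (trans (cong (m *_) (*-comm (w v) (X L s))) (sym (*-assoc m (X L s) (w v)))))
        where
        P0 : ∀ f → P 0 f ≡ X L f
        P0 f rewrite n∸n≡0 L = +-identityʳ (X L f)
      second : t₂ (λ _ → false) 0 v ≤ m ^ L * w v
      second = +-mono-≤ (≤-reflexive (*-zeroʳ (m * m ^ L))) (*-monoʳ-≤ (m ^ L) (ind-≤ (0 ≤? b v)))

  Free : (ℕ → Bool) → ℕ → Fin n → Set
  Free μ zero    v = ⊤
  Free μ (suc k) v = ∃[ y ] (SR ℓ v y × μ (b y) ≡ false × Free μ k y)

  -- The levels of an unmarked chain ascend, so each is decided after its predecessors were left
  -- unmarked, and is exposed by then. In `go`, the argument `pre` stands for the part of the chain
  -- already passed.
  free-≤ : ∀ μ k {v} → k ≤ L → Free μ k v → k ≤ Rev μ β v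
  free-≤ μ k {v} k≤L fr = ≤-trans (go k 0 v k≤L (λ _ h → h) fr)
    (#-mono β (λ x → (b v <? x) ×-dec Expo? μ x L v x) (λ x → Expo? μ x L v x) (λ x _ → proj₂))
    where
    go : ∀ k i y → i + k ≤ L → (∀ {x j} → b y < x → Expo μ x j y x → Expo μ x (i + j) v x) → Free μ k y →
         k ≤ # β (λ x → (b y <? x) ×-dec Expo? μ x L v x)
    go zero i y _ _ _ = z≤n
    go (suc k) i y le pre (y′ , r@(_ , lt , _) , u , fr) = ≤-trans (s≤s (go k (suc i) y′ (≤-trans (≤-reflexive (sym (+-suc i k))) le) pre′ fr))
        (#-remove β (λ x → (b y <? x) ×-dec Expo? μ x L v x) (λ x → (b y′ <? x) ×-dec Expo? μ x L v x) (b y′) (b<β y′)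
          (lt , Expo-≤ (≤-trans (+-monoʳ-≤ i (s≤s z≤n)) le) (pre {j = 1} lt (y′ , r , inj₁ refl)))
          (λ (l , _) → <-irrefl refl l) (λ x _ (l , h) → <-trans lt l , h))
      where
      pre′ : ∀ {x j} → b y′ < x → Expo μ x j y′ x → Expo μ x (suc i + j) v x
      pre′ {x} {j} l h = subst (λ k → Expo μ x k v x) (+-suc i j) (pre (<-trans lt l) (y′ , r , inj₂ (l , u , h)))

free : (m : ℕ) → {P : ℕ → Set} → Decidable P → ℕ
free zero    P? = 0
free (suc m) P? = choose (P? m) (free m P?) m

free-ext : ∀ m {P Q : ℕ → Set} (P? : Decidable P) (Q? : Decidable Q) → (∀ c → P c → Q c) → (∀ c → Q c → P c) → free m P? ≡ free m Q?
free-ext zero    P? Q? f g = refl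
free-ext (suc m) P? Q? f g = lem (P? m) (Q? m) (f m) (g m) (free-ext m P? Q? f g)
  where
  lem : ∀ {A B : Set} (d : Dec A) (e : Dec B) {x y z : ℕ} → (A → B) → (B → A) → x ≡ y → choose d x z ≡ choose e y z
  lem (yes _) (yes _) _ _ e = e
  lem (no _)  (no _)  _ _ _ = refl
  lem (yes a) (no ¬b) f _ _ = ⊥-elim (¬b (f a))
  lem (no ¬a) (yes b) _ g _ = ⊥-elim (¬a (g b))

free-spec : ∀ m {P : ℕ → Set} (P? : Decidable P) → # m P? < m → free m P? < m × ¬ P (free m P?)
free-spec (suc m) {P} P? l with choose-cases (P? m) {free m P?} {m}
... | inj₂ (¬p , e) = subst (λ c → c < suc m × ¬ P c) (sym e) (≤-refl , ¬p)
... | inj₁ (p , e) with free-spec m P? (s≤s⁻¹ (≤-trans (s≤s (≤-reflexive (cong (_+ # m P?) (sym (ind-yes (P? m) {1} p))))) l))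
...   | l′ , ¬q = subst (λ c → c < suc m × ¬ P c) (sym e) (m<n⇒m<1+n l′ , ¬q)

#-⊎ : ∀ β {P Q R : ℕ → Set} (P? : Decidable P) (Q? : Decidable Q) (R? : Decidable R) →
      (∀ x → P x → Q x ⊎ R x) → # β P? ≤ # β Q? + # β R?
#-⊎ zero    P? Q? R? f = z≤n
#-⊎ (suc β) P? Q? R? f = ≤-trans (+-mono-≤ (ind-⊎ (P? β) (Q? β) (R? β) (f β)) (#-⊎ β P? Q? R? f))
                          (≤-reflexive (+-interchange (ind (Q? β) 1) (ind (R? β) 1) _ _))

#-single : ∀ m c → # m (c ≟_) ≤ 1
#-single zero    c = z≤n
#-single (suc m) c = lem (c ≟ m) (#-single m c) (λ { refl → #-none m (c ≟_) (λ { x l refl → <-irrefl refl l }) })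
  where
  lem : ∀ {A : Set} (d : Dec A) {x} → x ≤ 1 → (A → x ≡ 0) → ind d 1 + x ≤ 1
  lem (yes a) _ f = ≤-reflexive (cong suc (f a))
  lem (no _) le _ = le

#-image : ∀ m β {A : ℕ → Set} (A? : Decidable A) (g : ℕ → ℕ) {T : ℕ → Set} (T? : Decidable T) →
          (∀ c → T c → ∃[ x ] (x < β × A x × g x ≡ c)) → # m T? ≤ # β A?
#-image m zero A? g T? h = ≤-reflexive (#-none m T? (λ c _ t → case proj₁ (proj₂ (h c t)) of λ ()))
#-image m (suc β) {A} A? g {T} T? h with A? β
... | no ¬a = #-image m β A? g T? (λ c t → let (x , l , a , e) = h c t in
                x , ≤∧≢⇒< (s≤s⁻¹ l) (λ x≡β → ¬a (subst A x≡β a)) , a , e)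
... | yes _ = ≤-trans (#-⊎ m T? (g β ≟_) (λ c → T? c ×-dec ¬? (g β ≟ c)) split)
                (+-mono-≤ (#-single m (g β)) (#-image m β A? g (λ c → T? c ×-dec ¬? (g β ≟ c)) rest))
  where
  split : ∀ c → T c → (g β ≡ c) ⊎ (T c × ¬ g β ≡ c)
  split c t = [ inj₁ , (λ ne → inj₂ (t , ne)) ]′ (toSum (g β ≟ c))
  rest : ∀ c → T c × ¬ g β ≡ c → ∃[ x ] (x < β × A x × g x ≡ c)
  rest c (t , ne) = let (x , l , a , e) = h c t in x , ≤∧≢⇒< (s≤s⁻¹ l) (λ x≡β → ne (trans (cong g (sym x≡β)) e)) , a , e

-- Colouring and clustering

module TrieColour (β s : ℕ) (μ : ℕ → Bool) where
  mutual
    -- Greedy colour of the root of the tree of sequences cut at depth `k`. At the cut the colour is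
    -- an arbitrary `0`; `col-stable` tells when this does no harm.
    col : ℕ → {P : List ℕ → Set} → Decidable P → ℕ
    col zero    P? = 0
    col (suc k) P? = free (suc s) (taken? k P?)

    Taken : ℕ → {P : List ℕ → Set} → Decidable P → ℕ → Set
    Taken k {P} P? c = ∃[ x ] (x < β × (P (x ∷ []) × μ x ≡ false) × col k (λ q → P? (x ∷ q)) ≡ c)

    taken? : ∀ k {P : List ℕ → Set} (P? : Decidable P) → Decidable (Taken k P?)
    taken? k P? c = anyUpTo? (λ x → (P? (x ∷ []) ×-dec (μ x ≟B false)) ×-dec (col k (λ q → P? (x ∷ q)) ≟ c)) β

  col-ext : ∀ k {P Q : List ℕ → Set} (P? : Decidable P) (Q? : Decidable Q) →
            (∀ q → length q ≤ k → P q → Q q) → (∀ q → length q ≤ k → Q q → P q) → col k P? ≡ col k Q?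
  col-ext zero    P? Q? f g = refl
  col-ext (suc k) P? Q? f g = free-ext (suc s) (taken? k P?) (taken? k Q?) (half P? Q? f g) (half Q? P? g f)
    where
    half : ∀ {P Q : List ℕ → Set} (P? : Decidable P) (Q? : Decidable Q) →
           (∀ q → length q ≤ suc k → P q → Q q) → (∀ q → length q ≤ suc k → Q q → P q) → ∀ c → Taken k P? c → Taken k Q? c
    half P? Q? f g c (x , l , (p , u) , e) = x , l , (f (x ∷ []) (s≤s z≤n) p , u) ,
      trans (col-ext k (λ q → Q? (x ∷ q)) (λ q → P? (x ∷ q)) (λ q l → g (x ∷ q) (s≤s l)) (λ q l → f (x ∷ q) (s≤s l))) e

  NoChain : ℕ → (List ℕ → Set) → Set
  -- The empty chain is always present.
  NoChain zero    P = ⊥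
  NoChain (suc k) P = ∀ x → P (x ∷ []) → μ x ≡ false → NoChain k (λ q → P (x ∷ q))

  no-chain : ∀ k {P : List ℕ → Set} → P [] → (∀ q → length q ≡ k → All.All (λ x → μ x ≡ false) q → ¬ P q) → NoChain k P
  no-chain zero    p h = h [] refl All.[] p
  no-chain (suc k) p h x px u = no-chain k px (λ q l a → h (x ∷ q) (cong suc l) (u All.∷ a))

  -- The cut at depth `k` can influence the colour of the root only along a chain of `k` unmarked
  -- levels.
  col-stable : ∀ k {P : List ℕ → Set} (P? : Decidable P) → NoChain k P → col (suc k) P? ≡ col k P?
  col-stable (suc k) P? nc = free-ext (suc s) (taken? (suc k) P?) (taken? k P?)
    (λ c (x , l , (p , u) , e) → x , l , (p , u) , trans (sym (col-stable k (λ q → P? (x ∷ q)) (nc x p u))) e)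
    (λ c (x , l , (p , u) , e) → x , l , (p , u) , trans (col-stable k (λ q → P? (x ∷ q)) (nc x p u)) e)

  col-spec : ∀ k {P : List ℕ → Set} (P? : Decidable P) → # β (λ x → P? (x ∷ [])) ≤ s →
             col (suc k) P? < suc s × ¬ Taken k P? (col (suc k) P?)
  col-spec k P? le = free-spec (suc s) (taken? k P?) (s≤s (≤-trans
    (#-image (suc s) β (λ x → P? (x ∷ []) ×-dec (μ x ≟B false)) (λ x → col k (λ q → P? (x ∷ q))) (taken? k P?) (λ c t → t))
    (≤-trans (#-mono β (λ x → P? (x ∷ []) ×-dec (μ x ≟B false)) (λ x → P? (x ∷ [])) (λ x _ → proj₁)) le)))

module Colour {n : ℕ} {E : Fin n → Fin n → Set} {E? : ∀ u v → Dec (E u v)}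
             {E-sym : ∀ {u v} → E u v → E v u} (S : Setting E E? E-sym) (s ρZ m₁ L I i : ℕ) (i<I : i < I)
             (2ρZ≤ρ : ρZ + ρZ ≤ Setting.ρ S) (fits : suc (L + L) * radius I ≤ ρZ)
             (fits′ : suc (L + L) * radius i ≤ ρZ) (μ : ℕ → Bool) where
  open Walks E E? E-sym
  open Setting S
  open Structure S
  open Tries S s ρZ L I 2ρZ≤ρ fits
  open Scale i
  open Marks S s ρZ m₁ L (radius i) 2ρZ≤ρ fits′ using (Free; Deep; Rev; free-≤)
  open TrieColour β s μ

  Kept : Fin n → Set
  Kept v = Tame v × ¬ Unstable i v × ¬ Deep μ v × μ (b v) ≡ false

  colour : Fin n → ℕ
  colour v = col (suc L) (Seq? ℓ v)

  few : ∀ {v} → Tame v → # β (λ x → Seq? ℓ v (x ∷ [])) ≤ s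
  few t = few-children (radius-mono (<⇒≤ i<I)) t [] z≤n tt

  colour-< : ∀ {v} → Kept v → colour v < suc s
  colour-< {v} (t , _) = proj₁ (col-spec L (Seq? ℓ v) (few t))

  seq-free : ∀ {v} q → All.All (λ x → μ x ≡ false) q → Seq ℓ v q → Free μ (length q) v
  seq-free [] _ _ = tt
  seq-free (x ∷ q) (u All.∷ a) (y , r , refl , m) = y , r , u , seq-free q a m

  kept-no-chain : ∀ {v} → Kept v → NoChain L (Seq ℓ v)
  kept-no-chain {v} (t , _ , nd , _) = no-chain L tt (λ q l a m → nd (t , free-≤ μ L ≤-refl (subst (λ k → Free μ k v) l (seq-free q a m))))

  -- By `seq-up` and `seq-down`, what `v` sees beyond the level of `u` is the tree of `u`. Its
  -- colour is taken for `v`, and by `col-stable` the loss of one level of depth does not alter it.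
  proper : ∀ {v u} → Kept v → Kept u → E v u → b v < b u → ¬ colour v ≡ colour u
  proper {v} {u} (tv , _) ku@(tu , su , _ , mu) e lt same =
    proj₂ (col-spec L (Seq? ℓ v) (few tv))
      (b u , b<β u , (seq-up (proj₁ tv) (proj₁ tu) e lt [] tt , mu) ,
        trans (trans (col-ext L (λ q → Seq? ℓ v (b u ∷ q)) (Seq? ℓ u)
                       (λ q l → seq-down (proj₁ tv) (proj₁ tu) e lt (λ c → su (tu , c)) q (m≤n⇒m≤1+n l))
                       (λ q l → seq-up (proj₁ tv) (proj₁ tu) e lt q))
                     (sym (col-stable L (Seq? ℓ u) (kept-no-chain ku))))
              (sym same))

members : ∀ {n} {P : Fin n → Set} → Decidable P → List (Fin n)
members {zero}  P? = []
members {suc n} P? = (if does (P? zero) then zero ∷ [] else []) ++ map suc (members (P? ∘ suc))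

members-complete : ∀ {n} {P : Fin n → Set} (P? : Decidable P) {v} → P v → v ∈ members P?
members-complete {suc n} P? {zero} p = ∈-++⁺ˡ (subst (zero ∈_) (sym (if-yes (P? zero) p)) (here refl))
members-complete {suc n} P? {suc v} p = ∈-++⁺ʳ (if does (P? zero) then zero ∷ [] else []) (∈-map⁺ suc (members-complete (P? ∘ suc) p))

length-members : ∀ {n} {P : Fin n → Set} (P? : Decidable P) → length (members P?) ≡ wt (λ _ → 1) P?
length-members {zero} P? = refl
length-members {suc n} P? = trans (length-++ (if does (P? zero) then zero ∷ [] else []))
    (cong₂ _+_ (lem (P? zero)) (trans (length-map suc (members (P? ∘ suc))) (length-members (P? ∘ suc))))
  where
  lem : ∀ {A : Set} (d : Dec A) → length (if does d then zero {n} ∷ [] else []) ≡ ind d 1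
  lem (yes _) = refl
  lem (no _)  = refl

wt-disjoint : ∀ {n} (w : Fin n → ℕ) {P Q R : Fin n → Set} (P? : Decidable P) (Q? : Decidable Q) (R? : Decidable R) →
  (∀ v → P v → R v) → (∀ v → Q v → R v) → (∀ v → P v → Q v → ⊥) → wt w P? + wt w Q? ≤ wt w R?
wt-disjoint w P? Q? R? f g h = ≤-trans (≤-reflexive (sym (∑-+ (λ v → ind (P? v) (w v)) (λ v → ind (Q? v) (w v)))))
  (∑-mono (λ v → lem (P? v) (Q? v) (R? v) (f v) (g v) (h v)))
  where
  lem : ∀ {A B C : Set} (a : Dec A) (b : Dec B) (c : Dec C) {x} → (A → C) → (B → C) → (A → B → ⊥) → ind a x + ind b x ≤ ind c x
  lem (yes a) (yes b) c f g h = ⊥-elim (h a b)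
  lem (yes a) (no _)  c f g h = ≤-reflexive (trans (+-identityʳ _) (sym (ind-yes c (f a))))
  lem (no _)  (yes b) c f g h = ≤-reflexive (sym (ind-yes c (g b)))
  lem (no _)  (no _)  c f g h = z≤n

-- Region growing inside a colour class

module Carve {n : ℕ} {E : Fin n → Fin n → Set} {E? : ∀ u v → Dec (E u v)}
             {E-sym : ∀ {u v} → E u v → E v u} (S : Setting E E? E-sym) (Λ Q : ℕ)
             (flat : ∀ {u v} → Setting.alive S u → Setting.alive S v → Setting.b S u ≡ Setting.b S v → Setting.w S u ≤ Λ * Setting.w S v)
             (growth : Setting.M S * Q ^ Setting.ρ S < suc Q ^ Setting.ρ S)
             (Y : Fin n → Set) (Y-alive : ∀ {v} → Y v → Setting.alive S v)
             (Y-level : ∀ {u v} → Y u → Y v → E u v → Setting.b S u ≡ Setting.b S v) where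
  open Walks E E? E-sym
  open Setting S
  open Structure S

  Clustered : (Fin n → Set) → Set
  Clustered P = ∀ v → P v → ∃[ xs ] (length xs ≤ Λ * M × (∀ ℓ x → Walk P ℓ v x → P x → x ∈ xs))

  -- Region growing: the ball around a vertex of least rank has a light boundary at some radius below ρ,
  -- as it would otherwise outgrow the weight weakly reaching its centre.
  carve : ∀ fuel {R : Fin n → Set} (R? : Decidable R) → (∀ {v} → R v → Y v) → wt (λ _ → 1) R? ≤ fuel →
          Σ (Fin n → Set) λ P → Σ (Decidable P) λ P? → (∀ {v} → P v → R v) × Clustered P × Q * wt w R? ≤ suc Q * wt w P?
  carve fuel {R} R? R⊆Y le with least (suc (∑ π)) (λ t → FinP.any? (λ x → R? x ×-dec (π x ≟ t)))
  carve fuel {R} R? R⊆Y le | inj₂ none = (λ _ → ⊥) , (λ _ → no id) , (λ ()) , (λ v ()) ,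
      ≤-trans (≤-reflexive (trans (cong (Q *_) (∑-0 (λ v → ind-no (R? v) (λ r → none (π v) (s≤s (∑-≥ π v)) (v , r , refl))))) (*-zeroʳ Q))) z≤n
  carve zero {R} R? R⊆Y le | inj₁ (t , _ , (u , ru , _) , _) =
      ⊥-elim (<⇒≱ (≤-trans (≤-reflexive (sym (ind-yes (R? u) {1} ru))) (∑-≥ (λ v → ind (R? v) 1) u)) le)
  carve (suc fuel) {R} R? R⊆Y le | inj₁ (t , _ , (u , ru , refl) , tmin) = result (FinP.any? {n = ρ} (λ j → Q * wt w (Ball? (suc (toℕ j))) ≤? suc Q * wt w (Ball? (toℕ j))))
    where
    open ≤-Reasoning
    Ball : ℕ → Fin n → Set
    Ball j x = R x × Walk R j u x
    Ball? : ∀ j → Decidable (Ball j)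
    Ball? j x = R? x ×-dec walk? R? j u x

    ball-heavy : ∀ {j} → j ≤ ρ → wt w (Ball? j) ≤ M * w u
    ball-heavy {j} j≤ρ = ≤-trans (∑-mono (λ x → ind-mono (Ball? j x) (Wk? x u)
        (λ (rx , k) → walk-≤ j≤ρ (walk-map (λ ry → tmin _ (_ , ry , refl)) (walk-rev k rx))) (λ _ → ≤-refl)))
      (heavy (Y-alive (R⊆Y ru)))

    ball-level : ∀ {j x} → Ball j x → b x ≡ b u
    ball-level (rx , k) = go rx k
      where
      go : ∀ {j v x} → R x → Walk R j v x → b x ≡ b v
      go rx here = refl
      go rx (step rv e k) = trans (go rx k) (sym (Y-level (R⊆Y rv) (R⊆Y (walk-head k rx)) e))

    -- The ball stays in one level, so by `flat` each of its vertices weighs at least `w u / Λ`,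
    -- while the whole ball weighs at most `M * w u`.
    ball-size : ∀ {j} → j ≤ ρ → length (members (Ball? j)) ≤ Λ * M
    ball-size {j} j≤ρ = *-cancelʳ-≤ _ _ (w u) {{>-nonZero (pos (Y-alive (R⊆Y ru)))}} (begin
      length (members (Ball? j)) * w u ≡⟨ trans (cong (_* w u) (length-members (Ball? j))) (*-comm _ (w u)) ⟩
      w u * wt (λ _ → 1) (Ball? j) ≡⟨ sym (∑-*ˡ (w u) (λ x → ind (Ball? j x) 1)) ⟩
      ∑ (λ x → w u * ind (Ball? j x) 1) ≡⟨ ∑-cong (λ x → trans (ind-* (Ball? j x) (w u) 1) (cong (ind (Ball? j x)) (*-identityʳ (w u)))) ⟩
      ∑ (λ x → ind (Ball? j x) (w u)) ≤⟨ ∑-mono (λ x → ind-mono (Ball? j x) (Ball? j x) id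
          (λ bx → flat (Y-alive (R⊆Y ru)) (Y-alive (R⊆Y (proj₁ bx))) (sym (ball-level bx)))) ⟩
      ∑ (λ x → ind (Ball? j x) (Λ * w x)) ≡⟨ ∑-cong (λ x → sym (ind-* (Ball? j x) Λ (w x))) ⟩
      ∑ (λ x → Λ * ind (Ball? j x) (w x)) ≡⟨ ∑-*ˡ Λ (λ x → ind (Ball? j x) (w x)) ⟩
      Λ * wt w (Ball? j) ≤⟨ *-monoʳ-≤ Λ (ball-heavy j≤ρ) ⟩
      Λ * (M * w u) ≡⟨ sym (*-assoc Λ M (w u)) ⟩
      Λ * M * w u ∎)

    result : Dec (Σ (Fin ρ) λ j → Q * wt w (Ball? (suc (toℕ j))) ≤ suc Q * wt w (Ball? (toℕ j))) →
             Σ (Fin n → Set) λ P → Σ (Decidable P) λ P? → (∀ {v} → P v → R v) × Clustered P × Q * wt w R? ≤ suc Q * wt w P?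
    result (no none) = ⊥-elim (<-irrefl refl (begin-strict
        M * Q ^ ρ * w u <⟨ *-monoˡ-< (w u) {{>-nonZero (pos (Y-alive (R⊆Y ru)))}} growth ⟩
        suc Q ^ ρ * w u ≤⟨ *-monoʳ-≤ (suc Q ^ ρ) (≤-trans (≤-reflexive (sym (ind-yes (Ball? 0 u) (ru , here)))) (∑-≥ (λ x → ind (Ball? 0 x) (w x)) u)) ⟩
        suc Q ^ ρ * wt w (Ball? 0) ≤⟨ grow ρ ≤-refl ⟩
        Q ^ ρ * wt w (Ball? ρ) ≤⟨ *-monoʳ-≤ (Q ^ ρ) (ball-heavy ≤-refl) ⟩
        Q ^ ρ * (M * w u) ≡⟨ trans (*-swap (Q ^ ρ) M (w u)) (sym (*-assoc M (Q ^ ρ) (w u))) ⟩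
        M * Q ^ ρ * w u ∎))
      where
      grow : ∀ j → j ≤ ρ → suc Q ^ j * wt w (Ball? 0) ≤ Q ^ j * wt w (Ball? j)
      grow zero _ = ≤-refl
      grow (suc j) l = begin
        suc Q * suc Q ^ j * wt w (Ball? 0)   ≡⟨ *-assoc (suc Q) (suc Q ^ j) _ ⟩
        suc Q * (suc Q ^ j * wt w (Ball? 0)) ≤⟨ *-monoʳ-≤ (suc Q) (grow j (<⇒≤ l)) ⟩
        suc Q * (Q ^ j * wt w (Ball? j))     ≡⟨ *-swap (suc Q) (Q ^ j) _ ⟩
        Q ^ j * (suc Q * wt w (Ball? j))     ≤⟨ *-monoʳ-≤ (Q ^ j) (<⇒≤ (≰⇒> (λ le′ → none (fromℕ< l , subst (λ i → Q * wt w (Ball? (suc i)) ≤ suc Q * wt w (Ball? i)) (sym (FinP.toℕ-fromℕ< l)) le′)))) ⟩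
        Q ^ j * (Q * wt w (Ball? (suc j)))   ≡⟨ trans (*-swap (Q ^ j) Q _) (sym (*-assoc Q (Q ^ j) _)) ⟩
        Q * Q ^ j * wt w (Ball? (suc j)) ∎
    result (yes (j′ , small)) = combine (carve fuel R′? (λ (r , _) → R⊆Y r) smaller)
      where
      j = toℕ j′
      R′ : Fin n → Set
      R′ x = R x × ¬ Ball (suc j) x
      R′? : Decidable R′
      R′? x = R? x ×-dec ¬? (Ball? (suc j) x)
      smaller : wt (λ _ → 1) R′? ≤ fuel
      smaller = s≤s⁻¹ (≤-trans (≤-trans
        (+-monoˡ-≤ _ (≤-trans (≤-reflexive (sym (ind-yes (Ball? (suc j) u) (ru , here)))) (∑-≥ (λ x → ind (Ball? (suc j) x) 1) u)))
        (wt-disjoint (λ _ → 1) (Ball? (suc j)) R′? R? (λ _ → proj₁) (λ _ → proj₁) (λ x bx (_ , nb) → nb bx))) le)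
      combine : (Σ (Fin n → Set) λ P → Σ (Decidable P) λ P? → (∀ {v} → P v → R′ v) × Clustered P × Q * wt w R′? ≤ suc Q * wt w P?) →
                Σ (Fin n → Set) λ P → Σ (Decidable P) λ P? → (∀ {v} → P v → R v) × Clustered P × Q * wt w R? ≤ suc Q * wt w P?
      -- The shell between the radii `j` and `suc j` is given up; it separates the ball from all
      -- later clusters.
      combine (P , P? , P⊆ , cl , le′) = P⁺ , P⁺? , [ proj₁ , (proj₁ ∘ P⊆) ]′ , cl⁺ , (begin
          Q * wt w R? ≤⟨ *-monoʳ-≤ Q (wt-⊎ w R? (Ball? (suc j)) R′? (λ x rx → [ inj₁ , (λ nb → inj₂ (rx , nb)) ]′ (toSum (Ball? (suc j) x)))) ⟩
          Q * (wt w (Ball? (suc j)) + wt w R′?) ≡⟨ *-distribˡ-+ Q _ _ ⟩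
          Q * wt w (Ball? (suc j)) + Q * wt w R′? ≤⟨ +-mono-≤ small le′ ⟩
          suc Q * wt w (Ball? j) + suc Q * wt w P? ≡⟨ sym (*-distribˡ-+ (suc Q) (wt w (Ball? j)) (wt w P?)) ⟩
          suc Q * (wt w (Ball? j) + wt w P?) ≤⟨ *-monoʳ-≤ (suc Q) (wt-disjoint w (Ball? j) P? P⁺? (λ _ → inj₁) (λ _ → inj₂) (λ x bx px → apart bx px)) ⟩
          suc Q * wt w P⁺? ∎)
        where
        P⁺ : Fin n → Set
        P⁺ x = Ball j x ⊎ P x
        P⁺? : Decidable P⁺
        P⁺? x = Ball? j x ⊎-dec P? x
        apart : ∀ {x} → Ball j x → P x → ⊥
        apart (r , k) px = proj₂ (P⊆ px) (r , walk-≤ (n≤1+n j) k)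
        separate : ∀ {x y} → Ball j x → P y → E x y → ⊥
        separate (r , k) py e = proj₂ (P⊆ py) (proj₁ (P⊆ py) , walk-∷ʳ k r e)
        stay-ball : ∀ {ℓ v x} → Ball j v → Walk P⁺ ℓ v x → P⁺ x → Ball j x
        stay-ball bv here _ = bv
        stay-ball bv (step _ e k) px with walk-head k px
        ... | inj₁ bw = stay-ball bw k px
        ... | inj₂ pw = ⊥-elim (separate bv pw e)
        stay-rest : ∀ {ℓ v x} → P v → Walk P⁺ ℓ v x → P⁺ x → Walk P ℓ v x × P x
        stay-rest pv here (inj₂ p) = here , p
        stay-rest pv here (inj₁ bv) = ⊥-elim (apart bv pv)
        stay-rest pv (step _ e k) px with walk-head k px
        ... | inj₁ bw = ⊥-elim (separate bw pv (E-sym e))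
        ... | inj₂ pw = let (k′ , p) = stay-rest pw k px in step pv e k′ , p
        cl⁺ : Clustered P⁺
        cl⁺ v (inj₁ bv) = members (Ball? j) , ball-size (<⇒≤ (FinP.toℕ<n j′)) , λ ℓ x k px → members-complete (Ball? j) (stay-ball bv k px)
        cl⁺ v (inj₂ pv) = let (xs , len , h) = cl v pv in xs , len , λ ℓ x k px → let (k′ , p) = stay-rest pv k px in h ℓ x k′ p

-- Constants

-- Bernoulli's inequality for `(1 + 1 / q) ^ j`, cleared of denominators.
bernoulli : ∀ q j → (q + j) * q ^ j ≤ q * suc q ^ j
bernoulli q zero    = *-monoˡ-≤ 1 (≤-reflexive (+-identityʳ q))
bernoulli q (suc j) = begin
  (q + suc j) * (q * q ^ j)           ≤⟨ m≤m+n _ (j * q ^ j) ⟩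
  (q + suc j) * (q * q ^ j) + j * q ^ j ≡⟨ arith q j (q ^ j) ⟩
  suc q * ((q + j) * q ^ j)           ≤⟨ *-monoʳ-≤ (suc q) (bernoulli q j) ⟩
  suc q * (q * suc q ^ j)             ≡⟨ *-swap (suc q) q _ ⟩
  q * (suc q * suc q ^ j)             ∎
  where
  open ≤-Reasoning
  arith : ∀ q j x → (q + (1 + j)) * (q * x) + j * x ≡ (1 + q) * ((q + j) * x)
  arith = solve-∀

enough : ∀ m d → ∃[ j ] d ^ j * m ≤ suc d ^ j
enough m zero = 1 , z≤n
enough m d@(suc _) = d * m , *-cancelˡ-≤ d (begin
  d * (d ^ j * m)     ≡⟨ arith d (d ^ j) m ⟩
  (d * m) * d ^ j     ≤⟨ *-monoˡ-≤ (d ^ j) (m≤n+m (d * m) d) ⟩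
  (d + d * m) * d ^ j ≤⟨ bernoulli d j ⟩
  d * suc d ^ j ∎)
  where
  open ≤-Reasoning
  j = d * m
  arith : ∀ d x m → d * (x * m) ≡ (d * m) * x
  arith = solve-∀

n<2^n : ∀ n → n < 2 ^ n
n<2^n zero    = s≤s z≤n
n<2^n (suc n) = ≤-trans (s≤s (n<2^n n)) (≤-trans (+-monoˡ-≤ (2 ^ n) (m^n>0 2 n)) (≤-reflexive (cong (2 ^ n +_) (sym (+-identityʳ (2 ^ n))))))

doubling : ∀ q → 1 ≤ q → 2 * q ^ q ≤ suc q ^ q
doubling q 1≤q = *-cancelˡ-≤ q {{>-nonZero 1≤q}} (≤-trans (≤-reflexive (arith q (q ^ q))) (bernoulli q q))
  where
  arith : ∀ q x → q * (2 * x) ≡ (q + q) * x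
  arith = solve-∀

^-distribʳ-* : ∀ a b k → (a * b) ^ k ≡ a ^ k * b ^ k
^-distribʳ-* a b zero    = refl
^-distribʳ-* a b (suc k) = trans (cong (a * b *_) (^-distribʳ-* a b k)) (arith a b (a ^ k) (b ^ k))
  where
  arith : ∀ a b x y → a * b * (x * y) ≡ a * x * (b * y)
  arith = solve-∀

-- With `x` a power of two only exponents need comparing: `B + 2 * z * d` is at most the square of
-- `suc z`, and hence at most `x`.
2^-dominates : ∀ B d x₀ → ∃[ x ] (x₀ ≤ x × 1 ≤ x × B * x ^ d < 2 ^ x)
2^-dominates B d x₀ = x , ≤-trans (≤-trans (m≤n+m x₀ (B + 2 * d)) (m≤m+n z (z + 0))) (<⇒≤ (n<2^n (2 * z))) , m^n>0 2 (2 * z) , (begin-strict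
    B * x ^ d             <⟨ *-monoˡ-< (x ^ d) {{m^n≢0 x d {{m^n≢0 2 (2 * z)}}}} (n<2^n B) ⟩
    2 ^ B * x ^ d         ≡⟨ cong (2 ^ B *_) (^-*-assoc 2 (2 * z) d) ⟩
    2 ^ B * 2 ^ (2 * z * d) ≡⟨ sym (^-distribˡ-+-* 2 B (2 * z * d)) ⟩
    2 ^ (B + 2 * z * d)   ≤⟨ ^-monoʳ-≤ 2 exponent ⟩
    2 ^ x ∎)
  where
  open ≤-Reasoning
  z = B + 2 * d + x₀
  x = 2 ^ (2 * z)
  exponent : B + 2 * z * d ≤ x
  exponent = begin
    B + 2 * z * d          ≤⟨ m≤m+n _ (1 + 2 * d + x₀ + z + z * (B + x₀)) ⟩
    B + 2 * z * d + (1 + 2 * d + x₀ + z + z * (B + x₀)) ≡⟨ arith B d x₀ ⟩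
    suc z * suc z          ≤⟨ *-mono-≤ (n<2^n z) (n<2^n z) ⟩
    2 ^ z * 2 ^ z          ≡⟨ sym (^-distribˡ-+-* 2 z z) ⟩
    2 ^ (z + z)            ≡⟨ cong (λ t → 2 ^ (z + t)) (sym (+-identityʳ z)) ⟩
    x ∎
    where
    arith : ∀ B d x₀ → B + 2 * (B + 2 * d + x₀) * d + (1 + 2 * d + x₀ + (B + 2 * d + x₀) + (B + 2 * d + x₀) * (B + x₀)) ≡ (1 + (B + 2 * d + x₀)) * (1 + (B + 2 * d + x₀))
    arith = solve-∀

reachable-≤ : ℕ → ℕ → ℕ
reachable-≤ r ρ = suc ρ ^ r * suc (r * suc (ρ + ρ))

-- For `ρ = Q * x`, `doubling` gains a factor `2 ^ x`, which exceeds any polynomial in `x`.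
long-radius : ∀ Q r ρ₀ → 1 ≤ Q → ∃[ ρ ] (ρ₀ ≤ ρ × Q * reachable-≤ r ρ * Q ^ ρ < suc Q ^ ρ)
long-radius Q r ρ₀ 1≤Q with 2^-dominates (Q * (2 * suc r) * suc Q ^ suc r) (suc r) ρ₀
... | x , x₀≤x , 1≤x , dom = Q * x , ≤-trans x₀≤x (m≤n*m x Q {{>-nonZero 1≤Q}}) , (begin-strict
    Q * reachable-≤ r (Q * x) * Q ^ (Q * x)     <⟨ *-monoˡ-< (Q ^ (Q * x)) {{m^n≢0 Q (Q * x) {{>-nonZero 1≤Q}}}} small ⟩
    2 ^ x * Q ^ (Q * x)                         ≡⟨ cong (2 ^ x *_) (sym (^-*-assoc Q Q x)) ⟩
    2 ^ x * (Q ^ Q) ^ x                         ≡⟨ sym (^-distribʳ-* 2 (Q ^ Q) x) ⟩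
    (2 * Q ^ Q) ^ x                             ≤⟨ ^-monoˡ-≤ x (doubling Q 1≤Q) ⟩
    (suc Q ^ Q) ^ x                             ≡⟨ ^-*-assoc (suc Q) Q x ⟩
    suc Q ^ (Q * x) ∎)
  where
  open ≤-Reasoning
  y = suc (Q * x)
  y≤ : y ≤ suc Q * x
  y≤ = +-monoˡ-≤ (Q * x) 1≤x
  small : Q * reachable-≤ r (Q * x) < 2 ^ x
  small = begin-strict
    Q * (y ^ r * suc (r * suc (Q * x + Q * x))) ≤⟨ *-monoʳ-≤ Q (*-monoʳ-≤ (y ^ r) (≤-trans (m≤m+n _ (r + Q * x + Q * x + 1)) (≤-reflexive (arith r (Q * x))))) ⟩
    Q * (y ^ r * (2 * suc r * y))               ≡⟨ arith₂ Q (y ^ r) (2 * suc r) y ⟩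
    Q * (2 * suc r) * y ^ suc r                 ≤⟨ *-monoʳ-≤ (Q * (2 * suc r)) (^-monoˡ-≤ (suc r) y≤) ⟩
    Q * (2 * suc r) * (suc Q * x) ^ suc r       ≡⟨ cong (Q * (2 * suc r) *_) (^-distribʳ-* (suc Q) x (suc r)) ⟩
    Q * (2 * suc r) * (suc Q ^ suc r * x ^ suc r) ≡⟨ sym (*-assoc (Q * (2 * suc r)) (suc Q ^ suc r) (x ^ suc r)) ⟩
    Q * (2 * suc r) * suc Q ^ suc r * x ^ suc r <⟨ dom ⟩
    2 ^ x ∎
    where
    arith : ∀ r z → (1 + r * (1 + (z + z))) + (r + z + z + 1) ≡ 2 * (1 + r) * (1 + z)
    arith = solve-∀
    arith₂ : ∀ q p c y → q * (p * (c * y)) ≡ q * c * (y * p)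
    arith₂ = solve-∀

module QueueBound (s m₁ : ℕ) where
  open Queue s m₁

  X-decay : ∀ k f → X (suc k) f ≤ m * X k f
  X-decay k zero = z≤n
  X-decay zero (suc f) = ≤-reflexive (cong suc (trans (*-identityʳ m₁) (sym (*-identityʳ m₁))))
  X-decay (suc k) (suc f) = ≤-trans (+-mono-≤ (X-decay k f) (*-monoʳ-≤ m₁ (X-decay k s)))
    (≤-reflexive (trans (cong (m * X k f +_) (*-swap m₁ m (X k s))) (sym (*-distribˡ-+ m (X k f) (m₁ * X k s)))))

  X-decay-^ : ∀ j k f → X (j + k) f ≤ m ^ j * X k f
  X-decay-^ zero    k f = ≤-reflexive (sym (+-identityʳ _))
  X-decay-^ (suc j) k f = ≤-trans (X-decay (j + k) f) (≤-trans (*-monoʳ-≤ m (X-decay-^ j k f)) (≤-reflexive (sym (*-assoc m (m ^ j) (X k f)))))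

  -- f marked levels in a row empty a queue of length f.
  X-drain : ∀ k f → X (f + suc k) f + X (suc k) s ≤ m ^ f * X (suc k) s
  X-drain k zero    = ≤-reflexive (sym (+-identityʳ _))
  X-drain k (suc f) = begin
    X (f + suc k) f + m₁ * X (f + suc k) s + y   ≡⟨ arith (X (f + suc k) f) (m₁ * X (f + suc k) s) y ⟩
    (X (f + suc k) f + y) + m₁ * X (f + suc k) s ≤⟨ +-mono-≤ (X-drain k f) (*-monoʳ-≤ m₁ (X-decay-^ f (suc k) s)) ⟩
    m ^ f * y + m₁ * (m ^ f * y)                 ≡⟨ sym (*-assoc m (m ^ f) y) ⟩
    m * m ^ f * y ∎
    where
    open ≤-Reasoning
    y = X (suc k) s
    arith : ∀ a b c → a + b + c ≡ (a + c) + b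
    arith = solve-∀

  rounds : ∀ j d → m ^ s ≡ suc d → X (j * s + 1) s ≤ d ^ j * m
  rounds zero d e = ≤-trans (X-decay 0 s) (≤-reflexive (trans (*-identityʳ m) (sym (+-identityʳ m))))
  rounds (suc j) d e = begin
    X (s + j * s + 1) s ≡⟨ cong (λ t → X t s) (trans (+-assoc s (j * s) 1) (cong (s +_) (+-comm (j * s) 1))) ⟩
    X (s + suc (j * s)) s ≤⟨ +-cancelʳ-≤ y _ _ (≤-trans (X-drain (j * s) s) (≤-reflexive (trans (cong (_* y) e) (+-comm y (d * y))))) ⟩
    d * y ≡⟨ cong (λ t → d * X t s) (+-comm 1 (j * s)) ⟩
    d * X (j * s + 1) s ≤⟨ *-monoʳ-≤ d (rounds j d e) ⟩
    d * (d ^ j * m) ≡⟨ sym (*-assoc d (d ^ j) m) ⟩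
    d * d ^ j * m ∎
    where
    open ≤-Reasoning
    y = X (suc (j * s)) s

  -- In every `s` steps a share `1 / m ^ s` of the surviving outcomes consists of marks only and
  -- drops out; `enough` counts how often this must be repeated.
  emptied : ∃[ L ] m * X L s ≤ m ^ L
  emptied with m ^ s in e
  ... | zero = ⊥-elim (<⇒≱ (m^n>0 m s) (≤-reflexive e))
  ... | suc d with enough m d
  ...   | j , le = j * s + 1 , (begin
      m * X (j * s + 1) s ≤⟨ *-monoʳ-≤ m (≤-trans (rounds j d e) le) ⟩
      m * suc d ^ j       ≡⟨ cong (λ t → m * t ^ j) (sym e) ⟩
      m * (m ^ s) ^ j     ≡⟨ cong (m *_) (trans (^-*-assoc m s j) (cong (m ^_) (*-comm s j))) ⟩
      m ^ suc (j * s)     ≡⟨ cong (m ^_) (+-comm 1 (j * s)) ⟩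
      m ^ (j * s + 1) ∎)
    where open ≤-Reasoning

∑-unique : ∀ {n} {P : Fin n → Set} (P? : Decidable P) x → (∀ i j → P i → P j → i ≡ j) → ∑ (λ i → ind (P? i) x) ≤ x
∑-unique {n} P? x uniq with FinP.any? P?
... | no none = ≤-trans (≤-reflexive (∑-0 (λ i → ind-no (P? i) (λ p → none (i , p))))) z≤n
... | yes (j , p) = ≤-trans (∑-mono (λ i → ind-mono (P? i) (i FinP.≟ j) (λ q → uniq i j q p) (λ _ → ≤-refl))) (∑-ind-≡ (λ _ → x) j)

floor-log : ∀ Γ → 2 ≤ Γ → ∀ x → ∃[ a ] (0 < x → Γ ^ a ≤ x × x < Γ ^ suc a)
floor-log Γ 2≤Γ zero = 0 , λ ()
floor-log Γ 2≤Γ x@(suc _) with least (suc x) (λ t → x <? Γ ^ t)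
... | inj₂ none = ⊥-elim (none x ≤-refl (≤-trans (n<2^n x) (^-monoˡ-≤ x 2≤Γ)))
... | inj₁ (zero , _ , p , _) = ⊥-elim (<⇒≱ p (s≤s z≤n))
... | inj₁ (suc a , _ , p , amin) = a , λ _ → ≮⇒≥ (λ q → <-irrefl refl (amin a q)) , p

-- Each deletion may cost a share of order `1 / Q` of the weight. The choices are made in the order
-- `L`, `I`, `ρZ`, `ρ`, `W`, `M`, `QD`, `Γ`; coming last, `Γ` can exceed all sizes in the tree
-- construction.
record Constants (s k r m₁ : ℕ) : Set where
  Q : ℕ
  Q = suc m₁
  field
    L I ρZ ρ W M Γ QD : ℕ
    L-ok   : Q * Queue.X s m₁ L s ≤ Q ^ L
    I-ok   : I ≡ Q * suc (trie-size s (suc L))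
    ρZ-ok  : suc (L + L) * radius I ≤ ρZ
    2ρZ≤ρ  : ρZ + ρZ ≤ ρ
    W-ok   : reachable-≤ r ρ ≡ W
    1≤W    : 1 ≤ W
    M-ok   : M ≡ Q * W
    growth : M * Q ^ ρ < suc Q ^ ρ
    QD-ok  : QD ≡ Q * M * (suc s * W ^ suc s)
    fit    : QD * (Size.size (suc (suc s * ρZ)) k (suc s) * (W * M)) < Γ
    M<Γ    : M < Γ
    2≤Γ    : 2 ≤ Γ

  clustering : ℕ
  clustering = Γ ^ Q * M

constants : ∀ s k r m₁ → Constants s k r m₁
constants s k r m₁ = let (L , L-ok) = QueueBound.emptied s m₁ in scales L L-ok _ refl _ ≤-refl
  where
  module _ (L : ℕ) (L-ok : suc m₁ * Queue.X s m₁ L s ≤ suc m₁ ^ L) (I : ℕ) (I-ok : I ≡ suc m₁ * suc (trie-size s (suc L)))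
           (ρZ : ℕ) (ρZ-ok : suc (L + L) * radius I ≤ ρZ) where
    weights : ∀ ρ → ρZ + ρZ ≤ ρ → ∀ W → reachable-≤ r ρ ≡ W → 1 ≤ W → ∀ M → M ≡ suc m₁ * W → M * suc m₁ ^ ρ < suc (suc m₁) ^ ρ →
              ∀ QD → QD ≡ suc m₁ * M * (suc s * W ^ suc s) → ∀ Y → QD * (Size.size (suc (suc s * ρZ)) k (suc s) * (W * M)) ≡ Y →
              Constants s k r m₁
    weights ρ 2ρZ≤ρ W W-ok 1≤W M M-ok growth QD QD-ok Y Y-ok = record
      { L = L ; I = I ; ρZ = ρZ ; ρ = ρ ; W = W ; M = M ; Γ = suc (suc (Y + M)) ; QD = QD
      ; L-ok = L-ok ; I-ok = I-ok ; ρZ-ok = ρZ-ok ; 2ρZ≤ρ = 2ρZ≤ρ ; W-ok = W-ok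
      ; 1≤W = 1≤W ; M-ok = M-ok ; growth = growth ; QD-ok = QD-ok
      ; fit = s≤s (m≤n⇒m≤1+n (≤-trans (≤-reflexive Y-ok) (m≤m+n Y M))) ; M<Γ = s≤s (m≤n⇒m≤1+n (m≤n+m M Y)) ; 2≤Γ = s≤s (s≤s z≤n) }

    scales : Constants s k r m₁
    scales = let (ρ , 2ρZ≤ρ , growth) = long-radius (suc m₁) r (ρZ + ρZ) (s≤s z≤n) in
      weights ρ 2ρZ≤ρ _ refl (*-mono-≤ (m^n>0 (suc ρ) r) (s≤s z≤n)) _ refl growth _ refl _ refl

-- The weighted bound

module Oracle {s k r m₁ : ℕ} (consts : Constants s k r m₁)
              {n : ℕ} (E : Fin n → Fin n → Set) (E? : ∀ u v → Dec (E u v)) (E-sym : ∀ {u v} → E u v → E v u)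
              (¬clique : ¬ Ranking.Clique E E? E-sym (suc (suc r)))
              (¬tree : ¬ TreeModel E E? E-sym k (suc s))
              (w : Fin n → ℕ) where
  open Walks E E? E-sym
  open Constants consts
  open Rank E E? E-sym using (π; weak-reach-bound)

  reach : ∀ v → ∃[ xs ] (length xs ≤ W × (∀ u → Walk (λ z → π u ≤ π z) ρ v u → u ∈ xs))
  reach v = let (xs , len , h) = weak-reach-bound v r ¬clique ρ in xs , ≤-trans len (≤-reflexive W-ok) , h

  Wk? : ∀ v u → Dec (Walk (λ z → π u ≤ π z) ρ v u)
  Wk? v u = walk? (λ z → π u ≤? π z) ρ v u

  w⁻ : Fin n → ℕ
  w⁻ u = ∑ (λ v → ind (Wk? v u) (w v))

  ∑w⁻ : ∑ w⁻ ≤ W * ∑ w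
  ∑w⁻ = begin
    ∑ (λ u → ∑ (λ v → ind (Wk? v u) (w v))) ≡⟨ ∑-swap (λ u v → ind (Wk? v u) (w v)) ⟩
    ∑ (λ v → ∑ (λ u → ind (Wk? v u) (w v))) ≤⟨ ∑-mono (λ v → ≤-trans (cover (Wk? v) (λ _ → w v) (proj₁ (reach v)) (proj₂ (proj₂ (reach v))))
         (≤-trans (sum-≤ (λ _ → w v) (w v) (proj₁ (reach v)) (λ _ _ → ≤-refl)) (*-monoˡ-≤ (w v) (proj₁ (proj₂ (reach v)))))) ⟩
    ∑ (λ v → W * w v) ≡⟨ ∑-*ˡ W w ⟩
    W * ∑ w ∎
    where open ≤-Reasoning

  Heavy : Fin n → Set
  Heavy v = 0 < w v × w⁻ v ≤ M * w v
  Heavy? : Decidable Heavy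
  Heavy? v = (0 <? w v) ×-dec (w⁻ v ≤? M * w v)

  -- Markov's inequality: `w⁻` has total at most `W * ∑ w`, and `M` is `Q * W`.
  light-loss : Q * wt w (λ v → ¬? (Heavy? v)) ≤ ∑ w
  light-loss = *-cancelˡ-≤ W {{>-nonZero 1≤W}} (begin
    W * (Q * wt w (λ v → ¬? (Heavy? v))) ≡⟨ trans (*-swap W Q _) (trans (sym (*-assoc Q W _)) (cong (_* wt w (λ v → ¬? (Heavy? v))) (sym M-ok))) ⟩
    M * wt w (λ v → ¬? (Heavy? v)) ≡⟨ sym (∑-*ˡ M (λ v → ind (¬? (Heavy? v)) (w v))) ⟩
    ∑ (λ v → M * ind (¬? (Heavy? v)) (w v)) ≤⟨ ∑-mono (λ v → ≤-trans (≤-reflexive (ind-* (¬? (Heavy? v)) M (w v))) (ind-≤′ (¬? (Heavy? v)) (light v))) ⟩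
    ∑ w⁻ ≤⟨ ∑w⁻ ⟩
    W * ∑ w ∎)
    where
    open ≤-Reasoning
    light : ∀ v → ¬ Heavy v → M * w v ≤ w⁻ v
    light v nh with 0 <? w v | w⁻ v ≤? M * w v
    ... | no w≯0 | _ = ≤-trans (≤-reflexive (trans (cong (M *_) (n≤0⇒n≡0 (≮⇒≥ w≯0))) (*-zeroʳ M))) z≤n
    ... | yes p | yes q = ⊥-elim (nh (p , q))
    ... | yes _ | no ¬q = <⇒≤ (≰⇒> ¬q)

  lg : Fin n → ℕ
  lg v = proj₁ (floor-log Γ 2≤Γ (w v))
  lg-spec : ∀ {v} → 0 < w v → Γ ^ lg v ≤ w v × w v < Γ ^ suc (lg v)
  lg-spec {v} = proj₂ (floor-log Γ 2≤Γ (w v))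

  -- Deleting one residue class of logarithms modulo `Q` cuts the others into blocks, the levels
  -- `b`. Of the `Q` shifts `c`, one has a class of weight at most `1 / Q` of the total.
  Gap : ℕ → Fin n → Set
  Gap c v = (lg v + c) % Q ≡ 0
  Gap? : ∀ c → Decidable (Gap c)
  Gap? c v = (lg v + c) % Q ≟ 0

  gap-unique : ∀ v (c c′ : Fin Q) → Gap (toℕ c) v → Gap (toℕ c′) v → c ≡ c′
  gap-unique v c c′ g g′ = FinP.toℕ-injective (go (<-cmp p p′))
    where
    p p′ : ℕ
    p = (lg v + toℕ c) / Q
    p′ = (lg v + toℕ c′) / Q
    eq : lg v + toℕ c ≡ p * Q
    eq = trans (m≡m%n+[m/n]*n (lg v + toℕ c) Q) (cong (_+ p * Q) g)
    eq′ : lg v + toℕ c′ ≡ p′ * Q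
    eq′ = trans (m≡m%n+[m/n]*n (lg v + toℕ c′) Q) (cong (_+ p′ * Q) g′)
    far : ∀ {x y} (d d′ : Fin Q) → lg v + toℕ d ≡ x * Q → lg v + toℕ d′ ≡ y * Q → x < y → ⊥
    far {x} {y} d d′ e e′ l = <⇒≱ (FinP.toℕ<n d′) (+-cancelˡ-≤ (lg v) Q (toℕ d′) (begin
      lg v + Q            ≤⟨ +-monoˡ-≤ Q (m≤m+n (lg v) (toℕ d)) ⟩
      lg v + toℕ d + Q    ≡⟨ trans (cong (_+ Q) e) (+-comm (x * Q) Q) ⟩
      suc x * Q           ≤⟨ *-monoˡ-≤ Q l ⟩
      y * Q               ≡⟨ sym e′ ⟩
      lg v + toℕ d′ ∎))
      where open ≤-Reasoning
    go : _ → toℕ c ≡ toℕ c′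
    go (tri< l _ _) = ⊥-elim (far c c′ eq eq′ l)
    go (tri> _ _ l) = ⊥-elim (far c′ c eq′ eq l)
    go (tri≈ _ e _) = +-cancelˡ-≡ (lg v) _ _ (trans eq (trans (cong (_* Q) e) (sym eq′)))

  abstract
    gaps : ∃[ c ] Q * wt w (Gap? c) ≤ ∑ w
    gaps = let (c , le) = ∑-min {Q} (λ c → wt w (Gap? (toℕ c))) (∑ w) (s≤s z≤n)
                 (≤-trans (≤-reflexive (∑-swap {Q} (λ c v → ind (Gap? (toℕ c) v) (w v))))
                          (∑-mono (λ v → ∑-unique {Q} (λ c → Gap? (toℕ c) v) (w v) (gap-unique v)))) in toℕ c , le

  c₀ : ℕ
  c₀ = proj₁ gaps

  alive : Fin n → Set
  alive v = Heavy v × ¬ Gap c₀ v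
  alive? : Decidable alive
  alive? v = Heavy? v ×-dec ¬? (Gap? c₀ v)

  b : Fin n → ℕ
  b v = (lg v + c₀) / Q

  b-lower : ∀ {v} → ¬ Gap c₀ v → b v * Q < lg v + c₀
  b-lower {v} ng = ≤-trans (+-monoˡ-≤ (b v * Q) (n≢0⇒n>0 ng)) (≤-reflexive (sym (m≡m%n+[m/n]*n (lg v + c₀) Q)))

  b-upper : ∀ v → lg v + c₀ < suc (b v) * Q
  b-upper v = ≤-trans (s≤s (≤-reflexive (m≡m%n+[m/n]*n (lg v + c₀) Q))) (+-monoˡ-≤ (b v * Q) (m%n<n (lg v + c₀) Q))

  Γ≢0 : NonZero Γ
  Γ≢0 = >-nonZero (≤-trans (s≤s z≤n) 2≤Γ)

  -- The deleted exponent between two blocks leaves one full power of `Γ` beyond what rounding in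
  -- `floor-log` loses.
  gap : ∀ {u v} → alive u → alive v → b v < b u → Γ * w v ≤ w u
  gap {u} {v} ((pu , _) , gu) ((pv , _) , _) l = begin
    Γ * w v              ≤⟨ *-monoʳ-≤ Γ (<⇒≤ (proj₂ (lg-spec pv))) ⟩
    Γ ^ suc (suc (lg v)) ≤⟨ ^-monoʳ-≤ Γ {{Γ≢0}} (+-cancelʳ-≤ c₀ _ _ (≤-trans (s≤s (≤-trans (b-upper v) (*-monoˡ-≤ Q l))) (b-lower gu))) ⟩
    Γ ^ lg u             ≤⟨ proj₁ (lg-spec pu) ⟩
    w u ∎
    where open ≤-Reasoning

  flat : ∀ {u v} → alive u → alive v → b u ≡ b v → w u ≤ Γ ^ Q * w v
  flat {u} {v} ((pu , _) , _) ((pv , _) , gv) e = begin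
    w u              ≤⟨ <⇒≤ (proj₂ (lg-spec pu)) ⟩
    Γ ^ suc (lg u)   ≤⟨ ^-monoʳ-≤ Γ {{Γ≢0}} (+-cancelʳ-≤ c₀ _ _ close) ⟩
    Γ ^ (Q + lg v)   ≡⟨ ^-distribˡ-+-* Γ Q (lg v) ⟩
    Γ ^ Q * Γ ^ lg v ≤⟨ *-monoʳ-≤ (Γ ^ Q) (proj₁ (lg-spec pv)) ⟩
    Γ ^ Q * w v ∎
    where
    open ≤-Reasoning
    close : suc (lg u) + c₀ ≤ Q + lg v + c₀
    close = begin
      suc (lg u + c₀) ≤⟨ b-upper u ⟩
      Q + b u * Q     ≡⟨ cong (λ x → Q + x * Q) e ⟩
      Q + b v * Q     ≤⟨ +-monoʳ-≤ Q (<⇒≤ (b-lower gv)) ⟩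
      Q + (lg v + c₀) ≡⟨ sym (+-assoc Q (lg v) c₀) ⟩
      Q + lg v + c₀ ∎

  S : Setting E E? E-sym
  S = record
    { w = w ; π = π ; ρ = ρ ; W = W ; M = M ; Γ = Γ ; β = suc (∑ b) ; reach = reach ; alive = alive ; alive? = alive?
    ; pos = λ ((p , _) , _) → p ; heavy = λ ((_ , h) , _) → h ; b = b ; b<β = λ v → s≤s (∑-≥ b v) ; gap = gap ; M<Γ = M<Γ }

  ρZ≤ρ : ρZ ≤ ρ
  ρZ≤ρ = ≤-trans (m≤m+n ρZ ρZ) 2ρZ≤ρ

  module TM = Tame S s ρZ
  module TR = Tries S s ρZ L I 2ρZ≤ρ ρZ-ok

  wild-loss : Q * (M * wt w TM.Wild?) ≤ ∑ w
  wild-loss = *-cancelˡ-≤ F {{>-nonZero (*-mono-≤ (s≤s (z≤n {s})) (m^n>0 W {{>-nonZero 1≤W}} (suc s)))}} (begin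
      F * (Q * (M * wt w TM.Wild?)) ≡⟨ trans (arith F Q M (wt w TM.Wild?)) (cong (_* wt w TM.Wild?) (sym QD-ok)) ⟩
      QD * wt w TM.Wild? ≤⟨ TreeBuild.Z-small S s ρZ k QD 2ρZ≤ρ 1≤W fit ¬tree ⟩
      suc s * (W ^ suc s * ∑ w) ≡⟨ sym (*-assoc (suc s) (W ^ suc s) (∑ w)) ⟩
      F * ∑ w ∎)
    where
    open ≤-Reasoning
    F = suc s * W ^ suc s
    arith : ∀ f q m x → f * (q * (m * x)) ≡ q * m * f * x
    arith = solve-∀

  abstract
    scale : ∃[ i ] (i < I × I * wt w (TR.Unstable? i) ≤ trie-size s (suc L) * ∑ w)
    scale = TR.stable-scale (subst (0 <_) (sym I-ok) (s≤s z≤n))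

  i : ℕ
  i = proj₁ scale
  i<I : i < I
  i<I = proj₁ (proj₂ scale)

  unstable-loss : Q * wt w (TR.Unstable? i) ≤ ∑ w
  unstable-loss = *-cancelˡ-≤ (suc C) (begin
    suc C * (Q * wt w (TR.Unstable? i)) ≡⟨ trans (*-swap (suc C) Q _) (trans (sym (*-assoc Q (suc C) _)) (cong (_* wt w (TR.Unstable? i)) (sym I-ok))) ⟩
    I * wt w (TR.Unstable? i) ≤⟨ proj₂ (proj₂ scale) ⟩
    C * ∑ w ≤⟨ *-monoˡ-≤ (∑ w) (n≤1+n C) ⟩
    suc C * ∑ w ∎)
    where
    open ≤-Reasoning
    C = trie-size s (suc L)

  fits′ : suc (L + L) * radius i ≤ ρZ
  fits′ = ≤-trans (*-monoʳ-≤ (suc (L + L)) (radius-mono (<⇒≤ i<I))) ρZ-ok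

  module MK = Marks S s ρZ m₁ L (radius i) 2ρZ≤ρ fits′

  abstract
    chosen-marks : ∃[ μ ] Q * Q ^ L * (wt w (MK.Deep? μ) + wt w (λ v → μ (b v) ≟B true)) ≤ (Q * Queue.X s m₁ L s + Q ^ L) * ∑ w
    chosen-marks = MK.marks

  μ : ℕ → Bool
  μ = proj₁ chosen-marks

  Marked? : Decidable (λ v → μ (b v) ≡ true)
  Marked? v = μ (b v) ≟B true

  mark-loss : Q * (wt w (MK.Deep? μ) + wt w Marked?) ≤ 2 * ∑ w
  mark-loss = *-cancelˡ-≤ (Q ^ L) {{m^n≢0 Q L}} (begin
    Q ^ L * (Q * x) ≡⟨ trans (*-swap (Q ^ L) Q x) (sym (*-assoc Q (Q ^ L) x)) ⟩
    Q * Q ^ L * x ≤⟨ proj₂ chosen-marks ⟩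
    (Q * Queue.X s m₁ L s + Q ^ L) * ∑ w ≤⟨ *-monoˡ-≤ (∑ w) (+-monoˡ-≤ (Q ^ L) L-ok) ⟩
    (Q ^ L + Q ^ L) * ∑ w ≡⟨ arith (Q ^ L) (∑ w) ⟩
    Q ^ L * (2 * ∑ w) ∎)
    where
    open ≤-Reasoning
    x = wt w (MK.Deep? μ) + wt w Marked?
    arith : ∀ a t → (a + a) * t ≡ a * (2 * t)
    arith = solve-∀

  module CO = Colour S s ρZ m₁ L I i i<I 2ρZ≤ρ ρZ-ok fits′ μ

  Kept? : Decidable CO.Kept
  Kept? v = TM.Tame? v ×-dec (¬? (TR.Unstable? i v) ×-dec (¬? (MK.Deep? μ v) ×-dec (μ (b v) ≟B false)))

  -- The six shares are one each for light, gap, untame and unstable vertices, and two for the deep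
  -- and the marked ones together.
  kept-weight : Q * ∑ w ≤ 6 * ∑ w + Q * wt w Kept?
  kept-weight = begin
    Q * ∑ w ≤⟨ *-monoʳ-≤ Q chain ⟩
    Q * (d₁ + (d₂ + (d₃ + (d₄ + (d₅ + (d₆ + wt w Kept?)))))) ≡⟨ arith Q d₁ d₂ d₃ d₄ d₅ d₆ (wt w Kept?) ⟩
    Q * d₁ + Q * d₂ + Q * d₃ + Q * d₄ + Q * (d₅ + d₆) + Q * wt w Kept?
      ≤⟨ +-monoˡ-≤ (Q * wt w Kept?) (+-mono-≤ (+-mono-≤ (+-mono-≤ (+-mono-≤ light-loss (proj₂ gaps)) (≤-trans (*-monoʳ-≤ Q TM.untame) wild-loss)) unstable-loss) mark-loss) ⟩
    ∑ w + ∑ w + ∑ w + ∑ w + 2 * ∑ w + Q * wt w Kept? ≡⟨ cong (_+ Q * wt w Kept?) (arith₂ (∑ w)) ⟩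
    6 * ∑ w + Q * wt w Kept? ∎
    where
    open ≤-Reasoning
    arith : ∀ q a b c d e f x → q * (a + (b + (c + (d + (e + (f + x)))))) ≡ q * a + q * b + q * c + q * d + q * (e + f) + q * x
    arith = solve-∀
    arith₂ : ∀ t → t + t + t + t + 2 * t ≡ 6 * t
    arith₂ = solve-∀
    D₃? : Decidable (λ v → alive v × ¬ TM.Tame v)
    D₃? v = alive? v ×-dec ¬? (TM.Tame? v)
    K₃? : Decidable (λ v → TM.Tame v × ¬ TR.Unstable i v)
    K₃? v = TM.Tame? v ×-dec ¬? (TR.Unstable? i v)
    K₄? : Decidable (λ v → TM.Tame v × ¬ TR.Unstable i v × ¬ MK.Deep μ v)
    K₄? v = TM.Tame? v ×-dec (¬? (TR.Unstable? i v) ×-dec ¬? (MK.Deep? μ v))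
    d₁ = wt w (λ v → ¬? (Heavy? v))
    d₂ = wt w (Gap? c₀)
    d₃ = wt w D₃?
    d₄ = wt w (TR.Unstable? i)
    d₅ = wt w (MK.Deep? μ)
    d₆ = wt w Marked?
    chain : ∑ w ≤ d₁ + (d₂ + (d₃ + (d₄ + (d₅ + (d₆ + wt w Kept?)))))
    chain = ≤-trans (wt-all w (λ v → ¬? (Heavy? v)) Heavy? (λ v → [ inj₂ , inj₁ ]′ (toSum (Heavy? v))))
      (+-monoʳ-≤ d₁ (≤-trans (wt-⊎ w Heavy? (Gap? c₀) alive? (λ v h → [ inj₁ , (λ g → inj₂ (h , g)) ]′ (toSum (Gap? c₀ v))))
      (+-monoʳ-≤ d₂ (≤-trans (wt-⊎ w alive? D₃? TM.Tame? (λ v a → [ inj₂ , (λ t → inj₁ (a , t)) ]′ (toSum (TM.Tame? v))))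
      (+-monoʳ-≤ d₃ (≤-trans (wt-⊎ w TM.Tame? (TR.Unstable? i) K₃? (λ v t → [ inj₁ , (λ u → inj₂ (t , u)) ]′ (toSum (TR.Unstable? i v))))
      (+-monoʳ-≤ d₄ (≤-trans (wt-⊎ w K₃? (MK.Deep? μ) K₄? (λ v (t , u) → [ inj₁ , (λ d → inj₂ (t , u , d)) ]′ (toSum (MK.Deep? μ v))))
      (+-monoʳ-≤ d₅ (wt-⊎ w K₄? Marked? Kept? (λ v (t , u , d) → unmarked v t u d)))))))))))
      where
      unmarked : ∀ v → TM.Tame v → ¬ TR.Unstable i v → ¬ MK.Deep μ v → μ (b v) ≡ true ⊎ CO.Kept v
      unmarked v t u d = [ inj₁ , (λ ne → inj₂ (t , u , d , ¬-not ne)) ]′ (toSum (Marked? v))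

  Class? : ∀ j → Decidable (λ v → CO.Kept v × CO.colour v ≡ j)
  Class? j v = Kept? v ×-dec (CO.colour v ≟ j)

  classes : wt w Kept? ≤ ∑ {suc s} (λ j → wt w (Class? (toℕ j)))
  classes = ≤-trans (∑-mono (λ v → ind-≤′ (Kept? v) (in-class v))) (≤-reflexive (sym (∑-swap {suc s} (λ j v → ind (Class? (toℕ j) v) (w v)))))
    where
    in-class : ∀ v → CO.Kept v → w v ≤ ∑ {suc s} (λ j → ind (Class? (toℕ j) v) (w v))
    in-class v kv = ≤-trans (≤-reflexive (sym (ind-yes (Class? (toℕ j) v) (kv , sym (FinP.toℕ-fromℕ< (CO.colour-< kv))))))
                            (∑-≥ {suc s} (λ j → ind (Class? (toℕ j) v) (w v)) j)
      where j = fromℕ< (CO.colour-< kv)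

  abstract
    best-colour : ∃[ j ] wt w Kept? ≤ suc s * wt w (Class? j)
    best-colour = let (j , le) = ∑-max {suc s} (λ j → wt w (Class? (toℕ j))) (wt w Kept?) (s≤s z≤n) classes in toℕ j , le

  colour₀ : ℕ
  colour₀ = proj₁ best-colour

  same-level : ∀ {u v} → CO.Kept u × CO.colour u ≡ colour₀ → CO.Kept v × CO.colour v ≡ colour₀ → E u v → b u ≡ b v
  same-level {u} {v} (ku , cu) (kv , cv) e = ≤-antisym
    (≮⇒≥ (λ l → CO.proper kv ku (E-sym e) l (trans cv (sym cu))))
    (≮⇒≥ (λ l → CO.proper ku kv e l (trans cu (sym cv))))

  module CA = Carve S (Γ ^ Q) Q flat growth (λ v → CO.Kept v × CO.colour v ≡ colour₀) (λ (kv , _) → proj₁ (proj₁ kv)) same-level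

  abstract
    heavy-set : Σ (Fin n → Set) λ P → Σ (Decidable P) λ P? →
      (∀ v → P v → ∃[ xs ] (length xs ≤ clustering × (∀ ℓ x → Walk P ℓ v x → P x → x ∈ xs)))
      × Q * ∑ w ≤ suc s * (suc Q * wt w P?) + 6 * ∑ w
    heavy-set = let (P , P? , _ , cl , le) = CA.carve (wt (λ _ → 1) (Class? colour₀)) (Class? colour₀) id ≤-refl in P , P? , cl , (begin
        Q * ∑ w ≤⟨ kept-weight ⟩
        6 * ∑ w + Q * wt w Kept? ≤⟨ +-monoʳ-≤ (6 * ∑ w) (*-monoʳ-≤ Q (proj₂ best-colour)) ⟩
        6 * ∑ w + Q * (suc s * wt w (Class? colour₀)) ≡⟨ trans (+-comm (6 * ∑ w) _) (cong (_+ 6 * ∑ w) (*-swap Q (suc s) (wt w (Class? colour₀)))) ⟩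
        suc s * (Q * wt w (Class? colour₀)) + 6 * ∑ w ≤⟨ +-monoˡ-≤ (6 * ∑ w) (*-monoʳ-≤ (suc s) le) ⟩
        suc s * (suc Q * wt w P?) + 6 * ∑ w ∎)
      where open ≤-Reasoning

-- Multiplicative weights

module _ (N₁ : ℕ) where
  private
    N : ℕ
    N = suc N₁

  -- Bernoulli's inequality for `(1 - 1 / N) ^ q`; truncated subtraction makes large `q` trivial.
  power-lower : ∀ q → (N ∸ q) * N ^ q ≤ N * N₁ ^ q
  power-lower zero    = ≤-refl
  power-lower (suc q) = begin
    (N₁ ∸ q) * (N * N ^ q) ≡⟨ sym (*-assoc (N₁ ∸ q) N (N ^ q)) ⟩
    (N₁ ∸ q) * N * N ^ q   ≤⟨ *-monoˡ-≤ (N ^ q) one ⟩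
    N₁ * (N ∸ q) * N ^ q   ≡⟨ *-assoc N₁ (N ∸ q) (N ^ q) ⟩
    N₁ * ((N ∸ q) * N ^ q) ≤⟨ *-monoʳ-≤ N₁ (power-lower q) ⟩
    N₁ * (N * N₁ ^ q)      ≡⟨ *-swap N₁ N (N₁ ^ q) ⟩
    N * (N₁ * N₁ ^ q)      ∎
    where
    open ≤-Reasoning
    one : (N₁ ∸ q) * N ≤ N₁ * (N ∸ q)
    one with q ≤? N₁
    ... | no q≰ = ≤-trans (≤-reflexive (cong (_* N) (m≤n⇒m∸n≡0 (<⇒≤ (≰⇒> q≰))))) z≤n
    ... | yes q≤ = begin
      (N₁ ∸ q) * N             ≡⟨ *-suc (N₁ ∸ q) N₁ ⟩
      (N₁ ∸ q) + (N₁ ∸ q) * N₁ ≤⟨ +-mono-≤ (m∸n≤m N₁ q) (≤-reflexive (*-comm (N₁ ∸ q) N₁)) ⟩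
      N₁ + N₁ * (N₁ ∸ q)       ≡⟨ sym (*-suc N₁ (N₁ ∸ q)) ⟩
      N₁ * suc (N₁ ∸ q)        ≡⟨ cong (N₁ *_) (sym (+-∸-assoc 1 q≤)) ⟩
      N₁ * (N ∸ q) ∎

-- With `m = D + a` this says that `(1 - a / m) ^ p` is at most `1 / (1 + p * a / m)`.
power-upper : ∀ D a p → D ^ p * (D + a + p * a) ≤ (D + a) ^ p * (D + a)
power-upper D a zero    = ≤-reflexive (cong (_+ 0) (+-identityʳ (D + a)))
power-upper D a (suc p) = begin
  D * D ^ p * (D + a + suc p * a)     ≡⟨ arith₁ D (D ^ p) (D + a + suc p * a) ⟩
  D ^ p * (D * (D + a + suc p * a))   ≤⟨ *-monoʳ-≤ (D ^ p) (≤-trans (m≤m+n _ (suc p * a * a)) (≤-reflexive (arith₂ D a p))) ⟩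
  D ^ p * ((D + a) * (D + a + p * a)) ≡⟨ *-swap (D ^ p) (D + a) (D + a + p * a) ⟩
  (D + a) * (D ^ p * (D + a + p * a)) ≤⟨ *-monoʳ-≤ (D + a) (power-upper D a p) ⟩
  (D + a) * ((D + a) ^ p * (D + a))   ≡⟨ sym (*-assoc (D + a) ((D + a) ^ p) (D + a)) ⟩
  (D + a) * (D + a) ^ p * (D + a)     ∎
  where
  open ≤-Reasoning
  arith₁ : ∀ x y z → x * y * z ≡ y * (x * z)
  arith₁ = solve-∀
  arith₂ : ∀ d a p → d * (d + a + (1 + p) * a) + (1 + p) * a * a ≡ (d + a) * (d + a + p * a)
  arith₂ = solve-∀

-- Multiplicative weights: covered elements are reweighted by N₁ / N, so that an element covered too rarely
-- would outweigh the whole total.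
module MultiplicativeWeights
  (A B p q : ℕ) (1≤A : 1 ≤ A) (1≤q : 1 ≤ q) (1≤B : 1 ≤ B) (qB<pA : q * B < p * A) where

  1≤p : 1 ≤ p
  1≤p = n≢0⇒n>0 (λ p≡0 → <⇒≱ qB<pA (≤-trans (≤-reflexive (cong (_* A) p≡0)) z≤n))

  N₁ N M D : ℕ
  -- The second order term `p * q * A` in `gain` has to stay below `N`, the margin left by `qB<pA`.
  N₁ = p * q * A
  N = suc N₁
  M = B * N
  D = M ∸ A

  A≤M : A ≤ M
  A≤M = begin
    A         ≤⟨ m≤n*m A (p * q) {{m*n≢0 p q {{>-nonZero 1≤p}} {{>-nonZero 1≤q}}}} ⟩
    p * q * A ≤⟨ n≤1+n N₁ ⟩
    N         ≤⟨ m≤n*m N B {{>-nonZero 1≤B}} ⟩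
    B * N     ∎
    where open ≤-Reasoning

  D+A : D + A ≡ M
  D+A = m∸n+n≡m A≤M

  x y : ℕ
  x = M ^ p * N₁ ^ q
  y = D ^ p * N ^ q

  M≢0 : NonZero M
  M≢0 = m*n≢0 B N {{>-nonZero 1≤B}}

  N∸q : q ≤ N
  N∸q = ≤-trans (m≤n*m q (p * A) {{m*n≢0 p A {{>-nonZero 1≤p}} {{>-nonZero 1≤A}}}}) (≤-trans (≤-reflexive (arith p A q)) (n≤1+n N₁))
    where
    arith : ∀ p a q → p * a * q ≡ p * q * a
    arith = solve-∀

  gain : M * N < (N ∸ q) * (M + p * A)
  gain = +-cancelʳ-< (q * (M + p * A)) (M * N) ((N ∸ q) * (M + p * A)) (begin-strict
    M * N + q * (M + p * A)   ≡⟨ arith B N p q A ⟩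
    M * N + (q * B * N + N₁)  <⟨ +-monoʳ-< (M * N) (≤-reflexive (sym (+-suc (q * B * N) N₁))) ⟩
    M * N + (q * B * N + N)   ≡⟨ cong (M * N +_) (+-comm (q * B * N) N) ⟩
    M * N + suc (q * B) * N   ≤⟨ +-monoʳ-≤ (M * N) (*-monoˡ-≤ N qB<pA) ⟩
    M * N + p * A * N         ≡⟨ trans (cong (M * N +_) (*-comm (p * A) N)) (trans (cong (_+ N * (p * A)) (*-comm M N)) (sym (*-distribˡ-+ N M (p * A)))) ⟩
    N * (M + p * A)           ≡⟨ cong (_* (M + p * A)) (sym (m∸n+n≡m N∸q)) ⟩
    ((N ∸ q) + q) * (M + p * A) ≡⟨ *-distribʳ-+ (M + p * A) (N ∸ q) q ⟩
    (N ∸ q) * (M + p * A) + q * (M + p * A) ∎)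
    where
    open ≤-Reasoning
    arith : ∀ b n p q a → b * n * n + q * (b * n + p * a) ≡ b * n * n + (q * b * n + p * q * a)
    arith = solve-∀

  -- Compares the decay in `p` rounds: the total shrinks by `(1 - A / M) ^ p`, an element covered
  -- `q` times only by `(1 - 1 / N) ^ q`.
  y<x : y < x
  y<x = *-cancelʳ-< (N * (M + p * A)) y x (begin-strict
    D ^ p * N ^ q * (N * (M + p * A))         ≡⟨ arith₁ (D ^ p) (N ^ q) N (M + p * A) ⟩
    D ^ p * (M + p * A) * (N * N ^ q)         ≤⟨ *-monoˡ-≤ (N * N ^ q) upper ⟩
    M ^ p * M * (N * N ^ q)                   ≡⟨ arith₂ (M ^ p) M N (N ^ q) ⟩
    M ^ p * N ^ q * (M * N)                   <⟨ *-monoʳ-< (M ^ p * N ^ q) {{m*n≢0 (M ^ p) (N ^ q) {{m^n≢0 M p {{M≢0}}}} {{m^n≢0 N q}}}} gain ⟩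
    M ^ p * N ^ q * ((N ∸ q) * (M + p * A))   ≡⟨ arith₃ (M ^ p) (N ^ q) (N ∸ q) (M + p * A) ⟩
    M ^ p * (M + p * A) * ((N ∸ q) * N ^ q)   ≤⟨ *-monoʳ-≤ (M ^ p * (M + p * A)) (power-lower N₁ q) ⟩
    M ^ p * (M + p * A) * (N * N₁ ^ q)        ≡⟨ arith₄ (M ^ p) (M + p * A) N (N₁ ^ q) ⟩
    M ^ p * N₁ ^ q * (N * (M + p * A)) ∎)
    where
    open ≤-Reasoning
    upper : D ^ p * (M + p * A) ≤ M ^ p * M
    upper = subst (λ m → D ^ p * (m + p * A) ≤ m ^ p * m) D+A (power-upper D A p)
    arith₁ : ∀ a b c d → a * b * (c * d) ≡ a * d * (c * b)
    arith₁ = solve-∀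
    arith₂ : ∀ a b c d → a * b * (c * d) ≡ a * d * (b * c)
    arith₂ = solve-∀
    arith₃ : ∀ a b c d → a * b * (c * d) ≡ a * d * (c * b)
    arith₃ = solve-∀
    arith₄ : ∀ a b c d → a * b * (c * d) ≡ a * d * (c * b)
    arith₄ = solve-∀

  module Run {n : ℕ} (Good : (Fin n → Set) → Set)
    (oracle : ∀ w → Σ (Fin n → Set) λ P → Σ (Decidable P) λ P? → Good P × A * ∑ w ≤ B * wt w P?) where

    -- Scaled up by `N` in every round to remain integral.
    weight : ℕ → Fin n → ℕ
    chosen : ℕ → Fin n → Set
    chosen? : ∀ i → Decidable (chosen i)
    weight zero    v = 1
    weight (suc i) v = choose (chosen? i v) N₁ N * weight i v
    chosen i  = proj₁ (oracle (weight i))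
    chosen? i = proj₁ (proj₂ (oracle (weight i)))

    good : ∀ i → Good (chosen i)
    good i = proj₁ (proj₂ (proj₂ (oracle (weight i))))

    hits : ℕ → Fin n → ℕ
    hits zero    v = 0
    hits (suc i) v = ind (chosen? i v) 1 + hits i v

    total-step : ∀ i → B * ∑ (weight (suc i)) ≤ D * ∑ (weight i)
    total-step i = +-cancelʳ-≤ (A * ∑ (weight i)) _ _ (begin
      B * ∑ (weight (suc i)) + A * ∑ (weight i) ≤⟨ +-monoʳ-≤ (B * ∑ (weight (suc i))) (proj₂ (proj₂ (proj₂ (oracle (weight i))))) ⟩
      B * ∑ (weight (suc i)) + B * wt (weight i) (chosen? i) ≡⟨ sym (*-distribˡ-+ B (∑ (weight (suc i))) (wt (weight i) (chosen? i))) ⟩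
      B * (∑ (weight (suc i)) + wt (weight i) (chosen? i)) ≡⟨ cong (B *_) (trans (sym (∑-+ (weight (suc i)) (λ v → ind (chosen? i v) (weight i v)))) (∑-cong (λ v → refill (chosen? i v) (weight i v)))) ⟩
      B * ∑ (λ v → N * weight i v) ≡⟨ trans (cong (B *_) (∑-*ˡ N (weight i))) (sym (*-assoc B N (∑ (weight i)))) ⟩
      M * ∑ (weight i) ≡⟨ cong (_* ∑ (weight i)) (sym D+A) ⟩
      (D + A) * ∑ (weight i) ≡⟨ *-distribʳ-+ (∑ (weight i)) D A ⟩
      D * ∑ (weight i) + A * ∑ (weight i) ∎)
      where
      open ≤-Reasoning
      refill : ∀ {X : Set} (d : Dec X) x → choose d N₁ N * x + ind d x ≡ N * x
      refill (yes _) x = +-comm (N₁ * x) x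
      refill (no _)  x = +-identityʳ (N * x)

    total : ∀ T → B ^ T * ∑ (weight T) ≤ D ^ T * n
    total zero = ≤-reflexive (cong (_+ 0) (trans (∑-const n 1) (*-identityʳ n)))
    total (suc T) = begin
      B * B ^ T * ∑ (weight (suc T)) ≡⟨ trans (*-assoc B (B ^ T) _) (*-swap B (B ^ T) _) ⟩
      B ^ T * (B * ∑ (weight (suc T))) ≤⟨ *-monoʳ-≤ (B ^ T) (total-step T) ⟩
      B ^ T * (D * ∑ (weight T)) ≡⟨ *-swap (B ^ T) D _ ⟩
      D * (B ^ T * ∑ (weight T)) ≤⟨ *-monoʳ-≤ D (total T) ⟩
      D * (D ^ T * n) ≡⟨ sym (*-assoc D (D ^ T) n) ⟩
      D * D ^ T * n ∎
      where open ≤-Reasoning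

    weight-hits : ∀ T v → weight T v * N ^ hits T v ≡ N₁ ^ hits T v * N ^ T
    weight-hits zero v = refl
    weight-hits (suc T) v = round (chosen? T v) (weight-hits T v)
      where
      arith₁ : ∀ a b c d → (a * b) * (c * d) ≡ (a * c) * (b * d)
      arith₁ = solve-∀
      arith₂ : ∀ a c h t → (a * c) * (h * t) ≡ a * h * (c * t)
      arith₂ = solve-∀
      arith₃ : ∀ c w h → c * w * h ≡ c * (w * h)
      arith₃ = solve-∀
      round : ∀ {X : Set} (d : Dec X) → weight T v * N ^ hits T v ≡ N₁ ^ hits T v * N ^ T →
             choose d N₁ N * weight T v * N ^ (ind d 1 + hits T v) ≡ N₁ ^ (ind d 1 + hits T v) * (N * N ^ T)
      round (yes _) e = trans (arith₁ N₁ (weight T v) N (N ^ hits T v)) (trans (cong (N₁ * N *_) e) (arith₂ N₁ N (N₁ ^ hits T v) (N ^ T)))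
      round (no _)  e = trans (arith₃ N (weight T v) (N ^ hits T v)) (trans (cong (N *_) e) (*-swap N (N₁ ^ hits T v) (N ^ T)))

    weight-≥ : ∀ T v e → hits T v ≤ e → N₁ ^ e * N ^ T ≤ weight T v * N ^ e
    weight-≥ T v e l = begin
      N₁ ^ e * N ^ T                               ≡⟨ cong (λ z → N₁ ^ z * N ^ T) (sym (m+[n∸m]≡n l)) ⟩
      N₁ ^ (hits T v + d) * N ^ T                  ≡⟨ cong (_* N ^ T) (^-distribˡ-+-* N₁ (hits T v) d) ⟩
      N₁ ^ hits T v * N₁ ^ d * N ^ T               ≤⟨ *-monoˡ-≤ (N ^ T) (*-monoʳ-≤ (N₁ ^ hits T v) (^-monoˡ-≤ d (n≤1+n N₁))) ⟩
      N₁ ^ hits T v * N ^ d * N ^ T                ≡⟨ arith (N₁ ^ hits T v) (N ^ d) (N ^ T) ⟩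
      N₁ ^ hits T v * N ^ T * N ^ d                ≡⟨ cong (_* N ^ d) (sym (weight-hits T v)) ⟩
      weight T v * N ^ hits T v * N ^ d            ≡⟨ trans (*-assoc (weight T v) _ _) (cong (weight T v *_) (sym (^-distribˡ-+-* N (hits T v) d))) ⟩
      weight T v * N ^ (hits T v + d)              ≡⟨ cong (λ z → weight T v * N ^ z) (m+[n∸m]≡n l) ⟩
      weight T v * N ^ e ∎
      where
      open ≤-Reasoning
      d = e ∸ hits T v
      arith : ∀ a b c → a * b * c ≡ a * c * b
      arith = solve-∀

    -- So many blocks of `p` rounds that the advantage of `x` over `y` outgrows the initial total
    -- weight `n`.
    T′ : ℕ
    T′ = suc (proj₁ (enough (suc n) y))

    separated : n * y ^ T′ < x ^ T′
    separated = begin-strict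
      n * (y * y ^ j)       ≡⟨ arith n y (y ^ j) ⟩
      y * (y ^ j * n)       ≤⟨ *-monoʳ-≤ y (≤-trans (*-monoʳ-≤ (y ^ j) (n≤1+n n)) (proj₂ (enough (suc n) y))) ⟩
      y * suc y ^ j         <⟨ *-monoˡ-< (suc y ^ j) {{m^n≢0 (suc y) j}} (n<1+n y) ⟩
      suc y * suc y ^ j     ≤⟨ ^-monoˡ-≤ (suc j) y<x ⟩
      x * x ^ j ∎
      where
      open ≤-Reasoning
      j = proj₁ (enough (suc n) y)
      arith : ∀ n y z → n * (y * z) ≡ y * (z * n)
      arith = solve-∀

    covered : ∀ v → q * T′ ≤ hits (p * T′) v
    covered v = ≮⇒≥ (λ l → <-irrefl refl (begin-strict
      n * y ^ T′ <⟨ separated ⟩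
      x ^ T′ ≡⟨ trans (^-distribʳ-* (M ^ p) (N₁ ^ q) T′) (cong₂ _*_ (trans (^-*-assoc M p T′) (^-distribʳ-* B N τ)) (^-*-assoc N₁ q T′)) ⟩
      B ^ τ * N ^ τ * N₁ ^ e ≡⟨ arith₁ (B ^ τ) (N ^ τ) (N₁ ^ e) ⟩
      B ^ τ * (N₁ ^ e * N ^ τ) ≤⟨ *-monoʳ-≤ (B ^ τ) (weight-≥ τ v e (<⇒≤ l)) ⟩
      B ^ τ * (weight τ v * N ^ e) ≤⟨ *-monoʳ-≤ (B ^ τ) (*-monoˡ-≤ (N ^ e) (∑-≥ (weight τ) v)) ⟩
      B ^ τ * (∑ (weight τ) * N ^ e) ≡⟨ sym (*-assoc (B ^ τ) (∑ (weight τ)) (N ^ e)) ⟩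
      B ^ τ * ∑ (weight τ) * N ^ e ≤⟨ *-monoˡ-≤ (N ^ e) (total τ) ⟩
      D ^ τ * n * N ^ e ≡⟨ arith₂ (D ^ τ) n (N ^ e) ⟩
      n * (D ^ τ * N ^ e) ≡⟨ cong (n *_) (trans (cong₂ _*_ (sym (^-*-assoc D p T′)) (sym (^-*-assoc N q T′))) (sym (^-distribʳ-* (D ^ p) (N ^ q) T′))) ⟩
      n * y ^ T′ ∎))
      where
      open ≤-Reasoning
      τ = p * T′
      e = q * T′
      arith₁ : ∀ a b c → a * b * c ≡ a * (c * b)
      arith₁ = solve-∀
      arith₂ : ∀ a b c → a * b * c ≡ b * (a * c)
      arith₂ = solve-∀

-- Rational arithmetic

-- In lowest terms by construction, so that numerator and denominator are visible without
-- normalisation.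
ι : ℕ → ℚ
ι n = mkℚ (ℤ.+ n) 0 (Coprime.sym (Coprime.1-coprimeTo n))

ι-/1 : ∀ n → ℤ.+ n ℚ./ 1 ≡ ι n
ι-/1 n = ℚP.normalize-coprime (Coprime.sym (Coprime.1-coprimeTo n))

ι-+ : ∀ m n → ι (m + n) ≡ ι m ℚ.+ ι n
ι-+ m n = ℚP.toℚᵘ-injective (ℚᵘP.≃-trans
  (ℚᵘ.*≡* (cong (ℤ._* ℤ.+ 1) (trans (ℤP.pos-+ m n) (sym (cong₂ ℤ._+_ (ℤP.*-identityʳ (ℤ.+ m)) (ℤP.*-identityʳ (ℤ.+ n)))))))
  (ℚᵘP.≃-sym (ℚP.toℚᵘ-homo-+ (ι m) (ι n))))

ι-* : ∀ m n → ι (m * n) ≡ ι m ℚ.* ι n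
ι-* m n = ℚP.toℚᵘ-injective (ℚᵘP.≃-trans
  (ℚᵘ.*≡* (cong (ℤ._* ℤ.+ 1) (ℤP.pos-* m n)))
  (ℚᵘP.≃-sym (ℚP.toℚᵘ-homo-* (ι m) (ι n))))

ι-mono : ∀ {m n} → m ≤ n → ι m ℚ.≤ ι n
ι-mono {m} {n} l = ℚ.*≤* (subst₂ ℤ._≤_ (sym (ℤP.*-identityʳ (ℤ.+ m))) (sym (ℤP.*-identityʳ (ℤ.+ n))) (ℤ.+≤+ l))

ι-cancel : ∀ {m n} → ι m ℚ.≤ ι n → m ≤ n
ι-cancel {m} {n} (ℚ.*≤* l) = ℤP.drop‿+≤+ (subst₂ ℤ._≤_ (ℤP.*-identityʳ (ℤ.+ m)) (ℤP.*-identityʳ (ℤ.+ n)) l)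

reciprocal : ∀ D → 1 ≤ D → ∃[ a ] (0ℚ ℚ.≤ a × a ℚ.≤ 1ℚ × ι D ℚ.* a ≡ 1ℚ)
reciprocal D@(suc _) _ = a , ℚP.<⇒≤ (ℚP.positive⁻¹ a {{ℚP.1/pos⇒pos (ι D)}}) , ℚP.*-cancelʳ-≤-pos (ι D) le , ℚP.*-inverseʳ (ι D)
  where
  a = ℚ.1/ ι D
  le : a ℚ.* ι D ℚ.≤ 1ℚ ℚ.* ι D
  le = subst₂ ℚ._≤_ (sym (ℚP.*-inverseˡ (ι D))) (sym (ℚP.*-identityˡ (ι D))) (ι-mono {1} {D} (s≤s z≤n))

fraction : ∀ t → 0ℚ ℚ.< t → ∃[ p ] ∃[ q ] (1 ≤ q × t ℚ.* ι q ≡ ι p)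
fraction (mkℚ ℤ.-[1+ n ] d c) (ℚ.*<* ())
fraction t@(mkℚ (ℤ.+ p) d c) _ = p , suc d , s≤s z≤n , ℚP.toℚᵘ-injective (ℚᵘP.≃-trans (ℚP.toℚᵘ-homo-* t (ι (suc d)))
  (ℚᵘ.*≡* (trans (ℤP.*-identityʳ _) (cong (λ z → ℤ.+ p ℤ.* ℤ.+ z) (sym (*-identityʳ (suc d)))))))

sumFin-const : ∀ s a → sumFin s (λ _ → a) ≡ ι s ℚ.* a
sumFin-const zero    a = sym (ℚP.*-zeroˡ a)
sumFin-const (suc s) a = sym (trans (cong (ℚ._* a) (ι-+ 1 s)) (trans (ℚP.*-distribʳ-+ a (ι 1) (ι s))
  (cong₂ ℚ._+_ (ℚP.*-identityˡ a) (sym (sumFin-const s a)))))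

-- Needed because `#` splits off the largest index and `sumFin` the smallest.
sumFin-last : ∀ s (g : ℕ → ℚ) → sumFin (suc s) (g ∘ toℕ) ≡ g s ℚ.+ sumFin s (g ∘ toℕ)
sumFin-last zero    g = refl
sumFin-last (suc s) g = trans (cong (g 0 ℚ.+_) (sumFin-last s (g ∘ suc)))
  (trans (sym (ℚP.+-assoc (g 0) (g (suc s)) rest)) (trans (cong (ℚ._+ rest) (ℚP.+-comm (g 0) (g (suc s)))) (ℚP.+-assoc (g (suc s)) (g 0) rest)))
  where rest = sumFin s (g ∘ suc ∘ toℕ)

∈-index-lookup : ∀ {A : Set} {xs : List A} → Unique xs → ∀ i (p : lookup xs i ∈ xs) → Any.index p ≡ i
∈-index-lookup (a ∷ u) zero    (here _)  = refl
∈-index-lookup {xs = x ∷ xs} (a ∷ u) zero (there p) = ⊥-elim (All.lookup a p refl)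
∈-index-lookup {xs = x ∷ xs} (a ∷ u) (suc i) (here e) = ⊥-elim (All.lookup a (∈-lookup {xs = xs} i) (sym e))
∈-index-lookup (a ∷ u) (suc i) (there p) = cong suc (∈-index-lookup u i p)

-- Minors and the upper bound

prefix⇒++ : ∀ {A : Set} {u w : List A} → Prefix _≡_ u w → ∃[ q ] w ≡ u ++ q
prefix⇒++ {w = w} [] = w , refl
prefix⇒++ (refl ∷ p) = let (q , e) = prefix⇒++ p in q , cong (_ ∷_) e

toList-injective : ∀ {A : Set} {m} (u w : Vec A m) → toList u ≡ toList w → u ≡ w
toList-injective u w e = trans (sym (VecP.cast-is-id refl u)) (VecP.toList-injective refl u w e)

module Numbering (G : Graph) where
  xs : List (V G)
  xs = deduplicate (_≟V_ G) (enum G)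

  n : ℕ
  n = length xs

  vert : Fin n → V G
  vert = lookup xs

  mem : ∀ v → v ∈ xs
  mem v = ∈-deduplicate⁺ (_≟V_ G) (complete G v)

  idx : V G → Fin n
  idx v = Any.index (mem v)

  vert-idx : ∀ v → vert (idx v) ≡ v
  vert-idx v = sym (lookup-index (mem v))

  idx-vert : ∀ i → idx (vert i) ≡ i
  idx-vert i = ∈-index-lookup (deduplicate-! (_≟V_ G) (enum G)) i (mem (vert i))

  E′ : Fin n → Fin n → Set
  E′ i j = E G (vert i) (vert j)
  E′? : ∀ i j → Dec (E′ i j)
  E′? i j = E? G (vert i) (vert j)
  E′-sym : ∀ {i j} → E′ i j → E′ j i
  E′-sym = E-sym G

  open Walks E′ E′? E′-sym

  walk⇒reach : ∀ {P : Fin n → Set} {Q : V G → Set} {ℓ i j} → (∀ {z} → P z → Q (vert z)) → Walk P ℓ i j → P j → Reach G Q (vert i) (vert j)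
  walk⇒reach f here pj = stay (f pj)
  walk⇒reach f (step p e k) pj = step (f p) e (walk⇒reach f k pj)

  reach⇒walk : ∀ {P : V G → Set} {Q : Fin n → Set} {u v} → (∀ {z} → P z → Q (idx z)) → Reach G P u v → ∃[ ℓ ] (Walk Q ℓ (idx u) (idx v) × Q (idx v))
  reach⇒walk f (stay p) = 0 , here , f p
  reach⇒walk f (step {u} {w} p e r) = let (ℓ , k , q) = reach⇒walk f r in
    suc ℓ , step (f p) (subst₂ (E G) (sym (vert-idx u)) (sym (vert-idx w)) e) k , q

  module Minor (H : Graph) (Br : V H → Fin n → Set) (Br? : ∀ x → Decidable (Br x))
    (nonempty : ∀ x → ∃ (Br x))
    (disjoint : ∀ x y i → Br x i → Br y i → x ≡ y)
    (connected : ∀ x i j → Br x i → Br x j → ∃[ ℓ ] Walk (Br x) ℓ i j)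
    (edges : ∀ x y → E H x y → ∃[ i ] ∃[ j ] (Br x i × Br y j × E′ i j)) where

    owner : ∀ i → Dec (Any.Any (λ x → Br x i) (enum H)) → Maybe (V H)
    owner i (yes p) = just (proj₁ (Any.satisfied p))
    owner i (no _)  = nothing

    φ : V G → Maybe (V H)
    φ g = owner (idx g) (Any.any? (λ x → Br? x (idx g)) (enum H))

    φ⇒ : ∀ {g x} → φ g ≡ just x → Br x (idx g)
    φ⇒ {g} = go (Any.any? (λ x → Br? x (idx g)) (enum H))
      where
      go : ∀ d {x} → owner (idx g) d ≡ just x → Br x (idx g)
      go (yes p) refl = proj₂ (Any.satisfied p)

    φ⇐ : ∀ {g x} → Br x (idx g) → φ g ≡ just x
    φ⇐ {g} {x} bx = go (Any.any? (λ x → Br? x (idx g)) (enum H))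
      where
      go : ∀ d → owner (idx g) d ≡ just x
      go (yes p) = cong just (disjoint _ _ _ (proj₂ (Any.satisfied p)) bx)
      go (no ¬p) = ⊥-elim (¬p (lose (complete H x) bx))

    φ-vert : ∀ {i x} → Br x i → φ (vert i) ≡ just x
    φ-vert {i} {x} bx = φ⇐ (subst (Br x) (sym (idx-vert i)) bx)

    minor : H ≼ G
    minor = record
      { φ = φ
      ; nonempty = λ x → let (i , bx) = nonempty x in vert i , φ-vert bx
      ; connected = λ x g g′ e e′ → let (ℓ , k) = connected x (idx g) (idx g′) (φ⇒ e) (φ⇒ e′) in
          subst₂ (Reach G (λ u → φ u ≡ just x)) (vert-idx g) (vert-idx g′) (walk⇒reach φ-vert k (φ⇒ e′))
      ; edges = λ x y e → let (i , j , bx , by , e′) = edges x y e in vert i , vert j , φ-vert bx , φ-vert by , e′ }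

  -- A clique model with at least as many parts as `H` has vertices contains one of `H`. Thus
  -- excluding the tree closure alone already excludes a clique minor.
  clique⇒minor : ∀ H r → length (enum H) ≤ r → Ranking.Clique E′ E′? E′-sym r → H ≼ G
  clique⇒minor H r le cl = Minor.minor H (λ x → B (pos x)) (λ x → B? (pos x)) (λ x → nonempty (pos x))
      (λ x y i bx by → pos-injective (disjoint _ _ i bx by)) (λ x → connected (pos x)) edge
    where
    open Ranking.Clique cl
    pos : V H → Fin r
    pos x = Fin.inject≤ (Any.index (complete H x)) le
    pos-injective : ∀ {x y} → pos x ≡ pos y → x ≡ y
    pos-injective {x} {y} e = trans (lookup-index (complete H x)) (trans (cong (lookup (enum H)) (FinP.inject≤-injective le le _ _ e)) (sym (lookup-index (complete H y))))
    edge : ∀ x y → E H x y → ∃[ i ] ∃[ j ] (B (pos x) i × B (pos y) j × E′ i j)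
    edge x y e with FinP.<-cmp (pos x) (pos y)
    ... | tri< l _ _ = adjacent (pos x) (pos y) l
    ... | tri> _ _ l = let (i , j , bi , bj , f) = adjacent (pos y) (pos x) l in j , i , bj , bi , E′-sym f
    ... | tri≈ _ q _ = ⊥-elim (E-irr H (subst (E H x) (sym (pos-injective q)) e))

  tree⇒minor : ∀ k t → TreeModel E′ E′? E′-sym k t → C⟨ suc t , k ⟩ ≼ G
  tree⇒minor k t tm = Minor.minor C⟨ suc t , k ⟩ (λ x i → i ∈ f (word x)) (λ x i → Any.any? (i FinP.≟_) (f (word x)))
      (λ x → let (i , m , _) = connected (word x) (short x) in i , m)
      (λ x y i a b → word-injective x y (disjoint (word x) (word y) i (short x) (short y) a b))
      conn edge
    where
    open TreeModel tm
    word : TreeV (suc t) k → List (Fin k)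
    word (l , u) = toList u
    length-word : ∀ x → length (word x) ≡ toℕ (proj₁ x)
    length-word (l , u) = length-toList u
    short : ∀ x → length (word x) ≤ t
    short x = ≤-trans (≤-reflexive (length-word x)) (s≤s⁻¹ (FinP.toℕ<n (proj₁ x)))
    word-injective : ∀ x y → word x ≡ word y → x ≡ y
    word-injective x@(l , u) y@(m , w) e = go (FinP.toℕ-injective (trans (sym (length-word x)) (trans (cong length e) (length-word y)))) w e
      where
      go : ∀ {m} → l ≡ m → (w : Vec (Fin k) (toℕ m)) → toList u ≡ toList w → (l , u) ≡ (m , w)
      go refl w e = cong (l ,_) (toList-injective u w e)
    conn : ∀ x i j → i ∈ f (word x) → j ∈ f (word x) → ∃[ ℓ ] Walk (_∈ f (word x)) ℓ i j
    conn x i j mi mj with connected (word x) (short x)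
    ... | c , _ , h = let (ℓ , k₁) = h i mi ; (ℓ′ , k₂) = h j mj in ℓ + ℓ′ , walk-++ (walk-rev k₁ mi) k₂
    down : ∀ x y → Anc x y → ∃[ i ] ∃[ j ] (i ∈ f (word x) × j ∈ f (word y) × E′ i j)
    down x y (p , l) with prefix⇒++ p
    ... | a ∷ q , e = let (i , j , mi , mj , g) = edges (word x) a q (≤-trans (≤-reflexive (cong length (sym e))) (short y)) in
                      i , j , mi , subst (λ z → j ∈ f z) (sym e) mj , g
    ... | [] , e = ⊥-elim (<-irrefl (trans (sym (length-word x)) (trans (cong length (trans (sym (ListP.++-identityʳ (word x))) (sym e))) (length-word y))) l)
    edge : ∀ x y → E C⟨ suc t , k ⟩ x y → ∃[ i ] ∃[ j ] (i ∈ f (word x) × j ∈ f (word y) × E′ i j)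
    edge x y (inj₁ a) = down x y a
    edge x y (inj₂ a) = let (i , j , mi , mj , g) = down y x a in j , i , mj , mi , E′-sym g

-- From the weighted bound to a fractional colouring

module FractionalCover {s k r m₁ : ℕ} (consts : Constants s k r m₁)
  (p q A B : ℕ) (1≤q : 1 ≤ q) (1≤A : 1 ≤ A) (Q-eq : suc m₁ ≡ A + 6) (1≤B : 1 ≤ B) (B-eq : B ≡ suc s * suc (suc m₁)) (qB<pA : q * B < p * A)
  {n : ℕ} (E : Fin n → Fin n → Set) (E? : ∀ u v → Dec (E u v)) (E-sym : ∀ {u v} → E u v → E v u)
  (¬clique : ¬ Ranking.Clique E E? E-sym (suc (suc r))) (¬tree : ¬ TreeModel E E? E-sym k (suc s)) where
  open Walks E E? E-sym

  Good : (Fin n → Set) → Set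
  Good P = ∀ v → P v → ∃[ ys ] (length ys ≤ Constants.clustering consts × (∀ ℓ x → Walk P ℓ v x → P x → x ∈ ys))

  oracle : ∀ w → Σ (Fin n → Set) λ P → Σ (Decidable P) λ P? → Good P × A * ∑ w ≤ B * wt w P?
  oracle w = let (P , P? , good , le) = Oracle.heavy-set consts E E? E-sym ¬clique ¬tree w
             in P , P? , good , +-cancelʳ-≤ (6 * ∑ w) (A * ∑ w) (B * wt w P?) (begin
                  A * ∑ w + 6 * ∑ w ≡⟨ trans (sym (*-distribʳ-+ (∑ w) A 6)) (cong (_* ∑ w) (sym Q-eq)) ⟩
                  suc m₁ * ∑ w ≤⟨ le ⟩
                  suc s * (suc (suc m₁) * wt w P?) + 6 * ∑ w ≡⟨ cong (_+ 6 * ∑ w) (trans (sym (*-assoc (suc s) (suc (suc m₁)) (wt w P?))) (cong (_* wt w P?) (sym B-eq))) ⟩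
                  B * wt w P? + 6 * ∑ w ∎)
    where open ≤-Reasoning

  fractional-cover : ∃[ T′ ] Σ (ℕ → Fin n → Set) λ chosen → Σ (∀ i → Decidable (chosen i)) λ chosen? →
    1 ≤ T′ × (∀ i → Good (chosen i)) × (∀ v → q * T′ ≤ # (p * T′) (λ i → chosen? i v))
  fractional-cover = T′ , chosen , chosen? , s≤s z≤n , good , λ v → ≤-trans (covered v) (≤-reflexive (hits-# (p * T′) v))
    where
    open MultiplicativeWeights A B p q 1≤A 1≤q 1≤B qB<pA using (module Run)
    open Run Good oracle
    hits-# : ∀ T v → hits T v ≡ # T (λ i → chosen? i v)
    hits-# zero    v = refl
    hits-# (suc T) v = cong (ind (chosen? T v) 1 +_) (hits-# T v)

module Colouring (G : Graph) (c : ℕ) (t : ℚ) (p q T′ : ℕ) (1≤q : 1 ≤ q) (1≤T′ : 1 ≤ T′) (t-eq : t ℚ.* ι q ≡ ι p) where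
  open Numbering G
  open Walks E′ E′? E′-sym

  module _ (chosen : ℕ → Fin n → Set) (chosen? : ∀ i → Decidable (chosen i))
           (good : ∀ i v → chosen i v → ∃[ ys ] (length ys ≤ c × (∀ ℓ x → Walk (chosen i) ℓ v x → chosen i x → x ∈ ys)))
           (covered : ∀ v → q * T′ ≤ # (p * T′) (λ i → chosen? i v)) where
    τ D : ℕ
    τ = p * T′
    D = q * T′

    -- Every set gets weight `1 / D`: the `p * T′` sets then have total weight `p / q`, which is
    -- `t`, and each vertex lies in at least `D` of them.
    recip : ∃[ a ] (0ℚ ℚ.≤ a × a ℚ.≤ 1ℚ × ι D ℚ.* a ≡ 1ℚ)
    recip = reciprocal D (*-mono-≤ 1≤q 1≤T′)

    a : ℚ
    a = proj₁ recip

    Y : Fin τ → V G → Bool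
    Y i v = does (chosen? (toℕ i) (idx v))

    sum-count : ∀ T v → sumFin T (λ i → if does (chosen? (toℕ i) v) then a else 0ℚ) ≡ ι (# T (λ i → chosen? i v)) ℚ.* a
    sum-count zero v = sym (ℚP.*-zeroˡ a)
    sum-count (suc T) v = trans (sumFin-last T (λ i → if does (chosen? i v) then a else 0ℚ)) (trans (cong₂ ℚ._+_ (one (chosen? T v)) (sum-count T v))
        (trans (sym (ℚP.*-distribʳ-+ a (ι (ind (chosen? T v) 1)) (ι (# T (λ i → chosen? i v))))) (cong (ℚ._* a) (sym (ι-+ (ind (chosen? T v) 1) (# T (λ i → chosen? i v)))))))
      where
      one : ∀ {X : Set} (d : Dec X) → (if does d then a else 0ℚ) ≡ ι (ind d 1) ℚ.* a
      one (yes _) = sym (ℚP.*-identityˡ a)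
      one (no _)  = sym (ℚP.*-zeroˡ a)

    total-weight : sumFin τ (λ _ → a) ℚ.≤ t
    total-weight = ℚP.≤-reflexive (begin
      sumFin τ (λ _ → a)         ≡⟨ sumFin-const τ a ⟩
      ι (p * T′) ℚ.* a           ≡⟨ cong (ℚ._* a) (trans (ι-* p T′) (cong (ℚ._* ι T′) (sym t-eq))) ⟩
      t ℚ.* ι q ℚ.* ι T′ ℚ.* a   ≡⟨ cong (ℚ._* a) (trans (ℚP.*-assoc t (ι q) (ι T′)) (cong (t ℚ.*_) (sym (ι-* q T′)))) ⟩
      t ℚ.* ι D ℚ.* a            ≡⟨ ℚP.*-assoc t (ι D) a ⟩
      t ℚ.* (ι D ℚ.* a)          ≡⟨ cong (t ℚ.*_) (proj₂ (proj₂ (proj₂ recip))) ⟩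
      t ℚ.* 1ℚ                   ≡⟨ ℚP.*-identityʳ t ⟩
      t ∎)
      where open ≡-Reasoning

    covering : ∀ v → 1ℚ ℚ.≤ sumFin τ (λ i → if Y i v then a else 0ℚ)
    covering v = subst₂ ℚ._≤_ (proj₂ (proj₂ (proj₂ recip))) (sym (sum-count τ (idx v)))
      (ℚP.*-monoʳ-≤-nonNeg a {{ℚ.nonNegative (proj₁ (proj₂ recip))}} (ι-mono (covered (idx v))))

    does⇒ : ∀ {X : Set} (d : Dec X) → T (does d) → X
    does⇒ (yes x) _ = x

    clustered : ∀ i → ClusteringAtMost G (λ v → T (Y i v)) c
    clustered i v tv = let (ys , len , h) = good (toℕ i) (idx v) (does⇒ (chosen? (toℕ i) (idx v)) tv) in
      map vert ys , ≤-trans (≤-reflexive (length-map vert ys)) len ,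
      λ u r → let (ℓ , k′ , cu) = reach⇒walk {Q = chosen (toℕ i)} (λ {x} → does⇒ (chosen? (toℕ i) (idx x))) r in
        subst (_∈ map vert ys) (vert-idx u) (∈-map⁺ vert (h ℓ (idx u) k′ cu))

    result : FracClustered G t c
    result = τ , Y , (λ _ → a) , clustered , (λ _ → proj₁ (proj₂ recip) , proj₁ (proj₂ (proj₂ recip))) , total-weight , covering

-- With z = q (s + 1) < p, the loss of 6 / Q in the weighted bound is affordable for Q = 7 z + 7.
upper-bound : ∀ s k t → 0ℚ ℚ.< t → ι (suc s) ℚ.< t → ∃[ c ] (∀ G → ¬ C⟨ suc (suc s) , k ⟩ ≼ G → FracClustered G t c)
upper-bound s k t t>0 lt = let (p , q , 1≤q , t-eq) = fraction t t>0 in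
    main p q 1≤q t-eq (above p q 1≤q t-eq) _ ≤-refl
  where
  above : ∀ p q → 1 ≤ q → t ℚ.* ι q ≡ ι p → q * suc s < p
  above p q@(suc _) _ t-eq = ≰⇒> (λ le → ℚP.<-irrefl refl (ℚP.<-≤-trans
    (subst₂ ℚ._<_ (trans (sym (ι-* (suc s) q)) (cong ι (*-comm (suc s) q))) t-eq (ℚP.*-monoˡ-<-pos (ι q) lt)) (ι-mono le)))
  module _ (p q : ℕ) (1≤q : 1 ≤ q) (t-eq : t ℚ.* ι q ≡ ι p) (z<p : q * suc s < p) where
    z : ℕ
    z = q * suc s
    enough-room : q * (suc s * (8 + 7 * z)) < p * suc (7 * z)
    enough-room = begin-strict
      q * (suc s * (8 + 7 * z)) ≡⟨ sym (*-assoc q (suc s) (8 + 7 * z)) ⟩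
      z * (8 + 7 * z)           <⟨ n<1+n _ ⟩
      suc (z * (8 + 7 * z))     ≡⟨ arith z ⟩
      suc z * suc (7 * z)       ≤⟨ *-monoˡ-≤ (suc (7 * z)) z<p ⟩
      p * suc (7 * z) ∎
      where
      open ≤-Reasoning
      arith : ∀ z → 1 + z * (8 + 7 * z) ≡ (1 + z) * (1 + 7 * z)
      arith = solve-∀
    bound-for : ∀ {r m₁} A B → length (enum C⟨ suc (suc s) , k ⟩) ≤ r → Constants s k r m₁ → 1 ≤ A → suc m₁ ≡ A + 6 → 1 ≤ B →
      B ≡ suc s * suc (suc m₁) → q * B < p * A → ∃[ c ] (∀ G → ¬ C⟨ suc (suc s) , k ⟩ ≼ G → FracClustered G t c)
    bound-for {r} A B r-ok consts 1≤A Q-eq 1≤B B-eq lt′ = Constants.clustering consts , λ G ¬minor →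
      let open Numbering G
          (T′ , chosen , chosen? , 1≤T′ , good , covered) = FractionalCover.fractional-cover consts p q A B 1≤q 1≤A Q-eq 1≤B B-eq lt′ E′ E′? E′-sym
            (λ cl → ¬minor (clique⇒minor C⟨ suc (suc s) , k ⟩ (suc (suc r)) (m≤n⇒m≤1+n (m≤n⇒m≤1+n r-ok)) cl))
            (λ tm → ¬minor (tree⇒minor k (suc s) tm))
      in Colouring.result G (Constants.clustering consts) t p q T′ 1≤q 1≤T′ t-eq chosen chosen? good covered
    main : ∀ r → length (enum C⟨ suc (suc s) , k ⟩) ≤ r → ∃[ c ] (∀ G → ¬ C⟨ suc (suc s) , k ⟩ ≼ G → FracClustered G t c)
    main r r-ok = bound-for (suc (7 * z)) (suc s * (8 + 7 * z)) r-ok (constants s k r (6 + 7 * z)) (s≤s z≤n) (cong suc (+-comm 6 (7 * z))) (s≤s z≤n) refl enough-room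

-- The lower bound

module Levels (k : ℕ) where
  -- Every level of the tree has total weight k ^ (m - 1).
  levels : ℕ → (List (Fin k) → ℕ) → ℕ
  levels zero    g = 0
  levels (suc m) g = k ^ m * g [] + ∑ (λ a → levels m (λ q → g (a ∷ q)))

  levels-zero : ∀ m g → (∀ q → length q < m → g q ≡ 0) → levels m g ≡ 0
  levels-zero zero    g h = refl
  levels-zero (suc m) g h = cong₂ _+_ (trans (cong (k ^ m *_) (h [] (s≤s z≤n))) (*-zeroʳ (k ^ m)))
                                      (∑-0 (λ a → levels-zero m _ (λ q l → h (a ∷ q) (s≤s l))))

  levels-mono : ∀ m {g g′} → (∀ q → g q ≤ g′ q) → levels m g ≤ levels m g′
  levels-mono zero    h = z≤n
  levels-mono (suc m) h = +-mono-≤ (*-monoʳ-≤ (k ^ m) (h [])) (∑-mono (λ a → levels-mono m (λ q → h (a ∷ q))))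

  levels-one : ∀ m → levels (suc m) (λ _ → 1) ≡ suc m * k ^ m
  levels-one zero = cong suc (∑-0 {k} (λ _ → refl))
  levels-one (suc m) = cong₂ _+_ (*-identityʳ (k ^ suc m))
    (trans (∑-const k (levels (suc m) (λ _ → 1))) (trans (cong (k *_) (levels-one m)) (*-swap k (suc m) (k ^ m))))

  -- In the closure all descendants of `u` are its neighbours, so a defect bounds the number of
  -- subtrees below `u` that meet the set.
  Sparse : ℕ → ℕ → (List (Fin k) → ℕ) → Set
  Sparse d m g = ∀ u → length u < m → 0 < g u →
    ∃[ as ] (length as ≤ d × (∀ a q → length (u ++ a ∷ q) < m → 0 < g (u ++ a ∷ q) → a ∈ as))

  -- If the root is outside the set, the bounds for the `k` subtrees add up. Otherwise at most `d`
  -- subtrees meet the set, and even counted in full they are of lower order in `k`.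
  sparse-levels : ∀ d m g → (∀ q → g q ≤ 1) → Sparse d (suc m) g → k * levels (suc m) g ≤ k ^ suc m + d * m * k ^ m
  sparse-levels d zero g g≤1 sp = ≤-trans (*-monoʳ-≤ k (≤-trans (≤-reflexive (cong₂ _+_ (+-identityʳ (g [])) (∑-0 {k} (λ _ → refl))))
      (≤-trans (≤-reflexive (+-identityʳ (g []))) (g≤1 [])))) (m≤m+n _ _)
  sparse-levels d (suc m) g g≤1 sp = go (g []) refl
    where
    open ≤-Reasoning
    sub : Fin k → ℕ
    sub a = levels (suc m) (λ q → g (a ∷ q))
    go : ∀ x → g [] ≡ x → k * (k ^ suc m * g [] + ∑ sub) ≤ k ^ suc (suc m) + d * suc m * k ^ suc m
    go zero e = begin
      k * (k ^ suc m * g [] + ∑ sub) ≡⟨ cong (λ x → k * (x + ∑ sub)) (trans (cong (k ^ suc m *_) e) (*-zeroʳ (k ^ suc m))) ⟩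
      k * ∑ sub ≡⟨ sym (∑-*ˡ k sub) ⟩
      ∑ (λ a → k * sub a) ≤⟨ ∑-mono (λ a → sparse-levels d m (λ q → g (a ∷ q)) (λ q → g≤1 (a ∷ q)) (λ u l p →
          let (as , len , h) = sp (a ∷ u) (s≤s l) p in as , len , λ b q l′ p′ → h b q (s≤s l′) p′)) ⟩
      ∑ {k} (λ _ → k ^ suc m + d * m * k ^ m) ≡⟨ ∑-const k (k ^ suc m + d * m * k ^ m) ⟩
      k * (k ^ suc m + d * m * k ^ m) ≡⟨ trans (*-distribˡ-+ k (k ^ suc m) (d * m * k ^ m)) (cong (k ^ suc (suc m) +_) (*-swap k (d * m) (k ^ m))) ⟩
      k ^ suc (suc m) + d * m * k ^ suc m ≤⟨ +-monoʳ-≤ (k ^ suc (suc m)) (*-monoˡ-≤ (k ^ suc m) (*-monoʳ-≤ d (n≤1+n m))) ⟩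
      k ^ suc (suc m) + d * suc m * k ^ suc m ∎
    go (suc x) e with sp [] (s≤s z≤n) (≤-trans (s≤s z≤n) (≤-reflexive (sym e)))
    ... | as , len , h = begin
      k * (k ^ suc m * g [] + ∑ sub) ≤⟨ *-monoʳ-≤ k (+-mono-≤ (≤-trans (*-monoʳ-≤ (k ^ suc m) (g≤1 [])) (≤-reflexive (*-identityʳ (k ^ suc m)))) few) ⟩
      k * (k ^ suc m + d * (suc m * k ^ m)) ≡⟨ arith k (k ^ suc m) d (suc m) (k ^ m) ⟩
      k ^ suc (suc m) + d * suc m * k ^ suc m ∎
      where
      arith : ∀ k x d m y → k * (x + d * (m * y)) ≡ k * x + d * m * (k * y)
      arith = solve-∀
      in? : Decidable (_∈ as)
      in? a = Any.any? (a FinP.≟_) as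
      few : ∑ sub ≤ d * (suc m * k ^ m)
      few = begin
        ∑ sub ≤⟨ ∑-mono (λ a → [ (λ i → ≤-reflexive (sym (ind-yes (in? a) i)))
                               , (λ ni → ≤-trans (≤-reflexive (levels-zero (suc m) _ (λ q l → n≤0⇒n≡0 (≮⇒≥ (λ p → ni (h a q (s≤s l) p)))))) z≤n) ]′ (toSum (in? a))) ⟩
        ∑ (λ a → ind (in? a) (sub a)) ≤⟨ cover in? sub as (λ a i → i) ⟩
        sum (map sub as) ≤⟨ sum-≤ sub (suc m * k ^ m) as (λ a _ → ≤-trans (levels-mono (suc m) (λ q → g≤1 (a ∷ q))) (≤-reflexive (levels-one m))) ⟩
        length as * (suc m * k ^ m) ≤⟨ *-monoˡ-≤ (suc m * k ^ m) len ⟩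
        d * (suc m * k ^ m) ∎

module Averaging (s : ℕ) (α : Fin s → ℚ) (α≥0 : ∀ i → 0ℚ ℚ.≤ α i) where
  sumFin-cong : ∀ {s} {f g : Fin s → ℚ} → (∀ i → f i ≡ g i) → sumFin s f ≡ sumFin s g
  sumFin-cong {zero}  h = refl
  sumFin-cong {suc s} h = cong₂ ℚ._+_ (h zero) (sumFin-cong (h ∘ suc))

  sumFin-mono : ∀ {s} {f g : Fin s → ℚ} → (∀ i → f i ℚ.≤ g i) → sumFin s f ℚ.≤ sumFin s g
  sumFin-mono {zero}  h = ℚP.≤-refl
  sumFin-mono {suc s} h = ℚP.+-mono-≤ (h zero) (sumFin-mono (h ∘ suc))

  sumFin-+ : ∀ {s} (f g : Fin s → ℚ) → sumFin s (λ i → f i ℚ.+ g i) ≡ sumFin s f ℚ.+ sumFin s g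
  sumFin-+ {zero}  f g = refl
  sumFin-+ {suc s} f g = trans (cong (f zero ℚ.+ g zero ℚ.+_) (sumFin-+ (f ∘ suc) (g ∘ suc))) (interchange (f zero) (g zero) (sumFin s (f ∘ suc)) (sumFin s (g ∘ suc)))
    where
    interchange : ∀ a b c d → (a ℚ.+ b) ℚ.+ (c ℚ.+ d) ≡ (a ℚ.+ c) ℚ.+ (b ℚ.+ d)
    interchange a b c d = trans (ℚP.+-assoc a b (c ℚ.+ d)) (trans (cong (a ℚ.+_) (trans (sym (ℚP.+-assoc b c d)) (trans (cong (ℚ._+ d) (ℚP.+-comm b c)) (ℚP.+-assoc c b d)))) (sym (ℚP.+-assoc a c (b ℚ.+ d))))

  sumFin-*ʳ : ∀ {s} (f : Fin s → ℚ) c → sumFin s (λ i → f i ℚ.* c) ≡ sumFin s f ℚ.* c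
  sumFin-*ʳ {zero}  f c = sym (ℚP.*-zeroˡ c)
  sumFin-*ʳ {suc s} f c = trans (cong (f zero ℚ.* c ℚ.+_) (sumFin-*ʳ (f ∘ suc) c)) (sym (ℚP.*-distribʳ-+ c (f zero) _))

  -- Weak duality: the covering inequalities of the vertices have this form and are combined with
  -- the level weights as multipliers.
  Dominated : ℕ → (Fin s → ℕ) → Set
  Dominated c f = ι c ℚ.≤ sumFin s (λ i → α i ℚ.* ι (f i))

  dom-0 : Dominated 0 (λ _ → 0)
  dom-0 = ℚP.≤-reflexive (sym (trans (sumFin-*ʳ α (ι 0)) (ℚP.*-zeroʳ (sumFin s α))))

  dom-+ : ∀ {c c′ f f′} → Dominated c f → Dominated c′ f′ → Dominated (c + c′) (λ i → f i + f′ i)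
  dom-+ {c} {c′} {f} {f′} h h′ = subst₂ ℚ._≤_ (sym (ι-+ c c′))
    (trans (sym (sumFin-+ (λ i → α i ℚ.* ι (f i)) (λ i → α i ℚ.* ι (f′ i))))
           (sumFin-cong (λ i → trans (sym (ℚP.*-distribˡ-+ (α i) (ι (f i)) (ι (f′ i)))) (cong (α i ℚ.*_) (sym (ι-+ (f i) (f′ i)))))))
    (ℚP.+-mono-≤ h h′)

  dom-* : ∀ N {c f} → Dominated c f → Dominated (N * c) (λ i → N * f i)
  dom-* zero    h = dom-0
  dom-* (suc N) h = dom-+ h (dom-* N h)

  dom-∑ : ∀ {k} {c : Fin k → ℕ} {f : Fin s → Fin k → ℕ} → (∀ a → Dominated (c a) (λ i → f i a)) → Dominated (∑ c) (λ i → ∑ (f i))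
  dom-∑ {zero}  h = dom-0
  dom-∑ {suc k} h = dom-+ (h zero) (dom-∑ (h ∘ suc))

  dom-levels : ∀ {k} m (y : Fin s → List (Fin k) → ℕ) → (∀ q → length q < m → Dominated 1 (λ i → y i q)) →
               Dominated (Levels.levels k m (λ _ → 1)) (λ i → Levels.levels k m (y i))
  dom-levels zero y h = dom-0
  dom-levels {k} (suc m) y h = dom-+ (dom-* (k ^ m) (h [] (s≤s z≤n))) (dom-∑ (λ a → dom-levels m (λ i q → y i (a ∷ q)) (λ q l → h (a ∷ q) (s≤s l))))

  dom-≤ : ∀ {c f B t} → Dominated c f → (∀ i → f i ≤ B) → sumFin s α ℚ.≤ t → ι c ℚ.≤ t ℚ.* ι B
  dom-≤ {c} {f} {B} {t} h f≤B Σα≤t = ℚP.≤-trans h (ℚP.≤-trans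
    (sumFin-mono (λ i → ℚP.*-monoˡ-≤-nonNeg (α i) {{ℚ.nonNegative (α≥0 i)}} (ι-mono (f≤B i))))
    (ℚP.≤-trans (ℚP.≤-reflexive (sumFin-*ʳ α (ι B))) (ℚP.*-monoʳ-≤-nonNeg (ι B) Σα≤t)))

module Words (H k : ℕ) where
  word : TreeV H k → List (Fin k)
  word (l , u) = toList u

  node : ∀ q → length q < H → TreeV H k
  node q l = fromℕ< l , subst (Vec (Fin k)) (sym (FinP.toℕ-fromℕ< l)) (fromList q)

  word-node : ∀ q l → word (node q l) ≡ q
  word-node q l = trans (toList-subst (sym (FinP.toℕ-fromℕ< l)) (fromList q)) (toList∘fromList q)
    where
    toList-subst : ∀ {m n} (e : m ≡ n) (u : Vec (Fin k) m) → toList (subst (Vec (Fin k)) e u) ≡ toList u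
    toList-subst refl u = refl

  ++-prefix : ∀ (u q : List (Fin k)) → Prefix _≡_ u (u ++ q)
  ++-prefix []      q = []
  ++-prefix (a ∷ u) q = refl ∷ ++-prefix u q

  node-anc : ∀ u a q l l′ → Anc (node u l) (node (u ++ a ∷ q) l′)
  node-anc u a q l l′ = subst₂ (Prefix _≡_) (sym (word-node u l)) (sym (word-node (u ++ a ∷ q) l′)) (++-prefix u (a ∷ q))
    , subst₂ _<_ (sym (FinP.toℕ-fromℕ< l)) (sym (FinP.toℕ-fromℕ< l′)) (≤-trans (m<m+n (length u) (s≤s z≤n)) (≤-reflexive (sym (length-++ u))))

  module _ (Y : TreeV H k → Bool) where
    value : ∀ q → Dec (length q < H) → ℕ
    value q (yes l) = if Y (node q l) then 1 else 0
    value q (no _)  = 0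

    y : List (Fin k) → ℕ
    y q = value q (length q <? H)

    y≤1 : ∀ q → y q ≤ 1
    y≤1 q = go (length q <? H)
      where
      bit : ∀ c → (if c then 1 else 0) ≤ 1
      bit true = ≤-refl
      bit false = z≤n
      go : ∀ d → value q d ≤ 1
      go (yes l) = bit (Y (node q l))
      go (no _) = z≤n

    y-pos : ∀ q → 0 < y q → Σ (length q < H) λ l → T (Y (node q l))
    y-pos q = go (length q <? H)
      where
      bit : ∀ c → 0 < (if c then 1 else 0) → T c
      bit true _ = tt
      go : ∀ d → 0 < value q d → Σ (length q < H) λ l → T (Y (node q l))
      go (yes l) p = l , bit (Y (node q l)) p

    y-value : ∀ q (l : length q < H) a → (if Y (node q l) then a else 0ℚ) ≡ a ℚ.* ι (y q)
    y-value q l a = go (length q <? H)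
      where
      bit : ∀ c a → (if c then a else 0ℚ) ≡ a ℚ.* ι (if c then 1 else 0)
      bit true  a = sym (ℚP.*-identityʳ a)
      bit false a = sym (ℚP.*-zeroʳ a)
      go : ∀ d → (if Y (node q l) then a else 0ℚ) ≡ a ℚ.* ι (value q d)
      go (yes l′) = trans (cong (λ l → if Y (node q l) then a else 0ℚ) (≤-irrelevant l l′)) (bit (Y (node q l′)) a)
      go (no ¬l) = ⊥-elim (¬l l)

    sparse : ∀ d → DefectAtMost C⟨ H , k ⟩ (λ v → T (Y v)) d → Levels.Sparse k d H y
    sparse d def u _ p with y-pos u p
    ... | l , tu with def (node u l) tu
    ...   | xs , len , h = letters xs , ≤-trans (length-letters xs) len , λ a q _ p′ →
            let (l′ , tv) = y-pos (u ++ a ∷ q) p′ in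
            letter∈ (h (node (u ++ a ∷ q) l′) (tv , inj₁ (node-anc u a q l l′))) (word-node (u ++ a ∷ q) l′)
      where
      letter : TreeV H k → List (Fin k)
      letter x = take 1 (drop (length u) (word x))
      letters : List (TreeV H k) → List (Fin k)
      letters []       = []
      letters (x ∷ xs) = letter x ++ letters xs
      length-letters : ∀ xs → length (letters xs) ≤ length xs
      length-letters []       = z≤n
      length-letters (x ∷ xs) = ≤-trans (≤-reflexive (length-++ (letter x)))
        (+-mono-≤ (≤-trans (≤-reflexive (length-take 1 (drop (length u) (word x)))) (m⊓n≤m 1 _)) (length-letters xs))
      drop-++ : ∀ (u : List (Fin k)) {q} → drop (length u) (u ++ q) ≡ q
      drop-++ []      = refl
      drop-++ (_ ∷ u) = drop-++ u
      letter∈ : ∀ {x xs a q} → x ∈ xs → word x ≡ u ++ a ∷ q → a ∈ letters xs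
      letter∈ {x} {a = a} (here refl) e = ∈-++⁺ˡ (subst (λ z → a ∈ take 1 z) (sym (trans (cong (drop (length u)) e) (drop-++ u))) (here refl))
      letter∈ {xs = x′ ∷ xs} (there i) e = ∈-++⁺ʳ (letter x′) (letter∈ i e)

lower-bound : ∀ m t → 0ℚ ℚ.< t → t ℚ.< ι (suc m) → ∀ d → ∃[ k ] ¬ FracDefective C⟨ suc m , k ⟩ t d
lower-bound m t t>0 lt d with fraction t t>0
... | p , q@(suc _) , 1≤q , t-eq = k , impossible
  where
  k : ℕ
  -- Since `p < suc m * q`, the sides differ by at least `k` before the defect is counted, and the
  -- defect contributes only `p * (d * m)`.
  k = suc (p * (d * m))
  below : p < suc m * q
  below = ≰⇒> (λ le → ℚP.<-irrefl refl (ℚP.≤-<-trans (ι-mono le) (subst₂ ℚ._<_ t-eq (sym (ι-* (suc m) q)) (ℚP.*-monoˡ-<-pos (ι q) lt))))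
  impossible : ¬ FracDefective C⟨ suc m , k ⟩ t d
  impossible (s , Y , α , good , α-ok , Σα≤t , covering) = <-irrefl refl (begin-strict
      p * k + k                     ≡⟨ +-comm (p * k) k ⟩
      suc p * k                     ≤⟨ *-monoˡ-≤ k below ⟩
      suc m * q * k                 ≤⟨ *-cancelˡ-≤ (k ^ m) {{m^n≢0 k m}} weighed ⟩
      p * (k + d * m)               ≡⟨ *-distribˡ-+ p k (d * m) ⟩
      p * k + p * (d * m)           <⟨ +-monoʳ-< (p * k) (n<1+n (p * (d * m))) ⟩
      p * k + k                     ∎)
    where
    open ≤-Reasoning
    module W = Words (suc m) k
    module L = Levels k
    open Averaging s α (λ i → proj₁ (α-ok i))
    bound : ℕ
    bound = k ^ suc m + d * m * k ^ m
    covered : ∀ u → length u < suc m → Dominated 1 (λ i → W.y (Y i) u)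
    covered u l = subst (1ℚ ℚ.≤_) (sumFin-cong (λ i → value-at i)) (covering (W.node u l))
      where
      value-at : ∀ i → (if Y i (W.node u l) then α i else 0ℚ) ≡ α i ℚ.* ι (W.y (Y i) u)
      value-at i = W.y-value (Y i) u l (α i)
    dominated : ι (k * (suc m * k ^ m)) ℚ.≤ t ℚ.* ι bound
    dominated = dom-≤ {f = λ i → k * L.levels (suc m) (W.y (Y i))}
      (subst (λ c → Dominated (k * c) (λ i → k * L.levels (suc m) (W.y (Y i)))) (L.levels-one m) (dom-* k (dom-levels (suc m) (λ i → W.y (Y i)) covered)))
      (λ i → L.sparse-levels d m (W.y (Y i)) (W.y≤1 (Y i)) (W.sparse (Y i) d (good i))) Σα≤t
    weighed : k ^ m * (suc m * q * k) ≤ k ^ m * (p * (k + d * m))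
    weighed = begin
      k ^ m * (suc m * q * k)       ≡⟨ arith₁ (k ^ m) (suc m) q k ⟩
      k * (suc m * k ^ m) * q       ≤⟨ ι-cancel (subst₂ ℚ._≤_ (sym (ι-* (k * (suc m * k ^ m)) q)) t-bound (ℚP.*-monoʳ-≤-nonNeg (ι q) dominated)) ⟩
      p * bound                     ≡⟨ arith₂ p k (k ^ m) (d * m) ⟩
      k ^ m * (p * (k + d * m)) ∎
      where
      arith₁ : ∀ x m q k → x * (m * q * k) ≡ k * (m * x) * q
      arith₁ = solve-∀
      arith₂ : ∀ p k x y → p * (k * x + y * x) ≡ x * (p * (k + y))
      arith₂ = solve-∀
      t-bound : t ℚ.* ι bound ℚ.* ι q ≡ ι (p * bound)
      t-bound = trans (ℚP.*-assoc t (ι bound) (ι q)) (trans (cong (t ℚ.*_) (ℚP.*-comm (ι bound) (ι q)))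
        (trans (sym (ℚP.*-assoc t (ι q) (ι bound))) (trans (cong (ℚ._* ι bound) t-eq) (sym (ι-* p bound)))))

-- Both chromatic numbers

frac-mono : ∀ {G} {Good Good′ : (V G → Set) → Set} {t} → (∀ P → Good P → Good′ P) → FracColouring G Good t → FracColouring G Good′ t
frac-mono f (s , Y , α , good , rest) = s , Y , α , (λ i → f (λ v → T (Y i v)) (good i)) , rest

clustered⇒defective : ∀ {G t c} → FracClustered G t c → FracDefective G t c
clustered⇒defective {G} {t} {c} = frac-mono {G} {λ P → ClusteringAtMost G P c} {λ P → DefectAtMost G P c} {t} λ P cl v pv → let (xs , len , h) = cl v pv in
  xs , len , λ u (pu , e) → h u (step pv e (stay pu))

-- Clustering `c` implies defect `c`, so an upper bound for clustering and a lower bound for defect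
-- settle both numbers.
inf-equals : ∀ 𝒢 r → (∀ t → 0ℚ ℚ.< t → ι r ℚ.< t → ∃[ c ] (∀ G → 𝒢 G → FracClustered G t c)) →
  (∀ t → 0ℚ ℚ.< t → t ℚ.< ι r → ∀ d → ∃[ G ] (𝒢 G × ¬ FracDefective G t d)) →
  FracDefectiveChromaticNumber≡ 𝒢 r × FracClusteredChromaticNumber≡ 𝒢 r
inf-equals 𝒢 r upper lower =
    ( (λ t pos above → let (c , h) = upper′ t pos above in c , λ G g → clustered⇒defective {G} {t} (h G g))
    , (λ t pos below (d , h) → let (G , g , ¬def) = lower′ t pos below d in ¬def (h G g)) )
  , ( upper′
    , (λ t pos below (c , h) → let (G , g , ¬def) = lower′ t pos below c in ¬def (clustered⇒defective {G} {t} (h G g))) )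
  where
  upper′ : ∀ t → 0ℚ ℚ.< t → ℤ.+ r ℚ./ 1 ℚ.< t → ∃[ c ] (∀ G → 𝒢 G → FracClustered G t c)
  upper′ t pos above = upper t pos (subst (ℚ._< t) (ι-/1 r) above)
  lower′ : ∀ t → 0ℚ ℚ.< t → t ℚ.< ℤ.+ r ℚ./ 1 → ∀ d → ∃[ G ] (𝒢 G × ¬ FracDefective G t d)
  lower′ t pos below = lower t pos (subst (t ℚ.<_) (ι-/1 r) below)

vertex⇒minor : ∀ G k → V G → C⟨ 1 , k ⟩ ≼ G
vertex⇒minor G k v = tree⇒minor k 0 (record
  { f         = λ _ → idx v ∷ []
  ; connected = λ _ _ → idx v , here refl , λ { y (here refl) → 0 , here }
  ; disjoint  = λ { [] [] _ _ _ _ _ → refl }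
  ; edges     = λ { [] _ _ () ; (_ ∷ _) _ _ () } })
  where open Numbering G
        open Walks E′ E′? E′-sym

empty⇒minor : ∀ G k → C⟨ 0 , k ⟩ ≼ G
empty⇒minor G k = record { φ = λ _ → nothing ; nonempty = λ { (() , _) } ; connected = λ { (() , _) } ; edges = λ { (() , _) } }

no-vertices : ∀ G t c → 0ℚ ℚ.< t → ¬ V G → FracClustered G t c
no-vertices G t c pos ¬v = 0 , (λ ()) , (λ ()) , (λ ()) , (λ ()) , ℚP.<⇒≤ pos , λ v → ⊥-elim (¬v v)

theorem6 : (𝒢 : GraphClass) → MinorClosed 𝒢 → ProperClass 𝒢 →
    (h : ℕ) → IsTcn 𝒢 h →
    FracDefectiveChromaticNumber≡ 𝒢 (h ∸ 1) × FracClusteredChromaticNumber≡ 𝒢 (h ∸ 1)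
-- The graph `C⟨ 0 , k ⟩` has no vertices and is a minor of every graph, so the class is empty;
-- `0 ∸ 1` is `0`.
theorem6 𝒢 closed _ zero ((k , ∉𝒢) , _) = inf-equals 𝒢 0
  (λ t pos _ → 0 , λ G g → ⊥-elim (∉𝒢 (closed G C⟨ 0 , k ⟩ g (empty⇒minor G k))))
  (λ t pos below → ⊥-elim (ℚP.<-asym pos below))
-- The graph `C⟨ 1 , k ⟩` is a single vertex, so the class has only graphs without vertices, which
-- the empty family colours.
theorem6 𝒢 closed _ (suc zero) ((k , ∉𝒢) , _) = inf-equals 𝒢 0
  (λ t pos _ → 0 , λ G g → no-vertices G t 0 pos (λ v → ∉𝒢 (closed G C⟨ 1 , k ⟩ g (vertex⇒minor G k v))))
  (λ t pos below → ⊥-elim (ℚP.<-asym pos below))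
theorem6 𝒢 closed _ (suc (suc s)) ((k , ∉𝒢) , small) = inf-equals 𝒢 (suc s)
  (λ t pos above → let (c , h) = upper-bound s k t pos above in
     c , λ G g → h G (λ minor → ∉𝒢 (closed G C⟨ suc (suc s) , k ⟩ g minor)))
  (λ t pos below d → let (k′ , ¬def) = lower-bound s t pos below d in
     C⟨ suc s , k′ ⟩ , small (suc s) ≤-refl k′ , ¬def)
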